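{- Let $\ell\ne p$ be a prime and let $e_i$ be the multiplicity of $\ell^i$ as an elementary divisor of the adjacency matrix $A'$ of the Grassmann graph $\Gamma'$ on the $2$-dimensional subspaces of $V=\mathbb F_q^n$ ($n\ge4$, $q=p^t$). Put $f=[n]-1$, $g=\left[\begin{smallmatrix}n\\2\end{smallmatrix}\right]_q-[n]$, $k'=q(q+1)[n-2]$ and $r=q^2[n-3]-1$. In each case below, $e_i=0$ for all $i$ not listed. (A) Suppose $\ell\nmid q+1$. If $\ell\nmid k'r$, then $\ell\nmid|S(\Gamma')|$. Otherwise $\ell$ divides exactly one of $k'$, $r$, and: (i) if $\ell\mid k'$, with $a=v_\ell(k')$: $e_a=1$, $e_0=f+g$; (ii) if $\ell\mid r$, with $a=v_\ell(r)$: $e_a=f$, $e_0=g+1$. (B) Suppose $\ell\mid q+1$ and $n$ is even. Let $h=[(n-2)/2]_{q^2}$, $a=v_\ell(q+1)$, $b=v_\ell(qh-1)$, $c=v_\ell(h)$ (at least one of $b$, $c$ is $0$). (a) If $b=c=0$: $e_{2a}=f$, $e_a=g-f+2$, $e_0=f-1$. (b) If $b>0$ (so $c=0$): $e_{2a+b}=f$, $e_a=g-f+2$, $e_0=f-1$. (c) If $c>0$ (so $b=0$): $e_{2a+c}=1$, $e_{2a}=f-1$, $e_a=g-f+2$, $e_0=f-1$. (C) Suppose $\ell\mid q+1$ and $n$ is odd. With $a=v_\ell(q+1)$: $e_a=g+1$, $e_0=f$.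
   Context: Let $p$ be a prime, $q=p^t$ with $t\ge1$, $n\ge4$, and $V$ an $n$-dimensional vector space over $\mathbb F_q$. Notation: $[m]=\frac{q^m-1}{q-1}$, $[m]_{q^2}=\frac{q^{2m}-1}{q^2-1}$, and $\left[\begin{smallmatrix}m\\k\end{smallmatrix}\right]_q$ is the number of $k$-dimensional subspaces of $\mathbb F_q^m$; $v_\ell$ is the $\ell$-adic valuation. The Grassmann graph $\Gamma'$ has as vertices the $2$-dimensional subspaces of $V$, two distinct ones being adjacent when their intersection is nonzero; $A'$ is its adjacency matrix. The Smith group $S(\Gamma')$ is the (finite) cokernel of $A'$ over $\mathbb Z$. The multiplicity of $\ell^i$ as an elementary divisor of an integer matrix is the number of nonzero diagonal entries of its Smith normal form whose $\ell$-adic valuation is exactly $i$. -}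

module Defs where

open import Algebra.Bundles using (AbelianGroup; CommutativeRing)
open import Algebra.Module.Bundles using (Module)
import Algebra.Properties.CommutativeMonoid.Sum as CommutativeMonoidSum
import Algebra.Properties.Semiring.Sum as SemiringSum
open import Data.Bool.Base using (if_then_else_)
open import Data.Fin.Base as Fin using (Fin)
import Data.Fin.Properties as Fin
open import Data.Integer.Base as ℤ using (ℤ; +_; 0ℤ; 1ℤ)
import Data.Integer.Properties as ℤ
open import Data.Integer.Tactic.RingSolver using (solve-∀)
open import Data.List.Base using (List; length; filter; allFin; map)
open import Data.List.Membership.Propositional using (_∉_)
open import Data.List.Relation.Unary.All using (All)
open import Data.Nat.Base using (ℕ; zero; suc; _+_; _*_; _∸_; _^_; _/_)
open import Data.Nat.Divisibility using (_∣_; _∣?_)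
open import Data.Product.Base using (Σ; ∃; _×_; _,_; proj₁; proj₂)
open import Data.Vec.Functional using (Vector)
open import Function.Bundles using (Inverse)
open import Level using (Level; _⊔_; 0ℓ) renaming (suc to lsuc)
open import Relation.Binary.Bundles using (Setoid)
open import Relation.Binary.Core using (Rel)
import Relation.Binary.Construct.On as On
open import Relation.Binary.PropositionalEquality as ≡ using (_≡_; module ≡-Reasoning)
open import Relation.Nullary using (¬_; Dec; does)
open import Relation.Nullary.Decidable using (_×-dec_; ¬?)
open import Relation.Unary using (Pred; _∈_; _≐_)
open import Relation.Unary.Polymorphic using (U)
open import Relation.Unary.Relation.Binary.Equality using (≐-setoid)

private
  variable
    a b r ℓr m ℓm : Level

HasCardinality : Setoid a b → ℕ → Set (a ⊔ b)
HasCardinality S n = Inverse (≡.setoid (Fin n)) S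

-- Total division, with the convention x div 0 = 0.
_div_ : ℕ → ℕ → ℕ
x div zero  = 0
x div suc y = x / suc y

-- [k] = (qᵏ - 1) / (q - 1), meant for q ≥ 2; thus [k]_{q²} is
-- qInt (q ^ 2) k.
qInt : ℕ → ℕ → ℕ
qInt q k = (q ^ k ∸ 1) div (q ∸ 1)

-- v_p(x) = i.  No i qualifies when x = 0.
HasValuation : ℕ → ℕ → ℕ → Set
HasValuation p x i = p ^ i ∣ x × ¬ (p ^ suc i ∣ x)

hasValuation? : ∀ p x i → Dec (HasValuation p x i)
hasValuation? p x i = (p ^ i ∣? x) ×-dec ¬? (p ^ suc i ∣? x)

IsTabulatedBy : (ℕ → ℕ) → List (ℕ × ℕ) → Set
IsTabulatedBy e t =
  All (λ p → e (proj₁ p) ≡ proj₂ p) t × (∀ i → i ∉ map proj₁ t → e i ≡ 0)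

open SemiringSum ℤ.+-*-semiring
  using (∑-distrib-+; sum-cong-≋; *-distribˡ-sum) renaming (sum to sumℤ)

Matrix : ℕ → Set
Matrix n = Fin n → Fin n → ℤ

_≈ₘ_ : ∀ {n} → Rel (Matrix n) 0ℓ
A ≈ₘ B = ∀ i j → A i j ≡ B i j

infixl 7 _*ₘ_ _*ᵥ_
infix  4 _≈ₘ_

_*ₘ_ : ∀ {n} → Matrix n → Matrix n → Matrix n
(A *ₘ B) i k = sumℤ (λ j → A i j ℤ.* B j k)

_*ᵥ_ : ∀ {n} → Matrix n → Vector ℤ n → Vector ℤ n
(A *ᵥ x) i = sumℤ (λ j → A i j ℤ.* x j)

diagonal : ∀ {n} → Vector ℤ n → Matrix n
diagonal d i j = if does (i Fin.≟ j) then d i else 0ℤ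

identity : ∀ {n} → Matrix n
identity = diagonal (λ _ → 1ℤ)

Invertible : ∀ {n} → Matrix n → Set
Invertible P = ∃ λ Q → (P *ₘ Q ≈ₘ identity) × (Q *ₘ P ≈ₘ identity)

-- The diagonal entries are taken in ℕ, i.e. normalised to be
-- nonnegative, which makes them unique.
record SmithNormalForm {n} (A : Matrix n) : Set where
  field
    left             : Matrix n
    right            : Matrix n
    left-invertible  : Invertible left
    right-invertible : Invertible right
    entry            : Fin n → ℕ
    divisibility     : ∀ {i j} → i Fin.≤ j → entry i ∣ entry j
    equation         : left *ₘ A *ₘ right ≈ₘ diagonal (λ i → + entry i)

-- The multiplicity of pⁱ as an elementary divisor.  Zero entries are
-- never counted, since they have no valuation.
multiplicity : ∀ {n} {A : Matrix n} → SmithNormalForm A → ℕ → ℕ → ℕ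
multiplicity {n} S p i =
  length (filter (λ j → hasValuation? p (SmithNormalForm.entry S j) i) (allFin n))

private
  *ᵥ-+ : ∀ {n} (A : Matrix n) (x y : Vector ℤ n) i →
         (A *ᵥ (λ j → x j ℤ.+ y j)) i ≡ (A *ᵥ x) i ℤ.+ (A *ᵥ y) i
  *ᵥ-+ A x y i = ≡.trans
    (sum-cong-≋ (λ j → ℤ.*-distribˡ-+ (A i j) (x j) (y j)))
    (∑-distrib-+ (λ j → A i j ℤ.* x j) (λ j → A i j ℤ.* y j))

  *ᵥ-neg : ∀ {n} (A : Matrix n) (x : Vector ℤ n) i →
           (A *ᵥ (λ j → ℤ.- x j)) i ≡ ℤ.- (A *ᵥ x) i
  *ᵥ-neg A x i = begin
    sumℤ (λ j → A i j ℤ.* ℤ.- x j)            ≡⟨ sum-cong-≋ (λ j → swap (A i j) (x j)) ⟩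
    sumℤ (λ j → ℤ.-1ℤ ℤ.* (A i j ℤ.* x j))    ≡⟨ *-distribˡ-sum ℤ.-1ℤ (λ j → A i j ℤ.* x j) ⟨
    ℤ.-1ℤ ℤ.* (A *ᵥ x) i                      ≡⟨ ℤ.-1*i≡-i ((A *ᵥ x) i) ⟩
    ℤ.- (A *ᵥ x) i                            ∎
    where
    open ≡-Reasoning
    swap : ∀ u v → u ℤ.* ℤ.- v ≡ ℤ.-1ℤ ℤ.* (u ℤ.* v)
    swap = solve-∀

  *ᵥ-0 : ∀ {n} (A : Matrix n) i → (A *ᵥ (λ _ → 0ℤ)) i ≡ 0ℤ
  *ᵥ-0 A i = ≡.trans (sum-cong-≋ (λ j → ℤ.*-comm (A i j) 0ℤ))
                     (≡.sym (*-distribˡ-sum 0ℤ (A i)))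

-- ℤⁿ modulo the image of A.
cokernel : ∀ {n} → Matrix n → AbelianGroup 0ℓ 0ℓ
cokernel {n} A = record
  { Carrier = Vector ℤ n
  ; _≈_     = λ x y → ∃ λ z → ∀ i → x i ℤ.- y i ≡ (A *ᵥ z) i
  ; _∙_     = λ x y i → x i ℤ.+ y i
  ; ε       = λ _ → 0ℤ
  ; _⁻¹     = λ x i → ℤ.- x i
  ; isAbelianGroup = record
    { isGroup = record
      { isMonoid = record
        { isSemigroup = record
          { isMagma = record
            { isEquivalence = record
              { refl  = λ {x} → pointwise {x} {x} (λ i → ≡.refl)
              ; sym   = λ {x} {y} (z , p) → (λ j → ℤ.- z j) , λ i → begin
                  y i ℤ.- x i                  ≡⟨ flip (x i) (y i) ⟩
                  ℤ.- (x i ℤ.- y i)            ≡⟨ ≡.cong ℤ.-_ (p i) ⟩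
                  ℤ.- (A *ᵥ z) i               ≡⟨ *ᵥ-neg A z i ⟨
                  (A *ᵥ (λ j → ℤ.- z j)) i     ∎
              ; trans = λ {x} {y} {w} (z , p) (z′ , p′) → (λ j → z j ℤ.+ z′ j) , λ i → begin
                  x i ℤ.- w i                          ≡⟨ via (x i) (y i) (w i) ⟩
                  (x i ℤ.- y i) ℤ.+ (y i ℤ.- w i)      ≡⟨ ≡.cong₂ ℤ._+_ (p i) (p′ i) ⟩
                  (A *ᵥ z) i ℤ.+ (A *ᵥ z′) i           ≡⟨ *ᵥ-+ A z z′ i ⟨
                  (A *ᵥ (λ j → z j ℤ.+ z′ j)) i        ∎
              }
            ; ∙-cong = λ {x} {y} {u} {v} (z , p) (z′ , p′) → (λ j → z j ℤ.+ z′ j) , λ i → begin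
                (x i ℤ.+ u i) ℤ.- (y i ℤ.+ v i)      ≡⟨ exchange (x i) (y i) (u i) (v i) ⟩
                (x i ℤ.- y i) ℤ.+ (u i ℤ.- v i)      ≡⟨ ≡.cong₂ ℤ._+_ (p i) (p′ i) ⟩
                (A *ᵥ z) i ℤ.+ (A *ᵥ z′) i           ≡⟨ *ᵥ-+ A z z′ i ⟨
                (A *ᵥ (λ j → z j ℤ.+ z′ j)) i        ∎
            }
          ; assoc = λ x y z → pointwise (λ i → ℤ.+-assoc (x i) (y i) (z i))
          }
        ; identity = (λ x → pointwise (λ i → ℤ.+-identityˡ (x i)))
                   , (λ x → pointwise (λ i → ℤ.+-identityʳ (x i)))
        }
      ; inverse = (λ x → pointwise (λ i → ℤ.+-inverseˡ (x i)))
                , (λ x → pointwise (λ i → ℤ.+-inverseʳ (x i)))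
      ; ⁻¹-cong = λ {x} {y} (z , p) → (λ j → ℤ.- z j) , λ i → begin
          ℤ.- x i ℤ.- (ℤ.- y i)        ≡⟨ ℤ.neg-distrib-+ (x i) (ℤ.- y i) ⟨
          ℤ.- (x i ℤ.- y i)            ≡⟨ ≡.cong ℤ.-_ (p i) ⟩
          ℤ.- (A *ᵥ z) i               ≡⟨ *ᵥ-neg A z i ⟨
          (A *ᵥ (λ j → ℤ.- z j)) i     ∎
      }
    ; comm = λ x y → pointwise (λ i → ℤ.+-comm (x i) (y i))
    }
  }
  where
  open ≡-Reasoning
  pointwise : {x y : Vector ℤ n} → (∀ i → x i ≡ y i) →
              ∃ λ z → ∀ i → x i ℤ.- y i ≡ (A *ᵥ z) i
  pointwise {x} {y} eq = (λ _ → 0ℤ) , λ i →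
    ≡.trans (ℤ.i≡j⇒i-j≡0 (eq i)) (≡.sym (*ᵥ-0 A i))
  flip : ∀ u v → v ℤ.- u ≡ ℤ.- (u ℤ.- v)
  flip = solve-∀
  via : ∀ u v w → u ℤ.- w ≡ (u ℤ.- v) ℤ.+ (v ℤ.- w)
  via = solve-∀
  exchange : ∀ x y u v → (x ℤ.+ u) ℤ.- (y ℤ.+ v) ≡ (x ℤ.- y) ℤ.+ (u ℤ.- v)
  exchange = solve-∀

record IsAdjacencyMatrix {n} (_~_ : Rel (Fin n) a) (A : Matrix n) : Set a where
  field
    adjacent    : ∀ {i j} → i ~ j → A i j ≡ 1ℤ
    nonadjacent : ∀ {i j} → ¬ (i ~ j) → A i j ≡ 0ℤ

record IsFieldOfOrder (F : CommutativeRing r ℓr) (q : ℕ) : Set (r ⊔ ℓr) where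
  open CommutativeRing F using (Carrier; _≈_; 0#; 1#; setoid) renaming (_*_ to _·_)
  field
    0≉1         : ¬ (0# ≈ 1#)
    invertible  : ∀ x → ¬ (x ≈ 0#) → ∃ λ y → x · y ≈ 1#
    cardinality : HasCardinality setoid q

module _ {F : CommutativeRing r ℓr} (V : Module F m ℓm) where
  open CommutativeRing F using (Carrier; _≈_; 0#)
  open Module V
  open CommutativeMonoidSum +ᴹ-commutativeMonoid using () renaming (sum to sumᴹ)

  linearCombination : ∀ {k} → Vector Carrier k → Vector Carrierᴹ k → Carrierᴹ
  linearCombination c v = sumᴹ (λ i → c i *ₗ v i)

  LinearlyIndependent : ∀ {k} → Vector Carrierᴹ k → Set (r ⊔ ℓr ⊔ ℓm)
  LinearlyIndependent v = ∀ c → linearCombination c v ≈ᴹ 0ᴹ → ∀ i → c i ≈ 0#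

  -- The level r ⊔ ℓm is that of the span of a finite family, so every
  -- finite-dimensional subspace occurs.
  record Subspace : Set (r ⊔ m ⊔ lsuc r ⊔ lsuc ℓm) where
    field
      members   : Pred Carrierᴹ (r ⊔ ℓm)
      resp-≈    : ∀ {u v} → u ≈ᴹ v → u ∈ members → v ∈ members
      0-closed  : 0ᴹ ∈ members
      +-closed  : ∀ {u v} → u ∈ members → v ∈ members → (u +ᴹ v) ∈ members
      *ₗ-closed : ∀ c {v} → v ∈ members → (c *ₗ v) ∈ members

  open Subspace

  whole : Subspace
  whole = record
    { members   = U
    ; resp-≈    = λ _ _ → _
    ; 0-closed  = _
    ; +-closed  = λ _ _ → _
    ; *ₗ-closed = λ _ _ → _
    }

  record IsBasis (W : Subspace) {k} (v : Vector Carrierᴹ k) : Set (r ⊔ ℓr ⊔ m ⊔ ℓm) where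
    field
      in-subspace : ∀ i → v i ∈ members W
      independent : LinearlyIndependent v
      spanning    : ∀ {w} → w ∈ members W → ∃ λ c → w ≈ᴹ linearCombination c v

  HasDimension : Subspace → ℕ → Set (r ⊔ ℓr ⊔ m ⊔ ℓm)
  HasDimension W k = Σ (Vector Carrierᴹ k) (IsBasis W)

  -- The k-dimensional subspaces, equal when they have the same vectors;
  -- the chosen bases are disregarded.
  Grassmannian : ℕ → Setoid _ _
  Grassmannian k = On.setoid {B = Σ Subspace (λ W → HasDimension W k)}
    (≐-setoid Carrierᴹ (r ⊔ ℓm)) (λ W → members (proj₁ W))

  GrassmannAdjacent : ∀ {k} → Rel (Setoid.Carrier (Grassmannian k)) (r ⊔ m ⊔ ℓm)
  GrassmannAdjacent (W , _) (W′ , _) =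
    ¬ (members W ≐ members W′) ×
    ∃ λ v → ¬ (v ≈ᴹ 0ᴹ) × v ∈ members W × v ∈ members W′

{-# OPTIONS --safe #-}

-- Let M be the incidence matrix of the points (1-dimensional subspaces) and
-- the lines (2-dimensional subspaces) of V, and put s = q + 1, t = q [n - 2].
-- Then Mᵀ M = A + s I and M Mᵀ = J + t I, so A has the eigenvalues k′ = s t,
-- r = t - s and - s.  Moreover, the two pencils of lines through points i and
-- j of a plane differ by a vector X with M X = q (eᵢ - eⱼ).  As q is a unit
-- modulo ℓ, these X determine the kernel and the image of A modulo ℓ.
--
-- The number μ i of elementary divisors divisible by ℓⁱ is bounded from below
-- by exhibiting vectors that are independent modulo ℓ and mapped by A into
-- ℓⁱ ℤᴺ, and from above by exhibiting linear forms that vanish simultaneously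
-- modulo ℓ at no nonzero vector of that kind.  In each case the bounds agree.
module Submission where

open import Defs
open import Algebra.Bundles using (AbelianGroup; CommutativeRing)
open import Algebra.Module.Bundles using (Module)
open import Data.Fin.Base as Fin using (Fin; zero; suc; toℕ; fromℕ<; finToFun; funToFin; combine; remQuot)
import Data.Fin.Properties as Fin
open import Data.List.Base using (List; []; _∷_; length; filter; allFin; lookup; map)
open import Data.Nat.Primality using (Prime; euclidsLemma; prime⇒irreducible; prime⇒nonTrivial; prime⇒nonZero)
open import Data.Product.Base using (∃; ∃₂; _×_; _,_; proj₁; proj₂)
open import Data.Sum.Base using (_⊎_; inj₁; inj₂; [_,_]′)
open import Data.Vec.Functional using (Vector)
open import Function.Base using (_∘_)
open import Function.Bundles using (Inverse)
open import Function.Definitions using (Injective)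
open import Level using (Level; _⊔_)
open import Relation.Binary.PropositionalEquality as ≡ using (_≡_; _≢_; _≗_; module ≡-Reasoning)
open import Relation.Nullary using (¬_; Dec; yes; no; does; contradiction)
open import Relation.Nullary.Decidable using (¬?; map′; decidable-stable; _×-dec_)
open import Relation.Unary using (Pred; Decidable)

-- While `ℓ` does not divide `t`, the matrix `M Mᵀ` is invertible modulo `ℓ` on vectors of sum zero,
-- and the rational eigenvectors of `A`, the differences of rows of `M`, stay independent. The
-- obstacle is the case where `ℓ` divides both `s` and `t`, that is, `ℓ` divides q + 1 and n is
-- even. There, modulo `ℓ`, the matrix `Mᵀ` kills the constant vectors, `M` takes values of sum
-- zero, and the constants themselves have sum zero because the number of points s + q t vanishes.
-- The row differences become dependent and the rank of `A` drops to [n] - 2. The vectors `X` repair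
-- this integrally: `M` reaches every vector of sum zero modulo `ℓ`, and, by pairing with `X`, a
-- vector `w` with `Mᵀ w` constant is itself constant. The higher powers of `ℓ` come from (A - r)(A
-- + s) = s² J together with sum (A y) = k′ sum y: the valuations of r s, s² and k′ locate the last
-- drops of μ. Since μ is antitone, it suffices to bound it at both ends of each interval of
-- constancy.

module IntegerMatrices where

  import Algebra.Properties.Semiring.Sum as SemiringSum
  open import Data.Integer.Base as ℤ using (ℤ; +_; 0ℤ; 1ℤ; _+_; _-_; _*_; -_; ∣_∣)
  open import Data.Integer.DivMod using (_%ℕ_; _/ℕ_; n%ℕd<d; a≡a%ℕn+[a/ℕn]*n)
  open import Data.Integer.Divisibility.Signed as ℤ∣
    using (_∣_; divides; ∣ᵤ⇒∣; ∣⇒∣ᵤ; ∣-trans; ∣m⇒∣m*n; ∣n⇒∣m*n; ∣m⇒∣-m; ∣m∣n⇒∣m+n; ∣m∣n⇒∣m-n)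
  import Data.Integer.Properties as ℤ
  open import Data.Integer.Tactic.RingSolver using (solve-∀)
  open import Data.List.Membership.Propositional using (_∈_)
  open import Data.List.Membership.Propositional.Properties using (∈-filter⁺; ∈-filter⁻; ∈-allFin; ∈-lookup)
  import Data.List.Properties as List
  open import Data.List.Relation.Unary.All as All using (All)
  open import Data.List.Relation.Unary.AllPairs using (_∷_)
  open import Data.List.Relation.Unary.Any as Any using (Any)
  import Data.List.Relation.Unary.Any.Properties as Any
  open import Data.List.Relation.Unary.Unique.Propositional using (Unique)
  open import Data.List.Relation.Unary.Unique.Propositional.Properties using (filter⁺; allFin⁺)
  open import Data.Nat.Base as ℕ using (ℕ; zero; suc; _^_; _≤_; _<_; z≤n; s≤s)
  open import Data.Nat.Divisibility as ℕ∣ using () renaming (_∣_ to _∣ⁿ_; _∣?_ to _∣ⁿ?_)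
  import Data.Nat.Properties as ℕ
  open ≡ using (refl; sym; trans; cong; cong₂; subst; subst₂)

  private
    variable
      m n k x : ℕ

  -- Integer vectors and matrices

  private
    module ΣZ = SemiringSum ℤ.+-*-semiring

  infixl 7 _⊛_
  infix 8 _ᵀ

  -- Opaque, so that Agda can infer the summand.
  opaque
    sum : Vector ℤ n → ℤ
    sum = ΣZ.sum

    _⊛_ : (Fin m → Fin n → ℤ) → Vector ℤ n → Vector ℤ m
    (B ⊛ x) i = sum (λ j → B i j * x j)

    sum-def : (f : Vector ℤ n) → sum f ≡ ΣZ.sum f
    sum-def f = refl

    ⊛-def : ∀ (B : Fin m → Fin n → ℤ) x i → (B ⊛ x) i ≡ sum (λ j → B i j * x j)
    ⊛-def B x i = refl

    sum-suc : (f : Vector ℤ (suc n)) → sum f ≡ f zero + sum (f ∘ suc)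
    sum-suc f = refl

    sum-cong : {f g : Vector ℤ n} → f ≗ g → sum f ≡ sum g
    sum-cong = ΣZ.sum-cong-≗

    sum-+ : ∀ (f g : Vector ℤ n) → sum (λ i → f i + g i) ≡ sum f + sum g
    sum-+ = ΣZ.∑-distrib-+

    sum-comm : ∀ (f : Fin m → Fin n → ℤ) →
               sum (λ i → sum (λ j → f i j)) ≡ sum (λ j → sum (λ i → f i j))
    sum-comm = ΣZ.∑-comm

    sum-scale : ∀ c (f : Vector ℤ n) → sum (λ i → c * f i) ≡ c * sum f
    sum-scale c f = sym (ΣZ.*-distribˡ-sum c f)

    sum-zero : {f : Vector ℤ n} → (∀ i → f i ≡ 0ℤ) → sum f ≡ 0ℤ
    sum-zero {n = n} {f} eq = trans (sum-cong {f = f} eq) (ΣZ.sum-replicate-zero n)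

    sum-const : ∀ n c → sum {n} (λ _ → c) ≡ + n * c
    sum-const zero    c = sym (ℤ.*-zeroˡ c)
    sum-const (suc n) c = trans (cong (ℤ._+_ c) (sum-const n c)) (sym (ℤ.suc-* (+ n) c))

    ∣-sum : ∀ {d} {f : Vector ℤ n} → (∀ i → d ∣ f i) → d ∣ sum f
    ∣-sum {zero}  h = divides 0ℤ refl
    ∣-sum {suc n} h = ∣m∣n⇒∣m+n (h zero) (∣-sum (h ∘ suc))

  sum-scaleʳ : ∀ c (f : Vector ℤ n) → sum (λ i → f i * c) ≡ sum f * c
  sum-scaleʳ c f = trans (sum-cong (λ i → ℤ.*-comm (f i) c)) (trans (sum-scale c f) (ℤ.*-comm c (sum f)))

  sum-minus : ∀ (f g : Vector ℤ n) → sum (λ i → f i - g i) ≡ sum f - sum g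
  sum-minus f g = begin
    sum (λ i → f i - g i)              ≡⟨ sum-+ f (λ i → - g i) ⟩
    sum f + sum (λ i → - g i)          ≡⟨ cong (ℤ._+_ (sum f)) (sum-cong (λ i → sym (ℤ.-1*i≡-i (g i)))) ⟩
    sum f + sum (λ i → ℤ.-1ℤ * g i)    ≡⟨ cong (ℤ._+_ (sum f)) (sum-scale ℤ.-1ℤ g) ⟩
    sum f + ℤ.-1ℤ * sum g              ≡⟨ cong (ℤ._+_ (sum f)) (ℤ.-1*i≡-i (sum g)) ⟩
    sum f - sum g                      ∎
    where open ≡-Reasoning

  sum-single : ∀ (f : Vector ℤ n) i → (∀ j → j ≢ i → f j ≡ 0ℤ) → sum f ≡ f i
  sum-single {suc n} f zero eq = begin
    sum f                   ≡⟨ sum-suc f ⟩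
    f zero + sum (f ∘ suc)  ≡⟨ cong (ℤ._+_ (f zero)) (sum-zero (λ j → eq (suc j) (λ ()))) ⟩
    f zero + 0ℤ             ≡⟨ ℤ.+-identityʳ _ ⟩
    f zero                  ∎
    where open ≡-Reasoning
  sum-single {suc n} f (suc i) eq = begin
    sum f                   ≡⟨ sum-suc f ⟩
    f zero + sum (f ∘ suc)
      ≡⟨ cong₂ _+_ (eq zero (λ ())) (sum-single (f ∘ suc) i λ j j≢i → eq (suc j) (j≢i ∘ Fin.suc-injective)) ⟩
    0ℤ + f (suc i)          ≡⟨ ℤ.+-identityˡ _ ⟩
    f (suc i)               ∎
    where open ≡-Reasoning

  x+y-y≡x : ∀ x y → (x + y) - y ≡ x
  x+y-y≡x = solve-∀

  x-y+y≡x : ∀ x y → (x - y) + y ≡ x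
  x-y+y≡x = solve-∀

  x-[x-y]≡y : ∀ x y → x - (x - y) ≡ y
  x-[x-y]≡y = solve-∀

  identity-refl : ∀ (i : Fin n) → identity i i ≡ 1ℤ
  identity-refl i with i Fin.≟ i
  ... | yes _ = refl
  ... | no ¬p = contradiction refl ¬p

  identity-≢ : ∀ {i j : Fin n} → i ≢ j → identity i j ≡ 0ℤ
  identity-≢ {i = i} {j} i≢j with i Fin.≟ j
  ... | yes p = contradiction p i≢j
  ... | no _ = refl

  identity-≢-* : ∀ (i j : Fin n) c → i ≢ j → identity i j * c ≡ 0ℤ
  identity-≢-* i j c i≢j = trans (cong (ℤ._* c) (identity-≢ i≢j)) (ℤ.*-zeroˡ c)

  identity-sym : ∀ (i j : Fin n) → identity i j ≡ identity j i
  identity-sym i j with i Fin.≟ j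
  ... | yes refl = sym (identity-refl i)
  ... | no ¬p = sym (identity-≢ (¬p ∘ sym))

  sum-identityˡ : ∀ (i : Fin n) (f : Vector ℤ n) → sum (λ j → identity i j * f j) ≡ f i
  sum-identityˡ i f = trans
    (sum-single (λ j → identity i j * f j) i
      λ j j≢i → identity-≢-* i j (f j) (j≢i ∘ sym))
    (trans (cong (ℤ._* f i) (identity-refl i)) (ℤ.*-identityˡ (f i)))

  sum-identityʳ : ∀ (i : Fin n) (f : Vector ℤ n) → sum (λ j → f j * identity j i) ≡ f i
  sum-identityʳ i f = trans
    (sum-cong λ j → trans (ℤ.*-comm (f j) (identity j i)) (cong (ℤ._* f j) (identity-sym j i)))
    (sum-identityˡ i f)

  sum-identity : ∀ (i : Fin n) → sum (identity i) ≡ 1ℤ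
  sum-identity i = trans
    (sum-cong λ j → sym (ℤ.*-identityʳ (identity i j))) (sum-identityˡ i (λ _ → 1ℤ))

  _ᵀ : (Fin m → Fin n → ℤ) → Fin n → Fin m → ℤ
  (B ᵀ) i j = B j i

  dot : Vector ℤ n → Vector ℤ n → ℤ
  dot x y = sum (λ i → x i * y i)

  module _ (B : Fin m → Fin n → ℤ) where

    ⊛-cong : ∀ {x y} → x ≗ y → B ⊛ x ≗ B ⊛ y
    ⊛-cong {x} {y} eq i = begin
      (B ⊛ x) i  ≡⟨ ⊛-def B x i ⟩
      _          ≡⟨ sum-cong (λ j → cong (ℤ._*_ (B i j)) (eq j)) ⟩
      _          ≡⟨ ⊛-def B y i ⟨
      (B ⊛ y) i  ∎
      where open ≡-Reasoning

    ⊛-+ : ∀ x y → B ⊛ (λ j → x j + y j) ≗ λ i → (B ⊛ x) i + (B ⊛ y) i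
    ⊛-+ x y i = begin
      (B ⊛ (λ j → x j + y j)) i                 ≡⟨ ⊛-def B _ i ⟩
      sum (λ j → B i j * (x j + y j))           ≡⟨ sum-cong (λ j → ℤ.*-distribˡ-+ (B i j) (x j) (y j)) ⟩
      sum (λ j → B i j * x j + B i j * y j)     ≡⟨ sum-+ (λ j → B i j * x j) (λ j → B i j * y j) ⟩
      sum (λ j → B i j * x j) + sum (λ j → B i j * y j)
        ≡⟨ cong₂ _+_ (⊛-def B x i) (⊛-def B y i) ⟨
      (B ⊛ x) i + (B ⊛ y) i                     ∎
      where open ≡-Reasoning

    ⊛-* : ∀ c x → B ⊛ (λ j → c * x j) ≗ λ i → c * (B ⊛ x) i
    ⊛-* c x i = begin
      (B ⊛ (λ j → c * x j)) i          ≡⟨ ⊛-def B _ i ⟩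
      sum (λ j → B i j * (c * x j))    ≡⟨ sum-cong (λ j → swap (B i j) c (x j)) ⟩
      sum (λ j → c * (B i j * x j))    ≡⟨ sum-scale c (λ j → B i j * x j) ⟩
      c * sum (λ j → B i j * x j)      ≡⟨ cong (ℤ._*_ c) (⊛-def B x i) ⟨
      c * (B ⊛ x) i                    ∎
      where
      open ≡-Reasoning
      swap : ∀ b c x → b * (c * x) ≡ c * (b * x)
      swap = solve-∀

    ⊛-minus : ∀ x y → B ⊛ (λ j → x j - y j) ≗ λ i → (B ⊛ x) i - (B ⊛ y) i
    ⊛-minus x y i = begin
      (B ⊛ (λ j → x j - y j)) i                 ≡⟨ ⊛-def B _ i ⟩
      sum (λ j → B i j * (x j - y j))           ≡⟨ sum-cong (λ j → distrib (B i j) (x j) (y j)) ⟩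
      sum (λ j → B i j * x j - B i j * y j)     ≡⟨ sum-minus (λ j → B i j * x j) (λ j → B i j * y j) ⟩
      sum (λ j → B i j * x j) - sum (λ j → B i j * y j)
        ≡⟨ cong₂ _-_ (⊛-def B x i) (⊛-def B y i) ⟨
      (B ⊛ x) i - (B ⊛ y) i                     ∎
      where
      open ≡-Reasoning
      distrib : ∀ b x y → b * (x - y) ≡ b * x - b * y
      distrib = solve-∀

    ⊛-∣ : ∀ {d} {x} → (∀ j → d ∣ x j) → ∀ i → d ∣ (B ⊛ x) i
    ⊛-∣ {d} {x} h i = subst (d ∣_) (sym (⊛-def B x i)) (∣-sum (λ j → ∣n⇒∣m*n (B i j) (h j)))

    ⊛-sum : ∀ (c : Vector ℤ k) (Y : Fin k → Vector ℤ n) →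
            B ⊛ (λ j → sum (λ a → c a * Y a j)) ≗ λ i → sum (λ a → c a * (B ⊛ Y a) i)
    ⊛-sum c Y i = begin
      (B ⊛ (λ j → sum (λ a → c a * Y a j))) i         ≡⟨ ⊛-def B _ i ⟩
      sum (λ j → B i j * sum (λ a → c a * Y a j))
        ≡⟨ sum-cong (λ j → sym (sum-scale (B i j) (λ a → c a * Y a j))) ⟩
      sum (λ j → sum (λ a → B i j * (c a * Y a j)))
        ≡⟨ sum-comm (λ j a → B i j * (c a * Y a j)) ⟩
      sum (λ a → sum (λ j → B i j * (c a * Y a j)))
        ≡⟨ sum-cong (λ a → sym (⊛-def B (λ j → c a * Y a j) i)) ⟩
      sum (λ a → (B ⊛ (λ j → c a * Y a j)) i)
        ≡⟨ sum-cong (λ a → ⊛-* (c a) (Y a) i) ⟩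
      sum (λ a → c a * (B ⊛ Y a) i) ∎
      where open ≡-Reasoning

    adjoint : ∀ x y → dot (B ⊛ x) y ≡ dot x (B ᵀ ⊛ y)
    adjoint x y = begin
      sum (λ i → (B ⊛ x) i * y i)
        ≡⟨ sum-cong (λ i → trans (cong (ℤ._* y i) (⊛-def B x i)) (sym (sum-scaleʳ (y i) (λ j → B i j * x j)))) ⟩
      sum (λ i → sum (λ j → B i j * x j * y i))   ≡⟨ sum-comm (λ i j → B i j * x j * y i) ⟩
      sum (λ j → sum (λ i → B i j * x j * y i))
        ≡⟨ sum-cong (λ j → trans (sum-cong λ i → swap (B i j) (x j) (y i)) (sum-scale (x j) (λ i → B i j * y i))) ⟩
      sum (λ j → x j * sum (λ i → B i j * y i))
        ≡⟨ sum-cong (λ j → cong (ℤ._*_ (x j)) (sym (⊛-def (B ᵀ) y j))) ⟩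
      sum (λ j → x j * (B ᵀ ⊛ y) j)               ∎
      where
      open ≡-Reasoning
      swap : ∀ b x y → b * x * y ≡ x * (b * y)
      swap = solve-∀

  ⊛-assoc : ∀ (B : Fin m → Fin n → ℤ) (C : Fin n → Fin k → ℤ) x →
            (λ i l → sum (λ j → B i j * C j l)) ⊛ x ≗ B ⊛ (C ⊛ x)
  ⊛-assoc B C x i = sym (begin
    (B ⊛ (C ⊛ x)) i                               ≡⟨ ⊛-def B _ i ⟩
    sum (λ j → B i j * (C ⊛ x) j)
      ≡⟨ sum-cong (λ j → trans (cong (ℤ._*_ (B i j)) (⊛-def C x j)) (sym (sum-scale (B i j) (λ l → C j l * x l)))) ⟩
    sum (λ j → sum (λ l → B i j * (C j l * x l)))
      ≡⟨ sum-cong (λ j → sum-cong λ l → sym (ℤ.*-assoc (B i j) (C j l) (x l))) ⟩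
    sum (λ j → sum (λ l → B i j * C j l * x l))   ≡⟨ sum-comm (λ j l → B i j * C j l * x l) ⟩
    sum (λ l → sum (λ j → B i j * C j l * x l))   ≡⟨ sum-cong (λ l → sum-scaleʳ (x l) (λ j → B i j * C j l)) ⟩
    sum (λ l → sum (λ j → B i j * C j l) * x l)   ≡⟨ ⊛-def (λ i l → sum (λ j → B i j * C j l)) x i ⟨
    _                                             ∎)
    where open ≡-Reasoning

  identity-⊛ : ∀ (x : Vector ℤ n) → identity ⊛ x ≗ x
  identity-⊛ x i = trans (⊛-def identity x i) (sum-identityˡ i x)

  ⊛-identity : ∀ (B : Fin m → Fin n → ℤ) j → B ⊛ identity j ≗ λ i → B i j
  ⊛-identity B j i = begin
    (B ⊛ identity j) i               ≡⟨ ⊛-def B (identity j) i ⟩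
    sum (λ k → B i k * identity j k) ≡⟨ sum-cong (λ k → cong (ℤ._*_ (B i k)) (identity-sym j k)) ⟩
    sum (λ k → B i k * identity k j) ≡⟨ sum-identityʳ j (B i) ⟩
    B i j                            ∎
    where open ≡-Reasoning

  diagonal-⊛ : ∀ (d x : Vector ℤ n) → diagonal d ⊛ x ≗ λ i → d i * x i
  diagonal-⊛ d x i = trans (⊛-def (diagonal d) x i)
    (trans (sum-single (λ j → diagonal d i j * x j) i λ j j≢i → off (j≢i ∘ sym)) on)
    where
    off : ∀ {j} → i ≢ j → diagonal d i j * x j ≡ 0ℤ
    off {j} i≢j with i Fin.≟ j
    ... | yes p = contradiction p i≢j
    ... | no _ = ℤ.*-zeroˡ (x j)
    on : diagonal d i i * x i ≡ d i * x i
    on with i Fin.≟ i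
    ... | yes _ = refl
    ... | no ¬p = contradiction refl ¬p

  ⊛-congˡ : ∀ {B C : Fin m → Fin n → ℤ} → (∀ i j → B i j ≡ C i j) → ∀ x → B ⊛ x ≗ C ⊛ x
  ⊛-congˡ {B = B} {C} eq x i = begin
    (B ⊛ x) i  ≡⟨ ⊛-def B x i ⟩
    _          ≡⟨ sum-cong (λ j → cong (ℤ._* x j) (eq i j)) ⟩
    _          ≡⟨ ⊛-def C x i ⟨
    (C ⊛ x) i  ∎
    where open ≡-Reasoning

  ⊛-∘ : ∀ (B : Fin m → Fin n → ℤ) (σ : Fin k → Fin m) x → (B ∘ σ) ⊛ x ≗ (B ⊛ x) ∘ σ
  ⊛-∘ B σ x i = trans (⊛-def (B ∘ σ) x i) (sym (⊛-def B x (σ i)))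

  ⊛-minusˡ : ∀ (B C : Fin m → Fin n → ℤ) x → (λ i j → B i j - C i j) ⊛ x ≗ λ i → (B ⊛ x) i - (C ⊛ x) i
  ⊛-minusˡ B C x i = begin
    ((λ i j → B i j - C i j) ⊛ x) i            ≡⟨ ⊛-def (λ i j → B i j - C i j) x i ⟩
    sum (λ j → (B i j - C i j) * x j)          ≡⟨ sum-cong (λ j → distrib (B i j) (C i j) (x j)) ⟩
    sum (λ j → B i j * x j - C i j * x j)      ≡⟨ sum-minus (λ j → B i j * x j) (λ j → C i j * x j) ⟩
    sum (λ j → B i j * x j) - sum (λ j → C i j * x j)
      ≡⟨ cong₂ _-_ (⊛-def B x i) (⊛-def C x i) ⟨
    (B ⊛ x) i - (C ⊛ x) i                      ∎
    where
    open ≡-Reasoning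
    distrib : ∀ b c x → (b - c) * x ≡ b * x - c * x
    distrib = solve-∀

  dot-minusʳ : ∀ (x y z : Vector ℤ n) → dot x (λ i → y i - z i) ≡ dot x y - dot x z
  dot-minusʳ x y z = trans (sum-cong (λ i → distrib (x i) (y i) (z i))) (sum-minus (λ i → x i * y i) (λ i → x i * z i))
    where
    distrib : ∀ b x y → b * (x - y) ≡ b * x - b * y
    distrib = solve-∀

  dot-+ʳ : ∀ (x y z : Vector ℤ n) → dot x (λ i → y i + z i) ≡ dot x y + dot x z
  dot-+ʳ x y z = trans (sum-cong (λ i → ℤ.*-distribˡ-+ (x i) (y i) (z i))) (sum-+ (λ i → x i * y i) (λ i → x i * z i))

  dot-scaleʳ : ∀ c (x y : Vector ℤ n) → dot x (λ i → c * y i) ≡ c * dot x y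
  dot-scaleʳ c x y = trans (sum-cong (λ i → swap (x i) c (y i))) (sum-scale c (λ i → x i * y i))
    where
    swap : ∀ b c x → b * (c * x) ≡ c * (b * x)
    swap = solve-∀

  dot-congʳ : ∀ (x : Vector ℤ n) {y z} → y ≗ z → dot x y ≡ dot x z
  dot-congʳ x eq = sum-cong (λ i → cong (ℤ._*_ (x i)) (eq i))

  dot-congˡ : ∀ {x y} (z : Vector ℤ n) → x ≗ y → dot x z ≡ dot y z
  dot-congˡ z eq = sum-cong (λ i → cong (ℤ._* z i) (eq i))

  ∣-dot : ∀ {d} (x : Vector ℤ n) {y} → (∀ i → d ∣ y i) → d ∣ dot x y
  ∣-dot x h = ∣-sum (λ i → ∣n⇒∣m*n (x i) (h i))

  -- Divisibility by prime powers

  ∣-resp : ∀ {d x y} → x ≡ y → d ∣ x → d ∣ y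
  ∣-resp refl d∣x = d∣x

  ∣ⁿ⇒∣ : ∀ {k m} → k ∣ⁿ m → + k ∣ + m
  ∣ⁿ⇒∣ = ∣ᵤ⇒∣

  ∣⇒∣ⁿ : ∀ {k m} → + k ∣ + m → k ∣ⁿ m
  ∣⇒∣ⁿ = ∣⇒∣ᵤ

  ^-∣ : ∀ ℓ {i j} → i ≤ j → + (ℓ ^ i) ∣ + (ℓ ^ j)
  ^-∣ ℓ {i} {j} i≤j = ∣ⁿ⇒∣ (subst (ℓ ^ i ∣ⁿ_) eq (ℕ∣.m∣m*n (ℓ ^ (j ℕ.∸ i))))
    where
    eq : ℓ ^ i ℕ.* ℓ ^ (j ℕ.∸ i) ≡ ℓ ^ j
    eq = trans (sym (ℕ.^-distribˡ-+-* ℓ i (j ℕ.∸ i))) (cong (ℓ ^_) (ℕ.m+[n∸m]≡n i≤j))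

  ∣-*-mono : ∀ {a b x y} → a ∣ x → b ∣ y → a * b ∣ x * y
  ∣-*-mono {a} {b} (divides q refl) (divides r refl) = divides (q * r) (swap q a r b)
    where
    swap : ∀ q a r b → q * a * (r * b) ≡ q * r * (a * b)
    swap = solve-∀

  ^-+ : ∀ ℓ i j → + (ℓ ^ (i ℕ.+ j)) ≡ + (ℓ ^ i) * + (ℓ ^ j)
  ^-+ ℓ i j = trans (cong +_ (ℕ.^-distribˡ-+-* ℓ i j)) (ℤ.pos-* (ℓ ^ i) (ℓ ^ j))

  ∣-*-^ : ∀ ℓ i j {x y} → + (ℓ ^ i) ∣ x → + (ℓ ^ j) ∣ y → + (ℓ ^ (i ℕ.+ j)) ∣ x * y
  ∣-*-^ ℓ i j {x} {y} p q = subst (_∣ x * y) (sym (^-+ ℓ i j)) (∣-*-mono p q)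

  module _ {ℓ : ℕ} (ℓ-prime : Prime ℓ) where

    private
      instance
        ℓ-nonZero : ℕ.NonZero ℓ
        ℓ-nonZero = prime⇒nonZero ℓ-prime

    ^-nonZero : ∀ i → ℕ.NonZero (ℓ ^ i)
    ^-nonZero i = ℕ.m^n≢0 ℓ i

    1<prime : 1 < ℓ
    1<prime = ℕ.nonTrivial⇒n>1 ℓ {{prime⇒nonTrivial ℓ-prime}}

    ∤1 : ¬ + ℓ ∣ 1ℤ
    ∤1 d = ℕ.<⇒≢ 1<prime (sym (ℕ∣.∣1⇒≡1 (∣⇒∣ᵤ d)))

    ∣^suc⇒∣ : ∀ i {x} → + (ℓ ^ suc i) ∣ x → + ℓ ∣ x
    ∣^suc⇒∣ i = ∣-trans (subst (_∣ + (ℓ ^ suc i)) (cong +_ (ℕ.*-identityʳ ℓ)) (^-∣ ℓ {1} {suc i} (s≤s z≤n)))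

    ∣^1⇒∣ : ∀ {x} → + (ℓ ^ 1) ∣ x → + ℓ ∣ x
    ∣^1⇒∣ = ∣^suc⇒∣ 0

    ∣⇒∣^1 : ∀ {x} → + ℓ ∣ x → + (ℓ ^ 1) ∣ x
    ∣⇒∣^1 {x} = subst (_∣ x) (cong +_ (sym (ℕ.*-identityʳ ℓ)))

    euclid : ∀ x y → + ℓ ∣ x * y → ¬ + ℓ ∣ x → + ℓ ∣ y
    euclid x y d ∤x with euclidsLemma ∣ x ∣ ∣ y ∣ ℓ-prime (subst (ℓ ∣ⁿ_) (ℤ.abs-* x y) (∣⇒∣ᵤ d))
    ... | inj₁ p = contradiction (∣ᵤ⇒∣ p) ∤x
    ... | inj₂ p = ∣ᵤ⇒∣ p

    private
      cancel-ℓ : ∀ i y → + (ℓ ^ suc i) ∣ y * + ℓ → + (ℓ ^ i) ∣ y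
      cancel-ℓ i y d = ℤ∣.*-cancelʳ-∣ (+ ℓ)
        (subst (_∣ y * + ℓ) (trans (cong +_ (ℕ.*-comm ℓ (ℓ ^ i))) (ℤ.pos-* (ℓ ^ i) ℓ)) d)

    ∣^-cancel-∤ : ∀ k u y → ¬ + ℓ ∣ u → + (ℓ ^ k) ∣ u * y → + (ℓ ^ k) ∣ y
    ∣^-cancel-∤ zero    u y ∤u d = ∣ᵤ⇒∣ (ℕ∣.1∣ _)
    ∣^-cancel-∤ (suc k) u y ∤u d with euclid u y (∣^suc⇒∣ k d) ∤u
    ... | divides z refl = subst (_∣ z * + ℓ) (sym (trans (cong +_ (ℕ.*-comm ℓ (ℓ ^ k))) (ℤ.pos-* (ℓ ^ k) ℓ)))
      (ℤ∣.*-monoˡ-∣ (+ ℓ) (∣^-cancel-∤ k u z ∤u (cancel-ℓ k (u * z) (∣-resp (sym (ℤ.*-assoc u z (+ ℓ))) d))))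

    -- The valuation of `d` is below `i`, so at least one factor `ℓ` is left for `y`. With `d` a
    -- diagonal entry of the Smith form, this kills modulo `ℓ` the coordinates at the entries that
    -- `ℓ ^ i` does not divide.
    ∣^-cancel : ∀ i d y → ¬ + (ℓ ^ i) ∣ d → + (ℓ ^ i) ∣ d * y → + ℓ ∣ y
    ∣^-cancel zero    d y ∤d p = contradiction (∣ᵤ⇒∣ (ℕ∣.1∣ _)) ∤d
    ∣^-cancel (suc i) d y ∤d p with + ℓ ℤ∣.∣? d
    ... | no ∤ℓ = euclid d y (∣^suc⇒∣ i p) ∤ℓ
    ... | yes (divides z refl) = ∣^-cancel i z y
      (λ q → ∤d (subst (_∣ z * + ℓ) (sym (trans (cong +_ (ℕ.*-comm ℓ (ℓ ^ i))) (ℤ.pos-* (ℓ ^ i) ℓ))) (ℤ∣.*-monoˡ-∣ (+ ℓ) q)))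
      (cancel-ℓ i (z * y) (∣-resp (swap z (+ ℓ) y) p))
      where
      swap : ∀ z l y → z * l * y ≡ z * y * l
      swap = solve-∀

    unitPart : ∀ x v → HasValuation ℓ x v → ∃ λ u → x ≡ ℓ ^ v ℕ.* u × ¬ + ℓ ∣ + u
    unitPart x v (ℕ∣.divides u eq , ∤) = u , trans eq (ℕ.*-comm u (ℓ ^ v)) , λ d → ∤ (lemma d)
      where
      lemma : + ℓ ∣ + u → ℓ ^ suc v ∣ⁿ x
      lemma d = subst (ℓ ^ suc v ∣ⁿ_) (sym eq) (ℕ∣.*-monoˡ-∣ (ℓ ^ v) (∣⇒∣ⁿ d))

    ∣^-cancel-valuation : ∀ x v → HasValuation ℓ x v → ∀ k y →
                          + (ℓ ^ (v ℕ.+ k)) ∣ + x * y → + (ℓ ^ k) ∣ y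
    ∣^-cancel-valuation x v val k y d with unitPart x v val
    ... | u , refl , ∤u = ∣^-cancel-∤ k (+ u) y ∤u
      (ℤ∣.*-cancelˡ-∣ (+ (ℓ ^ v)) {{^-nonZero v}}
        (subst₂ _∣_ (^-+ ℓ v k)
          (trans (cong (ℤ._* y) (ℤ.pos-* (ℓ ^ v) u)) (ℤ.*-assoc (+ (ℓ ^ v)) (+ u) y)) d))

    ∣-valuation : ∀ x v → HasValuation ℓ x v → + (ℓ ^ v) ∣ + x
    ∣-valuation x v (d , _) = ∣ⁿ⇒∣ d

    valuation-positive : ∀ x v → HasValuation ℓ x v → ℓ ∣ⁿ x → 0 < v
    valuation-positive x zero (_ , ∤) d = contradiction (subst (_∣ⁿ x) (sym (ℕ.*-identityʳ ℓ)) d) ∤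
    valuation-positive x (suc v) _ _ = s≤s z≤n

    valuation-zero⁺ : ∀ x → ¬ + ℓ ∣ + x → HasValuation ℓ x 0
    valuation-zero⁺ x ∤ = ℕ∣.1∣ x , λ d → ∤ (∣ⁿ⇒∣ (subst (_∣ⁿ x) (ℕ.*-identityʳ ℓ) d))

    valuation-* : ∀ x y v w → HasValuation ℓ x v → HasValuation ℓ y w → HasValuation ℓ (x ℕ.* y) (v ℕ.+ w)
    valuation-* x y v w vx vy =
      subst (_∣ⁿ x ℕ.* y) (sym (ℕ.^-distribˡ-+-* ℓ v w)) (ℕ∣.*-pres-∣ (proj₁ vx) (proj₁ vy)) ,
      λ d → proj₂ vy (∣⇒∣ⁿ (∣^-cancel-valuation x v vx (suc w) (+ y)
        (subst₂ _∣_ (cong (λ e → + (ℓ ^ e)) (sym (ℕ.+-suc v w))) (ℤ.pos-* x y) (∣ⁿ⇒∣ d))))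

    valuation-positive⁻ : ∀ x v → HasValuation ℓ x v → 0 < v → + ℓ ∣ + x
    valuation-positive⁻ x (suc v) val _ = ∣^suc⇒∣ v (∣-valuation x (suc v) val)

  -- Counting and residues

  count : ∀ {p} {P : Pred (Fin n) p} → Decidable P → ℕ
  count {n = n} P? = length (filter P? (allFin n))

  private
    length-filter-⊎ : ∀ {a p q r} {A : Set a} {P : Pred A p} {Q : Pred A q} {R : Pred A r}
      (P? : Decidable P) (Q? : Decidable Q) (R? : Decidable R) →
      (∀ {x} → P x → Q x ⊎ R x) → (∀ {x} → Q x → P x) → (∀ {x} → R x → P x) → (∀ {x} → Q x → ¬ R x) →
      ∀ xs → length (filter P? xs) ≡ length (filter Q? xs) ℕ.+ length (filter R? xs)
    length-filter-⊎ P? Q? R? split q⇒p r⇒p disj [] = refl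
    length-filter-⊎ P? Q? R? split q⇒p r⇒p disj (x ∷ xs)
      with ih ← length-filter-⊎ P? Q? R? split q⇒p r⇒p disj xs | P? x | Q? x | R? x
    ... | yes p | yes q | yes r = contradiction r (disj q)
    ... | yes p | yes q | no ¬r = cong suc ih
    ... | yes p | no ¬q | yes r = trans (cong suc ih) (sym (ℕ.+-suc _ _))
    ... | yes p | no ¬q | no ¬r = contradiction (split p) λ { (inj₁ q) → ¬q q ; (inj₂ r) → ¬r r }
    ... | no ¬p | yes q | _     = contradiction (q⇒p q) ¬p
    ... | no ¬p | no ¬q | yes r = contradiction (r⇒p r) ¬p
    ... | no ¬p | no ¬q | no ¬r = ih

    length-filter-∁ : ∀ {a p} {A : Set a} {P : Pred A p} (P? : Decidable P) →
      ∀ xs → length (filter P? xs) ℕ.+ length (filter (¬? ∘ P?) xs) ≡ length xs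
    length-filter-∁ P? [] = refl
    length-filter-∁ P? (x ∷ xs) with ih ← length-filter-∁ P? xs | P? x
    ... | yes p = cong suc ih
    ... | no ¬p = trans (ℕ.+-suc _ _) (cong suc ih)

    lookup-injective : ∀ {a} {A : Set a} {xs : List A} → Unique xs → Injective _≡_ _≡_ (lookup xs)
    lookup-injective {xs = x ∷ xs} (x∉ ∷ u) {zero}  {zero}  eq = refl
    lookup-injective {xs = x ∷ xs} (x∉ ∷ u) {zero}  {suc j} eq = contradiction eq (All.lookup x∉ (∈-lookup j))
    lookup-injective {xs = x ∷ xs} (x∉ ∷ u) {suc i} {zero}  eq = contradiction (sym eq) (All.lookup x∉ (∈-lookup i))
    lookup-injective {xs = x ∷ xs} (x∉ ∷ u) {suc i} {suc j} eq = cong suc (lookup-injective u eq)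

  count-⊎ : ∀ {p q r} {P : Pred (Fin n) p} {Q : Pred (Fin n) q} {R : Pred (Fin n) r}
    (P? : Decidable P) (Q? : Decidable Q) (R? : Decidable R) →
    (∀ {x} → P x → Q x ⊎ R x) → (∀ {x} → Q x → P x) → (∀ {x} → R x → P x) → (∀ {x} → Q x → ¬ R x) →
    count P? ≡ count Q? ℕ.+ count R?
  count-⊎ {n} P? Q? R? split q⇒p r⇒p disj = length-filter-⊎ P? Q? R? split q⇒p r⇒p disj (allFin n)

  count-∁ : ∀ {p} {P : Pred (Fin n) p} (P? : Decidable P) → count P? ℕ.+ count (¬? ∘ P?) ≡ n
  count-∁ {n} P? = trans (length-filter-∁ P? (allFin n)) (List.length-tabulate {n = n} (λ i → i))

  module _ {p} {P : Pred (Fin n) p} (P? : Decidable P) where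

    enumerate : Fin (count P?) → Fin n
    enumerate = lookup (filter P? (allFin n))

    enumerate-injective : Injective _≡_ _≡_ enumerate
    enumerate-injective = lookup-injective (filter⁺ P? (allFin⁺ n))

    enumerate-∈ : ∀ a → P (enumerate a)
    enumerate-∈ a = proj₂ (∈-filter⁻ P? {xs = allFin n} (∈-lookup {xs = filter P? (allFin n)} a))

    enumerate-surjective : ∀ {j} → P j → ∃ λ a → enumerate a ≡ j
    enumerate-surjective {j} pj = Any.index j∈ , sym (Any.lookup-index j∈)
      where
      j∈ : j ∈ filter P? (allFin n)
      j∈ = ∈-filter⁺ P? (∈-allFin j) pj

  module _ (d : ℕ) .{{_ : ℕ.NonZero d}} where

    residue : ℤ → Fin d
    residue x = fromℕ< (n%ℕd<d x d)

    toℕ-residue : ∀ x → + toℕ (residue x) ≡ x - (x /ℕ d) * + d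
    toℕ-residue x = trans (cong +_ (Fin.toℕ-fromℕ< (n%ℕd<d x d)))
      (trans (sym (ℤ.+-identityʳ (+ (x %ℕ d)))) (trans (solve′ (+ (x %ℕ d)) ((x /ℕ d) * + d))
        (cong (ℤ._- (x /ℕ d) * + d) (sym (a≡a%ℕn+[a/ℕn]*n x d)))))
      where
      solve′ : ∀ a b → a + 0ℤ ≡ (a + b) - b
      solve′ = solve-∀

    residue-∣ : ∀ x → + d ∣ x - + toℕ (residue x)
    residue-∣ x = divides (x /ℕ d) (trans (cong (λ y → x - y) (toℕ-residue x)) (solve′ x ((x /ℕ d) * + d)))
      where
      solve′ : ∀ x y → x - (x - y) ≡ y
      solve′ = solve-∀

    toℕ-∣⇒≡ : ∀ {i j : Fin d} → + d ∣ + toℕ i - + toℕ j → i ≡ j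
    toℕ-∣⇒≡ {i} {j} p = Fin.toℕ-injective (ℤ.+-injective
      (ℤ.i-j≡0⇒i≡j (+ toℕ i) (+ toℕ j) (ℤ.∣i∣≡0⇒i≡0 (vanishing (∣⇒∣ᵤ p) small))))
      where
      small : ∣ + toℕ i - + toℕ j ∣ < d
      small = ℕ.≤-<-trans
        (subst (λ x → ∣ x ∣ ≤ toℕ i ℕ.⊔ toℕ j) (sym (ℤ.m-n≡m⊖n (toℕ i) (toℕ j))) (ℤ.∣m⊝n∣≤m⊔n (toℕ i) (toℕ j)))
        (ℕ.⊔-lub (Fin.toℕ<n i) (Fin.toℕ<n j))
      vanishing : ∀ {x} → d ∣ⁿ x → x < d → x ≡ 0
      vanishing {zero}  _ _ = refl
      vanishing {suc x} d∣x x<d = contradiction (ℕ∣.∣⇒≤ d∣x) (ℕ.<⇒≱ x<d)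

    residue-≡⇒∣ : ∀ x y → residue x ≡ residue y → + d ∣ x - y
    residue-≡⇒∣ x y eq = ∣-resp (solve′ x y (+ toℕ (residue x)))
      (ℤ∣.∣m∣n⇒∣m-n (residue-∣ x) (subst (λ r → + d ∣ y - + toℕ r) (sym eq) (residue-∣ y)))
      where
      solve′ : ∀ x y r → (x - r) - (y - r) ≡ x - y
      solve′ = solve-∀

    ∣⇒residue-≡ : ∀ x y → + d ∣ x - y → residue x ≡ residue y
    ∣⇒residue-≡ x y p = toℕ-∣⇒≡ (∣-resp (solve′ x y (+ toℕ (residue x)) (+ toℕ (residue y)))
      (ℤ∣.∣m∣n⇒∣m+n p (ℤ∣.∣m∣n⇒∣m-n (residue-∣ y) (residue-∣ x))))
      where
      solve′ : ∀ x y r s → (x - y) + ((y - s) - (x - r)) ≡ r - s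
      solve′ = solve-∀

    residue-toℕ : ∀ i → residue (+ toℕ i) ≡ i
    residue-toℕ i = sym (toℕ-∣⇒≡ (residue-∣ (+ toℕ i)))

  funToFin-cong : ∀ {f g : Fin m → Fin n} → (∀ j → f j ≡ g j) → funToFin f ≡ funToFin g
  funToFin-cong {zero}  eq = refl
  funToFin-cong {suc m} eq = cong₂ combine (eq zero) (funToFin-cong (eq ∘ suc))

  -- Dimensions over the field with `ℓ` elements are compared by counting: the `ℓ ^ m` vectors with
  -- entries below `ℓ` have distinct images among the `ℓ ^ n` residue vectors.
  pigeonhole : ∀ {ℓ} → Prime ℓ → (φ : Vector ℤ m → Vector ℤ n) →
    (∀ c c′ → (∀ i → + ℓ ∣ φ c i - φ c′ i) → ∀ j → + ℓ ∣ c j - c′ j) → m ≤ n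
  pigeonhole {m} {n} {ℓ} ℓ-prime φ injective =
    ℕ.≮⇒≥ λ n<m → ℕ.<⇒≱ (ℕ.^-monoʳ-< ℓ (1<prime ℓ-prime) n<m) (Fin.injective⇒≤ ψ-injective)
    where
    instance
      ℓ≢0 : ℕ.NonZero ℓ
      ℓ≢0 = prime⇒nonZero ℓ-prime
    digits : Fin (ℓ ^ m) → Vector ℤ m
    digits x j = + toℕ (finToFun {ℓ} {m} x j)
    ψ : Fin (ℓ ^ m) → Fin (ℓ ^ n)
    ψ x = funToFin (λ i → residue ℓ (φ (digits x) i))
    ψ-injective : Injective _≡_ _≡_ ψ
    ψ-injective {x} {y} eq = begin
      x                                 ≡⟨ Fin.funToFin-finToFin {m} {ℓ} x ⟨
      funToFin (finToFun {ℓ} {m} x)     ≡⟨ funToFin-cong (λ j → toℕ-∣⇒≡ ℓ (injective (digits x) (digits y) φ≡ j)) ⟩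
      funToFin (finToFun {ℓ} {m} y)     ≡⟨ Fin.funToFin-finToFin {m} {ℓ} y ⟩
      y                                 ∎
      where
      open ≡-Reasoning
      φ≡ : ∀ i → + ℓ ∣ φ (digits x) i - φ (digits y) i
      φ≡ i = residue-≡⇒∣ ℓ (φ (digits x) i) (φ (digits y) i) (begin
        residue ℓ (φ (digits x) i)   ≡⟨ Fin.finToFun-funToFin (λ i → residue ℓ (φ (digits x) i)) i ⟨
        finToFun (ψ x) i             ≡⟨ cong (λ z → finToFun z i) eq ⟩
        finToFun (ψ y) i             ≡⟨ Fin.finToFun-funToFin (λ i → residue ℓ (φ (digits y) i)) i ⟩
        residue ℓ (φ (digits y) i)   ∎)

  -- Elementary divisors

  *ₘ-⊛ : ∀ (B C : Matrix n) y → (B *ₘ C) ⊛ y ≗ B ⊛ (C ⊛ y)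
  *ₘ-⊛ B C y i = trans
    (⊛-congˡ (λ i k → sym (sum-def (λ j → B i j * C j k))) y i)
    (⊛-assoc B C y i)

  inverse-⊛ : ∀ {B C : Matrix n} → B *ₘ C ≈ₘ identity → ∀ y → B ⊛ (C ⊛ y) ≗ y
  inverse-⊛ {B = B} {C} BC≈1 y i = begin
    (B ⊛ (C ⊛ y)) i    ≡⟨ *ₘ-⊛ B C y i ⟨
    ((B *ₘ C) ⊛ y) i   ≡⟨ ⊛-congˡ BC≈1 y i ⟩
    (identity ⊛ y) i   ≡⟨ identity-⊛ y i ⟩
    y i                ∎
    where open ≡-Reasoning

  ⊛-combination : ∀ (B : Fin m → Fin n → ℤ) (Y : Fin k → Vector ℤ n) c →
                  B ⊛ (Y ᵀ ⊛ c) ≗ (λ a → B ⊛ Y a) ᵀ ⊛ c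
  ⊛-combination B Y c i = trans (sym (⊛-assoc B (Y ᵀ) c i))
    (⊛-congˡ (λ i a → sym (⊛-def B (Y a) i)) c i)

  Independent : ℕ → (Fin k → Vector ℤ n) → Set
  Independent ℓ Y = ∀ c → (∀ j → + ℓ ∣ (Y ᵀ ⊛ c) j) → ∀ a → + ℓ ∣ c a

  pigeonhole-linear : ∀ {ℓ} → Prime ℓ → (φ : Vector ℤ m → Vector ℤ n) →
    (∀ c c′ i → φ (λ j → c j - c′ j) i ≡ φ c i - φ c′ i) →
    (∀ c → (∀ i → + ℓ ∣ φ c i) → ∀ j → + ℓ ∣ c j) → m ≤ n
  pigeonhole-linear ℓ-prime φ linear kernel = pigeonhole ℓ-prime φ
    λ c c′ h → kernel (λ j → c j - c′ j) (λ i → ∣-resp (sym (linear c c′ i)) (h i))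

  module _ {p} {P : Pred (Fin n) p} (P? : Decidable P) where

    -- Extension by zero, written as a matrix product so that its additivity is an instance of
    -- `⊛-minus`.
    extend : Vector ℤ (count P?) → Vector ℤ n
    extend c = (λ j a → identity j (enumerate P? a)) ⊛ c

    extend-enumerate : ∀ c b → extend c (enumerate P? b) ≡ c b
    extend-enumerate c b = begin
      extend c (enumerate P? b)
        ≡⟨ ⊛-def (λ j a → identity j (enumerate P? a)) c (enumerate P? b) ⟩
      sum (λ a → identity (enumerate P? b) (enumerate P? a) * c a)
        ≡⟨ sum-single (λ a → identity (enumerate P? b) (enumerate P? a) * c a) b (λ a a≢b →
             identity-≢-* (enumerate P? b) (enumerate P? a) (c a) (a≢b ∘ sym ∘ enumerate-injective P?)) ⟩
      identity (enumerate P? b) (enumerate P? b) * c b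
        ≡⟨ cong (ℤ._* c b) (identity-refl (enumerate P? b)) ⟩
      1ℤ * c b
        ≡⟨ ℤ.*-identityˡ (c b) ⟩
      c b ∎
      where open ≡-Reasoning

    extend-∉ : ∀ c {j} → ¬ P j → extend c j ≡ 0ℤ
    extend-∉ c {j} ¬pj = trans (⊛-def (λ j a → identity j (enumerate P? a)) c j) (sum-zero λ a →
      identity-≢-* j (enumerate P? a) (c a) λ { refl → ¬pj (enumerate-∈ P? a) })

    extend-minus : ∀ c c′ → extend (λ a → c a - c′ a) ≗ λ j → extend c j - extend c′ j
    extend-minus = ⊛-minus (λ j a → identity j (enumerate P? a))

  module _ {N} {A : Matrix N} (S : SmithNormalForm A) where

    open SmithNormalForm S

    private
      L R L⁻¹ R⁻¹ : Matrix N
      L = left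
      R = right
      L⁻¹ = proj₁ left-invertible
      R⁻¹ = proj₁ right-invertible

      RR⁻¹ : ∀ y → R ⊛ (R⁻¹ ⊛ y) ≗ y
      RR⁻¹ = inverse-⊛ (proj₁ (proj₂ right-invertible))

      R⁻¹R : ∀ y → R⁻¹ ⊛ (R ⊛ y) ≗ y
      R⁻¹R = inverse-⊛ (proj₂ (proj₂ right-invertible))

      L⁻¹L : ∀ y → L⁻¹ ⊛ (L ⊛ y) ≗ y
      L⁻¹L = inverse-⊛ (proj₂ (proj₂ left-invertible))

    -- From L A R = D follows L A = D R⁻¹. As L and R are unimodular, divisibility of `A ⊛ y` can be
    -- read off from the coordinates of `R⁻¹ ⊛ y`, one diagonal entry at a time.
    left-⊛ : ∀ y j → (left ⊛ (A ⊛ y)) j ≡ + entry j * (R⁻¹ ⊛ y) j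
    left-⊛ y j = begin
      (L ⊛ (A ⊛ y)) j                        ≡⟨ ⊛-cong L (⊛-cong A (RR⁻¹ y)) j ⟨
      (L ⊛ (A ⊛ (R ⊛ (R⁻¹ ⊛ y)))) j          ≡⟨ *ₘ-⊛ L A (R ⊛ (R⁻¹ ⊛ y)) j ⟨
      ((L *ₘ A) ⊛ (R ⊛ (R⁻¹ ⊛ y))) j         ≡⟨ *ₘ-⊛ (L *ₘ A) R (R⁻¹ ⊛ y) j ⟨
      ((L *ₘ A *ₘ R) ⊛ (R⁻¹ ⊛ y)) j          ≡⟨ ⊛-congˡ equation (R⁻¹ ⊛ y) j ⟩
      (diagonal (λ i → + entry i) ⊛ (R⁻¹ ⊛ y)) j ≡⟨ diagonal-⊛ (λ i → + entry i) (R⁻¹ ⊛ y) j ⟩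
      + entry j * (R⁻¹ ⊛ y) j                ∎
      where open ≡-Reasoning

    left⁻¹-⊛ : ∀ y → A ⊛ y ≗ L⁻¹ ⊛ (λ j → + entry j * (R⁻¹ ⊛ y) j)
    left⁻¹-⊛ y i = trans (sym (L⁻¹L (A ⊛ y) i)) (⊛-cong L⁻¹ (left-⊛ y) i)

  module ElementaryDivisors {N} {A : Matrix N} (S : SmithNormalForm A) {ℓ} (ℓ-prime : Prime ℓ) where

    open SmithNormalForm S

    private
      L R L⁻¹ R⁻¹ : Matrix N
      L = left
      R = right
      L⁻¹ = proj₁ left-invertible
      R⁻¹ = proj₁ right-invertible

      RR⁻¹ : ∀ y → R ⊛ (R⁻¹ ⊛ y) ≗ y
      RR⁻¹ = inverse-⊛ (proj₁ (proj₂ right-invertible))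

      R⁻¹R : ∀ y → R⁻¹ ⊛ (R ⊛ y) ≗ y
      R⁻¹R = inverse-⊛ (proj₂ (proj₂ right-invertible))

    private
      R⁻¹-∣ : ∀ y {d} → (∀ j → d ∣ (R⁻¹ ⊛ y) j) → ∀ j → d ∣ y j
      R⁻¹-∣ y h j = ∣-resp (RR⁻¹ y j) (⊛-∣ R h j)

      ∣entry? : ∀ i → Decidable (λ j → ℓ ^ i ∣ⁿ entry j)
      ∣entry? i j = ℓ ^ i ∣ⁿ? entry j

    -- A zero entry is divisible by every power of `ℓ`; it is counted in each `μ i` and cancels in
    -- the differences.
    μ : ℕ → ℕ
    μ i = count (∣entry? i)

    μ-zero : μ 0 ≡ N
    μ-zero = trans (sym (ℕ.+-identityʳ (μ 0)))
      (trans (cong (μ 0 ℕ.+_) (sym none)) (count-∁ (∣entry? 0)))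
      where
      none : count (¬? ∘ ∣entry? 0) ≡ 0
      none with count (¬? ∘ ∣entry? 0) in eq
      ... | zero  = refl
      ... | suc _ = contradiction (ℕ∣.1∣ _) (enumerate-∈ (¬? ∘ ∣entry? 0) (subst Fin (sym eq) zero))

    multiplicity-μ : ∀ i → multiplicity S ℓ i ℕ.+ μ (suc i) ≡ μ i
    multiplicity-μ i = sym (count-⊎ (∣entry? i) (λ j → hasValuation? ℓ (entry j) i) (∣entry? (suc i))
      (λ {j} d → split j d) proj₁ (λ {j} → ∣-pred j) (λ v d → proj₂ v d))
      where
      ∣-pred : ∀ j → ℓ ^ suc i ∣ⁿ entry j → ℓ ^ i ∣ⁿ entry j
      ∣-pred j d = ∣⇒∣ⁿ (∣-trans (^-∣ ℓ (ℕ.n≤1+n i)) (∣ⁿ⇒∣ d))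
      split : ∀ j → ℓ ^ i ∣ⁿ entry j → HasValuation ℓ (entry j) i ⊎ ℓ ^ suc i ∣ⁿ entry j
      split j d with ∣entry? (suc i) j
      ... | yes p = inj₂ p
      ... | no ¬p = inj₁ (d , ¬p)

    -- If `A ⊛ y` is divisible by `ℓ ^ i`, the coordinates of `R⁻¹ ⊛ y` at entries not divisible by
    -- `ℓ ^ i` vanish modulo `ℓ`. The remaining `μ i` coordinates therefore determine the
    -- combination of the `Y a` modulo `ℓ`.
    independent⇒≤μ : ∀ i (Y : Fin k → Vector ℤ N) → Independent ℓ Y →
                     (∀ a j → + (ℓ ^ i) ∣ (A ⊛ Y a) j) → k ≤ μ i
    independent⇒≤μ {k} i Y indep h = pigeonhole-linear ℓ-prime φ linear kernel
      where
      y : Vector ℤ k → Vector ℤ N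
      y c = Y ᵀ ⊛ c
      φ : Vector ℤ k → Vector ℤ (μ i)
      φ c b = (R⁻¹ ⊛ y c) (enumerate (∣entry? i) b)
      linear : ∀ c c′ b → φ (λ j → c j - c′ j) b ≡ φ c b - φ c′ b
      linear c c′ b = trans (⊛-cong R⁻¹ (⊛-minus (Y ᵀ) c c′) j) (⊛-minus R⁻¹ (y c) (y c′) j)
        where j = enumerate (∣entry? i) b
      kernel : ∀ c → (∀ b → + ℓ ∣ φ c b) → ∀ a → + ℓ ∣ c a
      kernel c hφ = indep c (R⁻¹-∣ (y c) all)
        where
        Ay : ∀ j → + (ℓ ^ i) ∣ (A ⊛ y c) j
        Ay j = ∣-resp (sym (trans (⊛-combination A Y c j) (trans (⊛-def _ c j)
          (sum-cong (λ a → ℤ.*-comm ((A ⊛ Y a) j) (c a))))))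
          (∣-dot c (λ a → h a j))
        all : ∀ j → + ℓ ∣ (R⁻¹ ⊛ y c) j
        all j with ∣entry? i j
        ... | yes d with enumerate-surjective (∣entry? i) d
        ...   | b , refl = hφ b
        all j | no ¬d = ∣^-cancel ℓ-prime i (+ entry j) ((R⁻¹ ⊛ y c) j) (¬d ∘ ∣⇒∣ⁿ)
          (∣-resp (left-⊛ S (y c) j) (⊛-∣ L Ay j))

    -- A rank bound modulo `ℓ`: the image of a vector under `A` depends modulo `ℓ` only on its
    -- coordinates at the `N - μ 1` entries prime to `ℓ`.
    independent-image⇒ : ∀ (Y : Fin k → Vector ℤ N) →
      (∀ c → (∀ j → + ℓ ∣ (A ⊛ (Y ᵀ ⊛ c)) j) → ∀ a → + ℓ ∣ c a) → k ℕ.+ μ 1 ≤ N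
    independent-image⇒ {k} Y indep = subst (k ℕ.+ μ 1 ≤_)
      (trans (ℕ.+-comm _ (μ 1)) (count-∁ (∣entry? 1)))
      (ℕ.+-monoˡ-≤ (μ 1) (pigeonhole-linear ℓ-prime φ linear kernel))
      where
      y : Vector ℤ k → Vector ℤ N
      y c = Y ᵀ ⊛ c
      P? = ¬? ∘ ∣entry? 1
      φ : Vector ℤ k → Vector ℤ (count P?)
      φ c b = (R⁻¹ ⊛ y c) (enumerate P? b)
      linear : ∀ c c′ b → φ (λ j → c j - c′ j) b ≡ φ c b - φ c′ b
      linear c c′ b = trans (⊛-cong R⁻¹ (⊛-minus (Y ᵀ) c c′) j) (⊛-minus R⁻¹ (y c) (y c′) j)
        where j = enumerate P? b
      kernel : ∀ c → (∀ b → + ℓ ∣ φ c b) → ∀ a → + ℓ ∣ c a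
      kernel c hφ = indep c λ j → ∣-resp (sym (left⁻¹-⊛ S (y c) j)) (⊛-∣ L⁻¹ all j)
        where
        all : ∀ j → + ℓ ∣ + entry j * (R⁻¹ ⊛ y c) j
        all j with ∣entry? 1 j
        ... | yes d = ∣m⇒∣m*n ((R⁻¹ ⊛ y c) j) (∣^1⇒∣ ℓ-prime (∣ⁿ⇒∣ d))
        ... | no ¬d with enumerate-surjective P? ¬d
        ...   | b , refl = ∣n⇒∣m*n (+ entry j) (hφ b)

    private
      -- The vectors `y c` are those whose `R⁻¹`-coordinates are supported on `P`. The two bounds
      -- below take for `P` the entries that `ℓ ^ i` does not divide, and those that it divides.
      module Supported {p} {P : Pred (Fin N) p} (P? : Decidable P) (Z : Fin x → Fin N → ℤ) where

        y : Vector ℤ (count P?) → Vector ℤ N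
        y c = R ⊛ extend P? c

        R⁻¹y : ∀ c → R⁻¹ ⊛ y c ≗ extend P? c
        R⁻¹y c = R⁻¹R (extend P? c)

        φ : Vector ℤ (count P?) → Vector ℤ x
        φ c = Z ⊛ y c

        φ-linear : ∀ c c′ i → φ (λ j → c j - c′ j) i ≡ φ c i - φ c′ i
        φ-linear c c′ i = trans
          (⊛-cong Z (λ j → trans (⊛-cong R (extend-minus P? c c′) j) (⊛-minus R (extend P? c) (extend P? c′) j)) i)
          (⊛-minus Z (y c) (y c′) i)

    -- On vectors supported at the `N - μ i` entries not divisible by `ℓ ^ i`, the forms `Z` are
    -- jointly injective modulo `ℓ`: where they vanish, the lift `y′` has zero coordinates modulo
    -- `ℓ` at these entries, and so does `y`. The unit `u` permits a lift of a multiple of `y`, such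
    -- as `t` or `q` times it.
    codimension⇒ : ∀ i (Z : Fin x → Fin N → ℤ) →
      (∀ y → (∀ b → + ℓ ∣ (Z ⊛ y) b) →
        ∃₂ λ y′ u → ¬ + ℓ ∣ u × (∀ j → + ℓ ∣ y′ j - u * y j) × (∀ j → + (ℓ ^ i) ∣ (A ⊛ y′) j)) →
      N ≤ x ℕ.+ μ i
    codimension⇒ {x} i Z lift = subst (_≤ x ℕ.+ μ i)
      (trans (ℕ.+-comm _ (μ i)) (count-∁ (∣entry? i)))
      (ℕ.+-monoˡ-≤ (μ i) (pigeonhole-linear ℓ-prime φ φ-linear kernel))
      where
      P? = ¬? ∘ ∣entry? i
      open Supported P? Z
      kernel : ∀ c → (∀ b → + ℓ ∣ φ c b) → ∀ a → + ℓ ∣ c a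
      kernel c hφ a with lift (y c) hφ
      ... | y′ , u , ∤u , cong-y , Ay′ = euclid ℓ-prime u (c a)
        (∣-resp (trans (x-[x-y]≡y ((R⁻¹ ⊛ y′) j) (u * extend P? c j)) (cong (ℤ._*_ u) (extend-enumerate P? c a)))
          (∣m∣n⇒∣m-n small close))
        ∤u
        where
        j = enumerate P? a
        small : + ℓ ∣ (R⁻¹ ⊛ y′) j
        small = ∣^-cancel ℓ-prime i (+ entry j) ((R⁻¹ ⊛ y′) j) (enumerate-∈ P? a ∘ ∣⇒∣ⁿ)
          (∣-resp (left-⊛ S y′ j) (⊛-∣ L Ay′ j))
        close : + ℓ ∣ (R⁻¹ ⊛ y′) j - u * extend P? c j
        close = ∣-resp (trans (⊛-minus R⁻¹ y′ (λ j → u * y c j) j)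
          (cong (ℤ._-_ ((R⁻¹ ⊛ y′) j)) (trans (⊛-* R⁻¹ u (y c) j) (cong (ℤ._*_ u) (R⁻¹y c j)))))
          (⊛-∣ R⁻¹ cong-y j)

    -- A vector supported at the entries divisible by `ℓ ^ i` is sent by `A` into multiples of
    -- `ℓ ^ i`, so the hypothesis makes `Z` injective modulo `ℓ` on a space of dimension `μ i`.
    kernel⇒μ≤ : ∀ i (Z : Fin x → Fin N → ℤ) →
      (∀ y → (∀ j → + (ℓ ^ i) ∣ (A ⊛ y) j) → (∀ b → + ℓ ∣ (Z ⊛ y) b) → ∀ j → + ℓ ∣ y j) → μ i ≤ x
    kernel⇒μ≤ i Z trivial = pigeonhole-linear ℓ-prime φ φ-linear kernel
      where
      P? = ∣entry? i
      open Supported P? Z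
      kernel : ∀ c → (∀ b → + ℓ ∣ φ c b) → ∀ a → + ℓ ∣ c a
      kernel c hφ a = ∣-resp (trans (R⁻¹y c (enumerate P? a)) (extend-enumerate P? c a))
        (⊛-∣ R⁻¹ (trivial (y c) Ay hφ) (enumerate P? a))
        where
        entries : ∀ j → + (ℓ ^ i) ∣ + entry j * (R⁻¹ ⊛ y c) j
        entries j with P? j
        ... | yes d = ∣m⇒∣m*n ((R⁻¹ ⊛ y c) j) (∣ⁿ⇒∣ d)
        ... | no ¬d = ∣n⇒∣m*n (+ entry j) (∣-resp (sym (trans (R⁻¹y c j) (extend-∉ P? c ¬d))) (divides 0ℤ refl))
        Ay : ∀ j → + (ℓ ^ i) ∣ (A ⊛ y c) j
        Ay j = ∣-resp (sym (left⁻¹-⊛ S (y c) j)) (⊛-∣ L⁻¹ entries j)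

  -- The order of the cokernel

  ∏ : Vector ℕ n → ℕ
  ∏ {zero}  d = 1
  ∏ {suc n} d = d zero ℕ.* ∏ (d ∘ suc)

  ∤-∏ : ∀ {ℓ} → Prime ℓ → (d : Vector ℕ n) → (∀ j → ¬ ℓ ∣ⁿ d j) → ¬ ℓ ∣ⁿ ∏ d
  ∤-∏ {zero}  ℓ-prime d ∤d p = ∤1 ℓ-prime (∣ⁿ⇒∣ p)
  ∤-∏ {suc n} ℓ-prime d ∤d p =
    [ ∤d zero , ∤-∏ ℓ-prime (d ∘ suc) (∤d ∘ suc) ]′ (euclidsLemma (d zero) (∏ (d ∘ suc)) ℓ-prime p)

  encode : (d : Vector ℕ n) → (∀ j → Fin (d j)) → Fin (∏ d)
  encode {zero}  d x = zero
  encode {suc n} d x = combine (x zero) (encode (d ∘ suc) (x ∘ suc))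

  decode : (d : Vector ℕ n) → Fin (∏ d) → ∀ j → Fin (d j)
  decode {suc n} d y zero    = proj₁ (remQuot {d zero} (∏ (d ∘ suc)) y)
  decode {suc n} d y (suc j) = decode (d ∘ suc) (proj₂ (remQuot {d zero} (∏ (d ∘ suc)) y)) j

  encode-cong : ∀ (d : Vector ℕ n) {x y} → (∀ j → x j ≡ y j) → encode d x ≡ encode d y
  encode-cong {zero}  d eq = refl
  encode-cong {suc n} d eq = cong₂ combine (eq zero) (encode-cong (d ∘ suc) (eq ∘ suc))

  encode-decode : ∀ (d : Vector ℕ n) y → encode d (decode d y) ≡ y
  encode-decode {zero}  d zero = refl
  encode-decode {suc n} d y = trans
    (cong (combine (proj₁ (remQuot {d zero} (∏ (d ∘ suc)) y))) (encode-decode (d ∘ suc) _))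
    (Fin.combine-remQuot {d zero} (∏ (d ∘ suc)) y)

  decode-encode : ∀ (d : Vector ℕ n) x j → decode d (encode d x) j ≡ x j
  decode-encode {suc n} d x zero = cong proj₁ (Fin.remQuot-combine (x zero) (encode (d ∘ suc) (x ∘ suc)))
  decode-encode {suc n} d x (suc j) = trans
    (cong (λ p → decode (d ∘ suc) (proj₂ p) j) (Fin.remQuot-combine (x zero) (encode (d ∘ suc) (x ∘ suc))))
    (decode-encode (d ∘ suc) (x ∘ suc) j)

  module _ {N} {A : Matrix N} (S : SmithNormalForm A) where

    open SmithNormalForm S

    module _ (nonZero : ∀ j → ℕ.NonZero (entry j)) where

      private
        L R L⁻¹ R⁻¹ : Matrix N
        L = left
        R = right
        L⁻¹ = proj₁ left-invertible
        R⁻¹ = proj₁ right-invertible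
        open AbelianGroup (cokernel A) using (_≈_) renaming (refl to ≈-refl)

        res : ∀ j → ℤ → Fin (entry j)
        res j = residue (entry j) {{nonZero j}}

        to : Fin (∏ entry) → Vector ℤ N
        to x = L⁻¹ ⊛ (λ j → + toℕ (decode entry x j))

        from : Vector ℤ N → Fin (∏ entry)
        from v = encode entry (λ j → res j ((L ⊛ v) j))

        left-A : ∀ y j → (L ⊛ (A ⊛ y)) j ≡ + entry j * (R⁻¹ ⊛ y) j
        left-A = left-⊛ S

        from-cong : ∀ {v w} → v ≈ w → from v ≡ from w
        from-cong {v} {w} (z , p) = encode-cong entry λ j →
          ∣⇒residue-≡ (entry j) {{nonZero j}} ((L ⊛ v) j) ((L ⊛ w) j)
            (divides ((R⁻¹ ⊛ z) j) (begin
              (L ⊛ v) j - (L ⊛ w) j            ≡⟨ ⊛-minus L v w j ⟨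
              (L ⊛ (λ i → v i - w i)) j        ≡⟨ ⊛-cong L (λ i → trans (p i) (trans (sym (sum-def (λ k → A i k * z k))) (sym (⊛-def A z i)))) j ⟩
              (L ⊛ (A ⊛ z)) j                  ≡⟨ left-A z j ⟩
              + entry j * (R⁻¹ ⊛ z) j          ≡⟨ ℤ.*-comm (+ entry j) ((R⁻¹ ⊛ z) j) ⟩
              (R⁻¹ ⊛ z) j * + entry j          ∎))
          where open ≡-Reasoning

        from-to : ∀ x → from (to x) ≡ x
        from-to x = trans
          (encode-cong entry λ j → trans
            (cong (res j) (inverse-⊛ (proj₁ (proj₂ left-invertible)) (λ j → + toℕ (decode entry x j)) j))
            (residue-toℕ (entry j) {{nonZero j}} (decode entry x j)))
          (encode-decode entry x)

        to-from : ∀ v → to (from v) ≈ v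
        to-from v = z , λ i → begin
          to (from v) i - v i
            ≡⟨ cong₂ _-_ (⊛-cong L⁻¹ (λ j → cong (λ r → + toℕ r) (decode-encode entry _ j)) i)
                         (sym (inverse-⊛ (proj₂ (proj₂ left-invertible)) v i)) ⟩
          (L⁻¹ ⊛ r) i - (L⁻¹ ⊛ (L ⊛ v)) i       ≡⟨ ⊛-minus L⁻¹ r (L ⊛ v) i ⟨
          (L⁻¹ ⊛ (λ j → r j - (L ⊛ v) j)) i
            ≡⟨ ⊛-cong L⁻¹ (λ j → trans (defect j) (cong (ℤ._*_ (+ entry j)) (sym (inverse-⊛ (proj₂ (proj₂ right-invertible)) quot j)))) i ⟩
          (L⁻¹ ⊛ (λ j → + entry j * (R⁻¹ ⊛ z) j)) i ≡⟨ ⊛-cong L⁻¹ (left-A z) i ⟨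
          (L⁻¹ ⊛ (L ⊛ (A ⊛ z))) i               ≡⟨ inverse-⊛ (proj₂ (proj₂ left-invertible)) (A ⊛ z) i ⟩
          (A ⊛ z) i                             ≡⟨ trans (⊛-def A z i) (sum-def (λ k → A i k * z k)) ⟩
          (A *ᵥ z) i                            ∎
          where
          open ≡-Reasoning
          r quot z : Vector ℤ N
          r j = + toℕ (res j ((L ⊛ v) j))
          remainder : ∀ j → + entry j ∣ (L ⊛ v) j - r j
          remainder j = residue-∣ (entry j) {{nonZero j}} ((L ⊛ v) j)
          quot j = - ℤ∣.quotient (remainder j)
          z = R ⊛ quot
          flip : ∀ a b q d → a - b ≡ q * d → b - a ≡ d * - q
          flip a b q d eq = trans (flip₁ a b) (trans (cong -_ eq) (flip₂ q d))
            where
            flip₁ : ∀ a b → b - a ≡ - (a - b)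
            flip₁ = solve-∀
            flip₂ : ∀ q d → - (q * d) ≡ d * - q
            flip₂ = solve-∀
          defect : ∀ j → r j - (L ⊛ v) j ≡ + entry j * quot j
          defect j = flip ((L ⊛ v) j) (r j) _ (+ entry j) (_∣_.equality (remainder j))

      -- The unimodular `L` carries the image of `A` onto the vectors whose `j`-th coordinate is a
      -- multiple of `entry j`, so the residues of the coordinates of `L ⊛ v` classify the cosets.
      cokernel-cardinality : HasCardinality (AbelianGroup.setoid (cokernel A)) (∏ entry)
      cokernel-cardinality = record
        { to        = to
        ; from      = from
        ; to-cong   = λ { {x} refl → ≈-refl {to x} }
        ; from-cong = from-cong
        ; inverse   = (λ { {v} refl → to-from v }) , λ {x} v≈ → trans (from-cong v≈) (from-to x)
        }

  -- Points and lines

  -- There are s points on each line and t + 1 lines through each point, and r is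
  -- the eigenvalue of A on the vectors Mᵀ w with sum w = 0.
  record PointLineGeometry (f N q s t r : ℕ) (A : Matrix N) : Set where
    field
      s≡     : + s ≡ 1ℤ + + q
      t≡     : + t ≡ + r + + s
      points : + (suc f) ≡ + s + + q * + t
      M      : Fin (suc f) → Fin N → ℤ
      A-def  : ∀ y → A ⊛ y ≗ λ j → (M ᵀ ⊛ (M ⊛ y)) j - + s * y j
      MMᵀ    : ∀ w → M ⊛ (M ᵀ ⊛ w) ≗ λ i → sum w + + t * w i
      M1     : ∀ i → sum (M i) ≡ 1ℤ + + t
      Mᵀ1    : ∀ j → sum ((M ᵀ) j) ≡ + s
      X      : Fin (suc f) → Vector ℤ N
      MX     : ∀ i → M ⊛ X i ≗ λ k → + q * (identity i k - identity zero k)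
      sum-X  : ∀ i → sum (X i) ≡ 0ℤ

  -- Spectral identities of the incidence matrix

  module PointLineGeometryProperties {f N q s t r A} (G : PointLineGeometry f N q s t r A) where

    open PointLineGeometry G public

    Mᵀ-const : ∀ c → M ᵀ ⊛ (λ _ → c) ≗ λ _ → + s * c
    Mᵀ-const c j = trans (⊛-def (M ᵀ) (λ _ → c) j) (trans (sum-scaleʳ c ((M ᵀ) j)) (cong (ℤ._* c) (Mᵀ1 j)))

    M-const : ∀ c → M ⊛ (λ _ → c) ≗ λ _ → (1ℤ + + t) * c
    M-const c i = trans (⊛-def M (λ _ → c) i) (trans (sum-scaleʳ c (M i)) (cong (ℤ._* c) (M1 i)))

    sum-M : ∀ y → sum (M ⊛ y) ≡ + s * sum y
    sum-M y = begin
      sum (M ⊛ y)                       ≡⟨ sum-cong (λ i → sym (ℤ.*-identityʳ ((M ⊛ y) i))) ⟩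
      dot (M ⊛ y) (λ _ → 1ℤ)            ≡⟨ adjoint M y (λ _ → 1ℤ) ⟩
      dot y (M ᵀ ⊛ (λ _ → 1ℤ))          ≡⟨ dot-congʳ y (Mᵀ-const 1ℤ) ⟩
      sum (λ j → y j * (+ s * 1ℤ))      ≡⟨ sum-scaleʳ (+ s * 1ℤ) y ⟩
      sum y * (+ s * 1ℤ)                ≡⟨ swap (sum y) (+ s) ⟩
      + s * sum y                       ∎
      where
      open ≡-Reasoning
      swap : ∀ a b → a * (b * 1ℤ) ≡ b * a
      swap = solve-∀

    sum-Mᵀ : ∀ w → sum (M ᵀ ⊛ w) ≡ (1ℤ + + t) * sum w
    sum-Mᵀ w = begin
      sum (M ᵀ ⊛ w)                     ≡⟨ sum-cong (λ i → sym (ℤ.*-identityʳ ((M ᵀ ⊛ w) i))) ⟩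
      dot (M ᵀ ⊛ w) (λ _ → 1ℤ)          ≡⟨ adjoint (M ᵀ) w (λ _ → 1ℤ) ⟩
      dot w (M ⊛ (λ _ → 1ℤ))            ≡⟨ dot-congʳ w (M-const 1ℤ) ⟩
      sum (λ j → w j * ((1ℤ + + t) * 1ℤ))  ≡⟨ sum-scaleʳ ((1ℤ + + t) * 1ℤ) w ⟩
      sum w * ((1ℤ + + t) * 1ℤ)         ≡⟨ swap (sum w) (+ t) ⟩
      (1ℤ + + t) * sum w                ∎
      where
      open ≡-Reasoning
      swap : ∀ a b → a * ((1ℤ + b) * 1ℤ) ≡ (1ℤ + b) * a
      swap = solve-∀

    sum-A : ∀ y → sum (A ⊛ y) ≡ + s * + t * sum y
    sum-A y = begin
      sum (A ⊛ y)                                        ≡⟨ sum-cong (A-def y) ⟩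
      sum (λ j → (M ᵀ ⊛ (M ⊛ y)) j - + s * y j)          ≡⟨ sum-minus (M ᵀ ⊛ (M ⊛ y)) (λ j → + s * y j) ⟩
      sum (M ᵀ ⊛ (M ⊛ y)) - sum (λ j → + s * y j)
        ≡⟨ cong₂ _-_ (trans (sum-Mᵀ (M ⊛ y)) (cong (ℤ._*_ (1ℤ + + t)) (sum-M y))) (sum-scale (+ s) y) ⟩
      (1ℤ + + t) * (+ s * sum y) - + s * sum y           ≡⟨ simplify (+ t) (+ s) (sum y) ⟩
      + s * + t * sum y                                  ∎
      where
      open ≡-Reasoning
      simplify : ∀ t s y → (1ℤ + t) * (s * y) - s * y ≡ s * t * y
      simplify = solve-∀

    A-Mᵀ : ∀ w → A ⊛ (M ᵀ ⊛ w) ≗ λ j → + s * sum w + + r * (M ᵀ ⊛ w) j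
    A-Mᵀ w j = begin
      (A ⊛ (M ᵀ ⊛ w)) j                                        ≡⟨ A-def (M ᵀ ⊛ w) j ⟩
      (M ᵀ ⊛ (M ⊛ (M ᵀ ⊛ w))) j - + s * (M ᵀ ⊛ w) j            ≡⟨ cong (ℤ._- + s * (M ᵀ ⊛ w) j) expand ⟩
      (+ s * sum w + + t * (M ᵀ ⊛ w) j) - + s * (M ᵀ ⊛ w) j
        ≡⟨ cong (λ x → (+ s * sum w + x * (M ᵀ ⊛ w) j) - + s * (M ᵀ ⊛ w) j) t≡ ⟩
      (+ s * sum w + (+ r + + s) * (M ᵀ ⊛ w) j) - + s * (M ᵀ ⊛ w) j
        ≡⟨ simplify (+ s) (sum w) (+ r) ((M ᵀ ⊛ w) j) ⟩
      + s * sum w + + r * (M ᵀ ⊛ w) j                          ∎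
      where
      open ≡-Reasoning
      simplify : ∀ s a r b → (s * a + (r + s) * b) - s * b ≡ s * a + r * b
      simplify = solve-∀
      expand : (M ᵀ ⊛ (M ⊛ (M ᵀ ⊛ w))) j ≡ + s * sum w + + t * (M ᵀ ⊛ w) j
      expand = begin
        (M ᵀ ⊛ (M ⊛ (M ᵀ ⊛ w))) j                              ≡⟨ ⊛-cong (M ᵀ) (MMᵀ w) j ⟩
        (M ᵀ ⊛ (λ i → sum w + + t * w i)) j                    ≡⟨ ⊛-+ (M ᵀ) (λ _ → sum w) (λ i → + t * w i) j ⟩
        (M ᵀ ⊛ (λ _ → sum w)) j + (M ᵀ ⊛ (λ i → + t * w i)) j
          ≡⟨ cong₂ _+_ (Mᵀ-const (sum w) j) (⊛-* (M ᵀ) (+ t) w j) ⟩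
        + s * sum w + + t * (M ᵀ ⊛ w) j                        ∎

    A-1 : A ⊛ (λ _ → 1ℤ) ≗ λ _ → + s * + t
    A-1 j = begin
      (A ⊛ (λ _ → 1ℤ)) j                                  ≡⟨ A-def (λ _ → 1ℤ) j ⟩
      (M ᵀ ⊛ (M ⊛ (λ _ → 1ℤ))) j - + s * 1ℤ               ≡⟨ cong (ℤ._- + s * 1ℤ) (⊛-cong (M ᵀ) (M-const 1ℤ) j) ⟩
      (M ᵀ ⊛ (λ _ → (1ℤ + + t) * 1ℤ)) j - + s * 1ℤ        ≡⟨ cong (ℤ._- + s * 1ℤ) (Mᵀ-const ((1ℤ + + t) * 1ℤ) j) ⟩
      + s * ((1ℤ + + t) * 1ℤ) - + s * 1ℤ                  ≡⟨ simplify (+ s) (+ t) ⟩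
      + s * + t                                           ∎
      where
      open ≡-Reasoning
      simplify : ∀ s t → s * ((1ℤ + t) * 1ℤ) - s * 1ℤ ≡ s * t
      simplify = solve-∀

    -- This is (A - r)(A + s) = s² J. It bounds a vector from its image: if `A ⊛ y` and s² sum y are
    -- divisible by a power of `ℓ`, then so is r s y.
    quadratic : ∀ y j → (A ⊛ (A ⊛ y)) j + (+ s - + r) * (A ⊛ y) j ≡ + r * + s * y j + + s * + s * sum y
    quadratic y j = begin
      (A ⊛ (A ⊛ y)) j + (+ s - + r) * Ay
        ≡⟨ cong (ℤ._+ (+ s - + r) * Ay) (trans (⊛-cong A (A-def y) j) (trans (⊛-minus A z (λ j → + s * y j) j)
             (cong₂ _-_ (A-Mᵀ (M ⊛ y) j) (⊛-* A (+ s) y j)))) ⟩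
      ((+ s * sum (M ⊛ y) + + r * z j) - + s * Ay) + (+ s - + r) * Ay
        ≡⟨ cong₂ (λ a b → ((+ s * a + + r * z j) - + s * b) + (+ s - + r) * b) (sum-M y) (A-def y j) ⟩
      ((+ s * (+ s * sum y) + + r * z j) - + s * (z j - + s * y j)) + (+ s - + r) * (z j - + s * y j)
        ≡⟨ simplify (+ s) (+ r) (sum y) (z j) (y j) ⟩
      + r * + s * y j + + s * + s * sum y ∎
      where
      open ≡-Reasoning
      Ay = (A ⊛ y) j
      z = M ᵀ ⊛ (M ⊛ y)
      simplify : ∀ s r a z y → ((s * (s * a) + r * z) - s * (z - s * y)) + (s - r) * (z - s * y) ≡ r * s * y + s * s * a
      simplify = solve-∀

    -- Since `X i` is orthogonal to constants, a vector `w` for which `Mᵀ w` is constant modulo `ℓ`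
    -- is constant modulo `ℓ` when `q` is a unit. This works even where `ℓ` divides `t` and `M Mᵀ`
    -- cannot be inverted.
    dot-X-Mᵀ : ∀ i w → dot (X i) (M ᵀ ⊛ w) ≡ + q * (w i - w zero)
    dot-X-Mᵀ i w = begin
      dot (X i) (M ᵀ ⊛ w)                                  ≡⟨ adjoint M (X i) w ⟨
      dot (M ⊛ X i) w                                      ≡⟨ dot-congˡ w (MX i) ⟩
      sum (λ k → + q * (identity i k - identity zero k) * w k)
        ≡⟨ sum-cong (λ k → distrib (+ q) (identity i k) (identity zero k) (w k)) ⟩
      sum (λ k → + q * (identity i k * w k - identity zero k * w k))
        ≡⟨ sum-scale (+ q) (λ k → identity i k * w k - identity zero k * w k) ⟩
      + q * sum (λ k → identity i k * w k - identity zero k * w k)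
        ≡⟨ cong (ℤ._*_ (+ q)) (trans (sum-minus (λ k → identity i k * w k) (λ k → identity zero k * w k))
             (cong₂ _-_ (sum-identityˡ i w) (sum-identityˡ zero w))) ⟩
      + q * (w i - w zero)                                 ∎
      where
      open ≡-Reasoning
      distrib : ∀ q a b w → q * (a - b) * w ≡ q * (a * w - b * w)
      distrib = solve-∀

    dot-X-const : ∀ i c → dot (X i) (λ _ → c) ≡ 0ℤ
    dot-X-const i c = trans (sum-scaleʳ c (X i)) (cong (ℤ._* c) (sum-X i))

    -- On vectors of sum zero, `X ᵀ` is a right inverse of `M` up to the factor `q`; a nonzero sum
    -- leaves a defect at the base point only.
    M-combination : ∀ v → M ⊛ (X ᵀ ⊛ v) ≗ λ k → + q * (v k - identity zero k * sum v)
    M-combination v k = begin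
      (M ⊛ (X ᵀ ⊛ v)) k                                    ≡⟨ ⊛-assoc M (X ᵀ) v k ⟨
      ((λ i l → sum (λ j → M i j * X l j)) ⊛ v) k          ≡⟨ ⊛-def (λ i l → sum (λ j → M i j * X l j)) v k ⟩
      sum (λ l → sum (λ j → M k j * X l j) * v l)
        ≡⟨ sum-cong (λ l → cong (ℤ._* v l) (trans (sym (⊛-def M (X l) k)) (MX l k))) ⟩
      sum (λ l → + q * (identity l k - identity zero k) * v l)
        ≡⟨ sum-cong (λ l → distrib (+ q) (identity l k) (identity zero k) (v l)) ⟩
      sum (λ l → + q * (v l * identity l k - identity zero k * v l))
        ≡⟨ sum-scale (+ q) (λ l → v l * identity l k - identity zero k * v l) ⟩
      + q * sum (λ l → v l * identity l k - identity zero k * v l)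
        ≡⟨ cong (ℤ._*_ (+ q)) (trans (sum-minus (λ l → v l * identity l k) (λ l → identity zero k * v l))
             (cong₂ _-_ (sum-identityʳ k v) (sum-scale (identity zero k) v))) ⟩
      + q * (v k - identity zero k * sum v)                ∎
      where
      open ≡-Reasoning
      distrib : ∀ q a b w → q * (a - b) * w ≡ q * (w * a - b * w)
      distrib = solve-∀

    Mᵀ-identity : ∀ i → M ᵀ ⊛ identity i ≗ M i
    Mᵀ-identity i = ⊛-identity (M ᵀ) i

    doubleCount : N ℕ.* s ≡ suc f ℕ.* suc t
    doubleCount = ℤ.+-injective (begin
      + (N ℕ.* s)                             ≡⟨ ℤ.pos-* N s ⟩
      + N * + s                               ≡⟨ sum-const N (+ s) ⟨
      sum {N} (λ _ → + s)                     ≡⟨ sum-cong Mᵀ1 ⟨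
      sum (λ j → sum (λ i → M i j))           ≡⟨ sum-comm (λ j i → M i j) ⟩
      sum (λ i → sum (M i))                   ≡⟨ sum-cong M1 ⟩
      sum {suc f} (λ _ → 1ℤ + + t)            ≡⟨ sum-const (suc f) (1ℤ + + t) ⟩
      + suc f * + suc t                       ≡⟨ ℤ.pos-* (suc f) (suc t) ⟨
      + (suc f ℕ.* suc t)                     ∎)
      where open ≡-Reasoning

  -- Bounds on the number of elementary divisors

  module MultiplicityBounds {f N q s t r A} (G : PointLineGeometry f N q s t r A) (S : SmithNormalForm A)
    {ℓ} (ℓ-prime : Prime ℓ) where

    open PointLineGeometryProperties G
    open ElementaryDivisors S ℓ-prime

    private
      0-∣ : ∀ {d x} → x ≡ 0ℤ → d ∣ x
      0-∣ eq = divides 0ℤ eq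

      sum-∣ : ∀ {d} y → (∀ j → d ∣ (A ⊛ y) j) → d ∣ + s * + t * sum y
      sum-∣ y h = ∣-resp (sum-A y) (∣-sum h)

      quadratic-∣ : ∀ {d} y → (∀ j → d ∣ (A ⊛ y) j) → d ∣ + s * + s * sum y → ∀ j → d ∣ + r * + s * y j
      quadratic-∣ y h hs j = ∣-resp (x+y-y≡x (+ r * + s * y j) (+ s * + s * sum y))
        (∣m∣n⇒∣m-n (∣-resp (quadratic y j) (∣m∣n⇒∣m+n (⊛-∣ A h j) (∣n⇒∣m*n (+ s - + r) (h j)))) hs)

      sum-cancel : ∀ κ → HasValuation ℓ (s ℕ.* t) κ → ∀ k y →
                   (∀ j → + (ℓ ^ (κ ℕ.+ k)) ∣ (A ⊛ y) j) → + (ℓ ^ k) ∣ sum y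
      sum-cancel κ val k y h = ∣^-cancel-valuation ℓ-prime (s ℕ.* t) κ val k (sum y)
        (∣-resp (cong (ℤ._* sum y) (sym (ℤ.pos-* s t))) (sum-∣ y h))

      -- By `quadratic` at exponent v + 1: s² contributes 2σ and the sum contributes k, so r s y is
      -- divisible by one power of `ℓ` more than r s is.
      vanishing : ∀ v σ → HasValuation ℓ (r ℕ.* s) v → HasValuation ℓ s σ → ∀ k i y →
                  suc v ≤ i → suc v ≤ σ ℕ.+ σ ℕ.+ k →
                  (∀ j → + (ℓ ^ i) ∣ (A ⊛ y) j) → + (ℓ ^ k) ∣ sum y → ∀ j → + ℓ ∣ y j
      vanishing v σ valrs vals k i y v<i v<2σ+k h hs j = ∣^1⇒∣ ℓ-prime
        (∣^-cancel-valuation ℓ-prime (r ℕ.* s) v valrs 1 (y j)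
          (subst (λ e → + (ℓ ^ e) ∣ + (r ℕ.* s) * y j) (ℕ.+-comm 1 v)
            (∣-resp (cong (ℤ._* y j) (sym (ℤ.pos-* r s)))
              (quadratic-∣ y (λ j → ∣-trans (^-∣ ℓ v<i) (h j))
                (∣-trans (^-∣ ℓ v<2σ+k) (∣-*-^ ℓ (σ ℕ.+ σ) k (∣-*-^ ℓ σ σ sσ sσ) hs)) j))))
        where
        sσ : + (ℓ ^ σ) ∣ + s
        sσ = ∣-valuation ℓ-prime s σ vals

    -- Here sum (A y) = k′ sum y supplies the divisibility of the sum: of the exponent `i`, at most
    -- κ is absorbed by k′ and at least `k` reaches sum y. Then `vanishing` leaves no vector, with
    -- an empty family of forms.
    μ≤0 : ∀ v σ κ → HasValuation ℓ (r ℕ.* s) v → HasValuation ℓ s σ → HasValuation ℓ (s ℕ.* t) κ →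
          ∀ k i → κ ℕ.+ k ≤ i → suc v ≤ i → suc v ≤ σ ℕ.+ σ ℕ.+ k → μ i ≤ 0
    μ≤0 v σ κ valrs vals valst k i κ+k≤i v<i v<2σ+k = kernel⇒μ≤ {x = 0} i (λ ()) λ y h _ →
      vanishing v σ valrs vals k i y v<i v<2σ+k h
        (sum-cancel κ valst k y (λ j → ∣-trans (^-∣ ℓ κ+k≤i) (h j)))

    -- The only form is the sum of the coordinates. Its vanishing modulo `ℓ` gives `vanishing` with
    -- k = 1.
    μ≤1 : ∀ v σ → HasValuation ℓ (r ℕ.* s) v → HasValuation ℓ s σ →
          ∀ i → suc v ≤ i → suc v ≤ σ ℕ.+ σ ℕ.+ 1 → μ i ≤ 1
    μ≤1 v σ valrs vals i v<i v<2σ+1 = kernel⇒μ≤ {x = 1} i (λ _ _ → 1ℤ) λ y h hs →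
      vanishing v σ valrs vals 1 i y v<i v<2σ+1 h
        (∣⇒∣^1 ℓ-prime (∣-resp (trans (⊛-def (λ (_ : Fin 1) _ → 1ℤ) y zero) (sum-cong λ j → ℤ.*-identityˡ (y j))) (hs zero)))

    1≤μ : Fin N → ∀ i → + (ℓ ^ i) ∣ + s * + t → 1 ≤ μ i
    1≤μ j₀ i d = independent⇒≤μ i (λ (_ : Fin 1) _ → 1ℤ)
      (λ { c h zero → ∣-resp (trans (⊛-def _ c j₀) (trans (sum-cong λ j → ℤ.*-identityˡ (c j)) (sum-one c))) (h j₀) })
      λ _ j → ∣-resp (sym (A-1 j)) d
      where
      sum-one : (c : Vector ℤ 1) → sum c ≡ c zero
      sum-one c = sum-single c zero λ { zero ne → contradiction refl ne }

    private
      -- The image under `Mᵀ` of the difference of two unit vectors, hence an eigenvector for `r`.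
      -- `spread` gives the point coefficients, of sum zero, of a combination of these differences.
      D : Fin f → Vector ℤ N
      D a j = M (suc a) j - M zero j

      spread : Vector ℤ f → Vector ℤ (suc f)
      spread c zero    = - sum c
      spread c (suc a) = c a

      sum-spread : ∀ c → sum (spread c) ≡ 0ℤ
      sum-spread c = trans (sum-suc (spread c)) (ℤ.+-inverseˡ (sum c))

      D-combination : ∀ c → D ᵀ ⊛ c ≗ M ᵀ ⊛ spread c
      D-combination c j = begin
        (D ᵀ ⊛ c) j                                              ≡⟨ ⊛-def (D ᵀ) c j ⟩
        sum (λ a → (M (suc a) j - M zero j) * c a)
          ≡⟨ sum-cong (λ a → distrib (M (suc a) j) (M zero j) (c a)) ⟩
        sum (λ a → M (suc a) j * c a - M zero j * c a)
          ≡⟨ sum-minus (λ a → M (suc a) j * c a) (λ a → M zero j * c a) ⟩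
        sum (λ a → M (suc a) j * c a) - sum (λ a → M zero j * c a)
          ≡⟨ cong (ℤ._-_ (sum (λ a → M (suc a) j * c a))) (sum-scale (M zero j) c) ⟩
        sum (λ a → M (suc a) j * c a) - M zero j * sum c
          ≡⟨ rearrange (sum (λ a → M (suc a) j * c a)) (M zero j) (sum c) ⟩
        M zero j * - sum c + sum (λ a → M (suc a) j * c a)       ≡⟨ sum-suc (λ i → M i j * spread c i) ⟨
        sum (λ i → M i j * spread c i)                           ≡⟨ ⊛-def (M ᵀ) (spread c) j ⟨
        (M ᵀ ⊛ spread c) j                                       ∎
        where
        open ≡-Reasoning
        distrib : ∀ a b c → (a - b) * c ≡ a * c - b * c
        distrib = solve-∀
        rearrange : ∀ a b c → a - b * c ≡ b * - c + a
        rearrange = solve-∀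

      A-D : ∀ a j → (A ⊛ D a) j ≡ + r * D a j
      A-D a j = begin
        (A ⊛ D a) j                                 ≡⟨ ⊛-cong A D≗ j ⟩
        (A ⊛ (M ᵀ ⊛ w)) j                           ≡⟨ A-Mᵀ w j ⟩
        + s * sum w + + r * (M ᵀ ⊛ w) j
          ≡⟨ cong₂ (λ x y → + s * x + + r * y) sum-w (sym (D≗ j)) ⟩
        + s * 0ℤ + + r * D a j                      ≡⟨ simplify (+ s) (+ r * D a j) ⟩
        + r * D a j                                 ∎
        where
        open ≡-Reasoning
        w : Vector ℤ (suc f)
        w i = identity (suc a) i - identity zero i
        D≗ : D a ≗ M ᵀ ⊛ w
        D≗ j = sym (trans (⊛-minus (M ᵀ) (identity (suc a)) (identity zero) j)
          (cong₂ _-_ (Mᵀ-identity (suc a) j) (Mᵀ-identity zero j)))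
        sum-w : sum w ≡ 0ℤ
        sum-w = trans (sum-minus (identity (suc a)) (identity zero))
          (cong₂ _-_ (sum-identity (suc a)) (sum-identity zero))
        simplify : ∀ s x → s * 0ℤ + x ≡ x
        simplify = solve-∀

      -- `M` undoes `Mᵀ` up to the factor `t`, because `J` vanishes on the sum-zero vector
      -- `spread c`.
      D-independent : ¬ + ℓ ∣ + t → Independent ℓ D
      D-independent ∤t c h a = euclid ℓ-prime (+ t) (c a)
        (∣-resp (begin
          (M ⊛ (D ᵀ ⊛ c)) (suc a)                    ≡⟨ ⊛-cong M (D-combination c) (suc a) ⟩
          (M ⊛ (M ᵀ ⊛ spread c)) (suc a)             ≡⟨ MMᵀ (spread c) (suc a) ⟩
          sum (spread c) + + t * c a                 ≡⟨ cong (ℤ._+ + t * c a) (sum-spread c) ⟩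
          0ℤ + + t * c a                             ≡⟨ ℤ.+-identityˡ (+ t * c a) ⟩
          + t * c a                                  ∎)
          (⊛-∣ M h (suc a)))
        ∤t
        where open ≡-Reasoning

    f≤μ : ¬ + ℓ ∣ + t → ∀ i → + (ℓ ^ i) ∣ + r → f ≤ μ i
    f≤μ ∤t i d = independent⇒≤μ i D (D-independent ∤t) λ a j → ∣-resp (sym (A-D a j)) (∣m⇒∣m*n (D a j) d)

    f+μ≤N : ¬ + ℓ ∣ + t → ¬ + ℓ ∣ + r → f ℕ.+ μ 1 ≤ N
    f+μ≤N ∤t ∤r = independent-image⇒ D λ c h → D-independent ∤t c λ j →
      euclid ℓ-prime (+ r) ((D ᵀ ⊛ c) j) (∣-resp (image c j) (h j)) ∤r
      where
      open ≡-Reasoning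
      simplify : ∀ s x → s * 0ℤ + x ≡ x
      simplify = solve-∀
      image : ∀ c j → (A ⊛ (D ᵀ ⊛ c)) j ≡ + r * (D ᵀ ⊛ c) j
      image c j = begin
        (A ⊛ (D ᵀ ⊛ c)) j                                ≡⟨ ⊛-cong A (D-combination c) j ⟩
        (A ⊛ (M ᵀ ⊛ spread c)) j                         ≡⟨ A-Mᵀ (spread c) j ⟩
        + s * sum (spread c) + + r * (M ᵀ ⊛ spread c) j
          ≡⟨ cong₂ (λ x y → + s * x + + r * y) (sum-spread c) (sym (D-combination c j)) ⟩
        + s * 0ℤ + + r * (D ᵀ ⊛ c) j                     ≡⟨ simplify (+ s) (+ r * (D ᵀ ⊛ c) j) ⟩
        + r * (D ᵀ ⊛ c) j                                ∎

    private
      A-constant : ∀ {d} (y : Vector ℤ N) c → (∀ j → d ∣ y j - c) → ∀ j → d ∣ (A ⊛ y) j - + s * + t * c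
      A-constant y c h j = ∣-resp
        (trans (⊛-minus A y (λ _ → c) j) (cong (ℤ._-_ ((A ⊛ y) j))
          (trans (⊛-cong A (λ _ → sym (ℤ.*-identityʳ c)) j)
            (trans (⊛-* A c (λ _ → 1ℤ) j) (trans (cong (ℤ._*_ c) (A-1 j)) (ℤ.*-comm c (+ s * + t)))))))
        (⊛-∣ A h j)

    -- Vanishing of the forms `D` makes `M ⊛ y` constant modulo `ℓ`, equal to `c`. Then
    -- `Mᵀ M y - A y` compares s c with s y, so `y` is itself the constant `c`, and A y = k′ c
    -- forces `c` to vanish.
    μ1≤f : Fin N → ¬ + ℓ ∣ + s → ¬ + ℓ ∣ + s * + t → μ 1 ≤ f
    μ1≤f j₀ ∤s ∤st = kernel⇒μ≤ 1 D trivial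
      where
      trivial : ∀ y → (∀ j → + (ℓ ^ 1) ∣ (A ⊛ y) j) → (∀ a → + ℓ ∣ (D ⊛ y) a) → ∀ j → + ℓ ∣ y j
      trivial y hA hD j = ∣-resp (x-y+y≡x (y j) c) (∣m∣n⇒∣m+n (y≡c j) ∣c)
        where
        open ≡-Reasoning
        c = (M ⊛ y) zero
        Ay : ∀ j → + ℓ ∣ (A ⊛ y) j
        Ay j = ∣^1⇒∣ ℓ-prime (hA j)
        constant : ∀ i → + ℓ ∣ (M ⊛ y) i - c
        constant zero = 0-∣ (ℤ.+-inverseʳ c)
        constant (suc a) = ∣-resp (trans (⊛-minusˡ (M ∘ suc) (λ _ → M zero) y a)
          (cong₂ _-_ (⊛-∘ M suc y a) (⊛-∘ M (λ _ → zero) y a))) (hD a)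
        y≡c : ∀ j → + ℓ ∣ y j - c
        y≡c j = euclid ℓ-prime (+ s) (y j - c)
          (∣-resp (begin
            ((M ᵀ ⊛ (M ⊛ y)) j - + s * c) - (A ⊛ y) j
              ≡⟨ cong (ℤ._-_ ((M ᵀ ⊛ (M ⊛ y)) j - + s * c)) (A-def y j) ⟩
            ((M ᵀ ⊛ (M ⊛ y)) j - + s * c) - ((M ᵀ ⊛ (M ⊛ y)) j - + s * y j)
              ≡⟨ simplify ((M ᵀ ⊛ (M ⊛ y)) j) (+ s) c (y j) ⟩
            + s * (y j - c) ∎)
            (∣m∣n⇒∣m-n (∣-resp (trans (⊛-minus (M ᵀ) (M ⊛ y) (λ _ → c) j)
                (cong (ℤ._-_ ((M ᵀ ⊛ (M ⊛ y)) j)) (Mᵀ-const c j))) (⊛-∣ (M ᵀ) constant j)) (Ay j)))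
          ∤s
          where
          simplify : ∀ m s c y → (m - s * c) - (m - s * y) ≡ s * (y - c)
          simplify = solve-∀
        ∣c : + ℓ ∣ c
        ∣c = euclid ℓ-prime (+ s * + t) c
          (∣-resp (x-[x-y]≡y ((A ⊛ y) j₀) (+ s * + t * c)) (∣m∣n⇒∣m-n (Ay j₀) (A-constant y c y≡c j₀))) ∤st

    -- Where `M y` vanishes modulo `ℓ`, the vector t y - Mᵀ M y is congruent to t y, and `M` maps it
    -- to the constant - s sum y. Thus `A` maps it to multiples of `s`. One point need not be
    -- tested, since the coordinates of `M y` add up to s sum y.
    N≤f+μ : ¬ + ℓ ∣ + t → + ℓ ∣ + s → ∀ i → + (ℓ ^ i) ∣ + s → N ≤ f ℕ.+ μ i
    N≤f+μ ∤t ∣s i ∣^s = codimension⇒ i (M ∘ suc) λ y h → y′ y , + t , ∤t , close y h , image y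
      where
      y′ : Vector ℤ N → Vector ℤ N
      y′ y j = + t * y j - (M ᵀ ⊛ (M ⊛ y)) j
      points-∣ : ∀ y → (∀ a → + ℓ ∣ (M ∘ suc ⊛ y) a) → ∀ i → + ℓ ∣ (M ⊛ y) i
      points-∣ y h (suc a) = ∣-resp (⊛-∘ M suc y a) (h a)
      points-∣ y h zero = ∣-resp
        (trans (cong (ℤ._- sum (λ a → (M ⊛ y) (suc a))) (trans (sym (sum-M y)) (sum-suc (M ⊛ y)))) (x+y-y≡x ((M ⊛ y) zero) (sum (λ a → (M ⊛ y) (suc a)))))
        (∣m∣n⇒∣m-n (∣m⇒∣m*n (sum y) ∣s) (∣-sum (λ a → points-∣ y h (suc a))))
      close : ∀ y → (∀ a → + ℓ ∣ (M ∘ suc ⊛ y) a) → ∀ j → + ℓ ∣ y′ y j - + t * y j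
      close y h j = ∣-resp (solve′ (+ t * y j) ((M ᵀ ⊛ (M ⊛ y)) j))
        (∣n⇒∣m*n (- 1ℤ) (⊛-∣ (M ᵀ) (points-∣ y h) j))
        where
        solve′ : ∀ a b → - 1ℤ * b ≡ (a - b) - a
        solve′ = solve-∀
      My′ : ∀ y k → (M ⊛ y′ y) k ≡ - (+ s * sum y)
      My′ y k = begin
        (M ⊛ y′ y) k                                           ≡⟨ ⊛-minus M (λ j → + t * y j) (M ᵀ ⊛ (M ⊛ y)) k ⟩
        (M ⊛ (λ j → + t * y j)) k - (M ⊛ (M ᵀ ⊛ (M ⊛ y))) k    ≡⟨ cong₂ _-_ (⊛-* M (+ t) y k) (MMᵀ (M ⊛ y) k) ⟩
        + t * (M ⊛ y) k - (sum (M ⊛ y) + + t * (M ⊛ y) k)      ≡⟨ simplify (+ t * (M ⊛ y) k) (sum (M ⊛ y)) ⟩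
        - sum (M ⊛ y)                                          ≡⟨ cong -_ (sum-M y) ⟩
        - (+ s * sum y)                                        ∎
        where
        open ≡-Reasoning
        simplify : ∀ a b → a - (b + a) ≡ - b
        simplify = solve-∀
      image : ∀ y j → + (ℓ ^ i) ∣ (A ⊛ y′ y) j
      image y j = ∣-resp (sym (A-def (y′ y) j)) (∣m∣n⇒∣m-n
        (⊛-∣ (M ᵀ) (λ k → ∣-resp (sym (My′ y k)) (ℤ∣.∣m⇒∣-m (∣m⇒∣m*n (sum y) ∣^s))) j)
        (∣m⇒∣m*n (y′ y j) ∣^s))

  -- Bounds when ℓ divides both s and t

  module DegenerateBounds {f N q s t r A} (G : PointLineGeometry (suc f) N q s t r A) (S : SmithNormalForm A)
    {ℓ} (ℓ-prime : Prime ℓ) (ℓ∤q : ¬ + ℓ ∣ + q) (ℓ∣s : + ℓ ∣ + s) (ℓ∣t : + ℓ ∣ + t) where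

    open PointLineGeometryProperties G
    open ElementaryDivisors S ℓ-prime

    private
      -- Two of the `suc (suc f)` points, `zero` and `ω`, are set aside: modulo `ℓ`, one dimension
      -- is lost because `M` takes values of sum zero, another because `Mᵀ` kills constants.
      -- Throughout, `suc f` is the multiplicity [n] - 1 of the eigenvalue `r`.
      ω : Fin (suc (suc f))
      ω = suc zero

      E : Fin f → Vector ℤ N
      E a = X (suc (suc a))

      -- The point vector of sum zero with entries `c` that vanishes at `ω`. By `ME` it is, up to
      -- `q`, the image under `M` of a combination of the `E a`.
      spread : Vector ℤ f → Vector ℤ (suc (suc f))
      spread c zero          = - sum c
      spread c (suc zero)    = 0ℤ
      spread c (suc (suc a)) = c a

      pad : Vector ℤ f → Vector ℤ (suc (suc f))
      pad c zero          = 0ℤ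
      pad c (suc zero)    = 0ℤ
      pad c (suc (suc a)) = c a

      sum-suc² : ∀ (v : Vector ℤ (suc (suc f))) → sum v ≡ v zero + (v ω + sum (λ a → v (suc (suc a))))
      sum-suc² v = trans (sum-suc v) (cong (ℤ._+_ (v zero)) (sum-suc (v ∘ suc)))

      E-combination : ∀ c → E ᵀ ⊛ c ≗ X ᵀ ⊛ pad c
      E-combination c j = begin
        (E ᵀ ⊛ c) j                                              ≡⟨ ⊛-def (E ᵀ) c j ⟩
        sum (λ a → E a j * c a)                                  ≡⟨ simplify (X zero j) (X ω j) (sum (λ a → E a j * c a)) ⟩
        X zero j * 0ℤ + (X ω j * 0ℤ + sum (λ a → E a j * c a))   ≡⟨ sum-suc² (λ i → X i j * pad c i) ⟨
        sum (λ i → X i j * pad c i)                              ≡⟨ ⊛-def (X ᵀ) (pad c) j ⟨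
        (X ᵀ ⊛ pad c) j                                          ∎
        where
        open ≡-Reasoning
        simplify : ∀ a b c → c ≡ a * 0ℤ + (b * 0ℤ + c)
        simplify = solve-∀

      sum-pad : ∀ c → sum (pad c) ≡ sum c
      sum-pad c = trans (sum-suc² (pad c)) (simplify (sum c))
        where
        simplify : ∀ c → 0ℤ + (0ℤ + c) ≡ c
        simplify = solve-∀

      ME : ∀ c → M ⊛ (E ᵀ ⊛ c) ≗ λ k → + q * spread c k
      ME c k = begin
        (M ⊛ (E ᵀ ⊛ c)) k                             ≡⟨ ⊛-cong M (E-combination c) k ⟩
        (M ⊛ (X ᵀ ⊛ pad c)) k                         ≡⟨ M-combination (pad c) k ⟩
        + q * (pad c k - identity zero k * sum (pad c)) ≡⟨ cong (ℤ._*_ (+ q)) (entry k) ⟩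
        + q * spread c k                              ∎
        where
        open ≡-Reasoning
        simplify₀ : ∀ c → 0ℤ - 1ℤ * c ≡ - c
        simplify₀ = solve-∀
        simplify₁ : ∀ a c → a - 0ℤ * c ≡ a
        simplify₁ = solve-∀
        entry : ∀ k → pad c k - identity zero k * sum (pad c) ≡ spread c k
        entry zero = trans (simplify₀ (sum (pad c))) (cong -_ (sum-pad c))
        entry (suc zero) = simplify₁ 0ℤ (sum (pad c))
        entry (suc (suc a)) = simplify₁ (c a) (sum (pad c))

      A-E : ∀ c j → (A ⊛ (E ᵀ ⊛ c)) j ≡ + q * (M ᵀ ⊛ spread c) j - + s * (E ᵀ ⊛ c) j
      A-E c j = trans (A-def (E ᵀ ⊛ c) j) (cong (ℤ._- + s * (E ᵀ ⊛ c) j)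
        (trans (⊛-cong (M ᵀ) (ME c) j) (⊛-* (M ᵀ) (+ q) (spread c) j)))

      -- Pairing with `X i` removes `c₀` and shows that `spread c` is constant modulo `ℓ`; the
      -- constant is its entry 0 at `ω`. Allowing `c₀` makes the all-ones vector available as a
      -- further member of an independent family.
      spread-independent : ∀ c c₀ → (∀ j → + ℓ ∣ + q * (M ᵀ ⊛ spread c) j + c₀) → ∀ a → + ℓ ∣ c a
      spread-independent c c₀ h a = ∣-resp (simplify (c a) (sum c))
        (∣m∣n⇒∣m-n (difference (suc (suc a))) (difference ω))
        where
        open ≡-Reasoning
        simplify : ∀ c s → (c - - s) - (0ℤ - - s) ≡ c
        simplify = solve-∀
        pairing : ∀ i → dot (X i) (λ j → + q * (M ᵀ ⊛ spread c) j + c₀) ≡ + q * (+ q * (spread c i - spread c zero))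
        pairing i = begin
          dot (X i) (λ j → + q * (M ᵀ ⊛ spread c) j + c₀)
            ≡⟨ dot-+ʳ (X i) (λ j → + q * (M ᵀ ⊛ spread c) j) (λ _ → c₀) ⟩
          dot (X i) (λ j → + q * (M ᵀ ⊛ spread c) j) + dot (X i) (λ _ → c₀)
            ≡⟨ cong₂ _+_ (trans (dot-scaleʳ (+ q) (X i) (M ᵀ ⊛ spread c)) (cong (ℤ._*_ (+ q)) (dot-X-Mᵀ i (spread c)))) (dot-X-const i c₀) ⟩
          + q * (+ q * (spread c i - spread c zero)) + 0ℤ
            ≡⟨ ℤ.+-identityʳ _ ⟩
          + q * (+ q * (spread c i - spread c zero)) ∎
        difference : ∀ i → + ℓ ∣ spread c i - spread c zero
        difference i = euclid ℓ-prime (+ q) _ (euclid ℓ-prime (+ q) _ (∣-resp (pairing i) (∣-dot (X i) h)) ℓ∤q) ℓ∤q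

    -- Since `ℓ` divides `s`, modulo `ℓ` the image of a combination of the `E a` is q `Mᵀ` applied
    -- to `spread c`.
    f+μ≤N : f ℕ.+ μ 1 ≤ N
    f+μ≤N = independent-image⇒ E λ c h → spread-independent c 0ℤ λ j →
      ∣-resp (trans (cong (ℤ._+ + s * (E ᵀ ⊛ c) j) (A-E c j)) (simplify (+ q * (M ᵀ ⊛ spread c) j) (+ s * (E ᵀ ⊛ c) j)))
        (∣m∣n⇒∣m+n (h j) (∣m⇒∣m*n ((E ᵀ ⊛ c) j) ℓ∣s))
      where
      simplify : ∀ a b → (a - b) + b ≡ a + 0ℤ
      simplify = solve-∀

    private
      ℓ∣r : + ℓ ∣ + r
      ℓ∣r = ∣-resp (trans (cong (ℤ._- + s) t≡) (x+y-y≡x (+ r) (+ s))) (∣m∣n⇒∣m-n ℓ∣t ℓ∣s)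

      -- In the first vector the coefficient `t` cancels the constant part: A 1 = s t and A `M zero`
      -- = s + r `M zero` leave - t r `M zero`. The others are (A + s - r) E, so `quadratic` turns
      -- their images into r s E, as the sums of the `E a` vanish. Modulo `ℓ` the family reduces to
      -- 1 and the `A ⊛ E a`.
      Y : Fin (suc f) → Vector ℤ N
      Y zero    j = 1ℤ - + t * M zero j
      Y (suc a) j = (A ⊛ E a) j + (+ s - + r) * E a j

      A-Y₀ : ∀ j → (A ⊛ Y zero) j ≡ - (+ t * + r * M zero j)
      A-Y₀ j = begin
        (A ⊛ (λ j → 1ℤ - + t * M zero j)) j                     ≡⟨ ⊛-minus A (λ _ → 1ℤ) (λ j → + t * M zero j) j ⟩
        (A ⊛ (λ _ → 1ℤ)) j - (A ⊛ (λ j → + t * M zero j)) j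
          ≡⟨ cong₂ _-_ (A-1 j) (trans (⊛-* A (+ t) (M zero) j) (cong (ℤ._*_ (+ t)) row)) ⟩
        + s * + t - + t * (+ s * 1ℤ + + r * M zero j)           ≡⟨ simplify (+ s) (+ t) (+ r) (M zero j) ⟩
        - (+ t * + r * M zero j)                                ∎
        where
        open ≡-Reasoning
        simplify : ∀ s t r m → s * t - t * (s * 1ℤ + r * m) ≡ - (t * r * m)
        simplify = solve-∀
        row : (A ⊛ M zero) j ≡ + s * 1ℤ + + r * M zero j
        row = trans (⊛-cong A (λ j → sym (Mᵀ-identity zero j)) j)
          (trans (A-Mᵀ (identity zero) j)
            (cong₂ (λ x y → + s * x + + r * y) (sum-identity (zero {suc f})) (Mᵀ-identity zero j)))

      A-Y₊ : ∀ a j → (A ⊛ Y (suc a)) j ≡ + r * + s * E a j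
      A-Y₊ a j = begin
        (A ⊛ Y (suc a)) j
          ≡⟨ trans (⊛-+ A (A ⊛ E a) (λ j → (+ s - + r) * E a j) j) (cong (ℤ._+_ ((A ⊛ (A ⊛ E a)) j)) (⊛-* A (+ s - + r) (E a) j)) ⟩
        (A ⊛ (A ⊛ E a)) j + (+ s - + r) * (A ⊛ E a) j           ≡⟨ quadratic (E a) j ⟩
        + r * + s * E a j + + s * + s * sum (E a)
          ≡⟨ cong (λ x → + r * + s * E a j + + s * + s * x) (sum-X (suc (suc a))) ⟩
        + r * + s * E a j + + s * + s * 0ℤ                      ≡⟨ simplify (+ r * + s * E a j) (+ s) ⟩
        + r * + s * E a j                                       ∎
        where
        open ≡-Reasoning
        simplify : ∀ x s → x + s * s * 0ℤ ≡ x
        simplify = solve-∀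

      Y-combination : ∀ c j → (Y ᵀ ⊛ c) j ≡
        (+ q * (M ᵀ ⊛ spread (c ∘ suc)) j + c zero) - (+ t * (M zero j * c zero) + + r * (E ᵀ ⊛ (c ∘ suc)) j)
      Y-combination c j = begin
        (Y ᵀ ⊛ c) j                                             ≡⟨ ⊛-def (Y ᵀ) c j ⟩
        sum (λ a → Y a j * c a)                                 ≡⟨ sum-suc (λ a → Y a j * c a) ⟩
        Y zero j * c zero + sum (λ a → Y (suc a) j * c′ a)
          ≡⟨ cong (ℤ._+_ (Y zero j * c zero)) (begin
            sum (λ a → Y (suc a) j * c′ a)
              ≡⟨ sum-cong (λ a → distrib ((A ⊛ E a) j) (+ s - + r) (E a j) (c′ a)) ⟩
            sum (λ a → (A ⊛ E a) j * c′ a + (+ s - + r) * (E a j * c′ a))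
              ≡⟨ sum-+ (λ a → (A ⊛ E a) j * c′ a) (λ a → (+ s - + r) * (E a j * c′ a)) ⟩
            sum (λ a → (A ⊛ E a) j * c′ a) + sum (λ a → (+ s - + r) * (E a j * c′ a))
              ≡⟨ cong₂ _+_ (sym (trans (⊛-combination A E c′ j) (⊛-def ((λ a → A ⊛ E a) ᵀ) c′ j)))
                   (trans (sum-scale (+ s - + r) (λ a → E a j * c′ a)) (cong (ℤ._*_ (+ s - + r)) (sym (⊛-def (E ᵀ) c′ j)))) ⟩
            (A ⊛ (E ᵀ ⊛ c′)) j + (+ s - + r) * (E ᵀ ⊛ c′) j
              ≡⟨ cong (ℤ._+ (+ s - + r) * (E ᵀ ⊛ c′) j) (A-E c′ j) ⟩
            (+ q * (M ᵀ ⊛ spread c′) j - + s * (E ᵀ ⊛ c′) j) + (+ s - + r) * (E ᵀ ⊛ c′) j ∎) ⟩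
        (1ℤ - + t * M zero j) * c zero +
          ((+ q * (M ᵀ ⊛ spread c′) j - + s * (E ᵀ ⊛ c′) j) + (+ s - + r) * (E ᵀ ⊛ c′) j)
          ≡⟨ simplify (+ t) (M zero j) (c zero) (+ q * (M ᵀ ⊛ spread c′) j) (+ s) (+ r) ((E ᵀ ⊛ c′) j) ⟩
        (+ q * (M ᵀ ⊛ spread c′) j + c zero) - (+ t * (M zero j * c zero) + + r * (E ᵀ ⊛ c′) j) ∎
        where
        open ≡-Reasoning
        c′ = c ∘ suc
        distrib : ∀ a u e c → (a + u * e) * c ≡ a * c + u * (e * c)
        distrib = solve-∀
        simplify : ∀ t m c a s r e → (1ℤ - t * m) * c + ((a - s * e) + (s - r) * e) ≡ (a + c) - (t * (m * c) + r * e)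
        simplify = solve-∀

    -- Modulo `ℓ` a combination of the `Y a` is q `Mᵀ (spread c)` plus a constant.
    -- `spread-independent` removes the coefficients of the former, after which evaluation at `j₀`
    -- removes the constant.
    f<μ : Fin N → ∀ i → + (ℓ ^ i) ∣ + t * + r → + (ℓ ^ i) ∣ + r * + s → suc f ≤ μ i
    f<μ j₀ i ∣tr ∣rs = independent⇒≤μ i Y independent image
      where
      image : ∀ a j → + (ℓ ^ i) ∣ (A ⊛ Y a) j
      image zero    j = ∣-resp (sym (A-Y₀ j)) (∣m⇒∣-m (∣m⇒∣m*n (M zero j) ∣tr))
      image (suc a) j = ∣-resp (sym (A-Y₊ a j)) (∣m⇒∣m*n (E a j) ∣rs)
      independent : Independent ℓ Y
      independent c h = λ { zero → head ; (suc a) → tail a }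
        where
        cancel₂ : ∀ a b → (a + b) - a ≡ b
        cancel₂ = solve-∀
        reduced : ∀ j → + ℓ ∣ + q * (M ᵀ ⊛ spread (c ∘ suc)) j + c zero
        reduced j = ∣-resp (trans (cong (ℤ._+ rest) (Y-combination c j))
            (x-y+y≡x (+ q * (M ᵀ ⊛ spread (c ∘ suc)) j + c zero) rest))
          (∣m∣n⇒∣m+n (h j) (∣m∣n⇒∣m+n (∣m⇒∣m*n (M zero j * c zero) ℓ∣t) (∣m⇒∣m*n ((E ᵀ ⊛ (c ∘ suc)) j) ℓ∣r)))
          where rest = + t * (M zero j * c zero) + + r * (E ᵀ ⊛ (c ∘ suc)) j
        tail : ∀ a → + ℓ ∣ c (suc a)
        tail = spread-independent (c ∘ suc) (c zero) reduced
        spread-∣ : ∀ i → + ℓ ∣ spread (c ∘ suc) i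
        spread-∣ zero          = ∣m⇒∣-m (∣-sum tail)
        spread-∣ (suc zero)    = divides 0ℤ refl
        spread-∣ (suc (suc a)) = tail a
        head : + ℓ ∣ c zero
        head = ∣-resp (cancel₂ (+ q * (M ᵀ ⊛ spread (c ∘ suc)) j₀) (c zero))
          (∣m∣n⇒∣m-n (reduced j₀) (∣n⇒∣m*n (+ q) (⊛-∣ (M ᵀ) spread-∣ j₀)))

    private
      sum-M-minus : ∀ y c → sum (λ i → (M ⊛ y) i - c) ≡ + s * sum y - (+ s + + q * + t) * c
      sum-M-minus y c = trans (sum-minus (M ⊛ y) (λ _ → c))
        (cong₂ _-_ (sum-M y) (trans (sum-const (suc (suc f)) c) (cong (ℤ._* c) points)))

    -- The forms make `M y` constant modulo `ℓ`; `v y` is its deviation from the value at `ω`, and q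
    -- y - Xᵀ v has that deviation removed. Under `M` only a constant remains, which `Mᵀ` multiplies
    -- by `s`, and a defect at the base point proportional to `sum (v y)`, a combination of `s` and
    -- `t`.
    N≤f+μ : ∀ i → + (ℓ ^ i) ∣ + s → + (ℓ ^ i) ∣ + t → N ≤ f ℕ.+ μ i
    N≤f+μ i ∣^s ∣^t = codimension⇒ i Z λ y h → y′ y , + q , ℓ∤q , close y h , image y
      where
      Z : Fin f → Fin N → ℤ
      Z a j = M (suc (suc a)) j - M ω j
      v : Vector ℤ N → Vector ℤ (suc (suc f))
      v y k = (M ⊛ y) k - (M ⊛ y) ω
      y′ : Vector ℤ N → Vector ℤ N
      y′ y j = + q * y j - (X ᵀ ⊛ v y) j
      sum-v-∣ : ∀ {d} y → d ∣ + s → d ∣ + t → d ∣ sum (v y)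
      sum-v-∣ y d∣s d∣t = ∣-resp (sym (sum-M-minus y ((M ⊛ y) ω)))
        (∣m∣n⇒∣m-n (∣m⇒∣m*n (sum y) d∣s) (∣m⇒∣m*n ((M ⊛ y) ω) (∣m∣n⇒∣m+n d∣s (∣n⇒∣m*n (+ q) d∣t))))
      v-∣ : ∀ y → (∀ a → + ℓ ∣ (Z ⊛ y) a) → ∀ k → + ℓ ∣ v y k
      v-∣ y h (suc zero) = divides 0ℤ (ℤ.+-inverseʳ ((M ⊛ y) ω))
      v-∣ y h (suc (suc a)) = ∣-resp (trans (⊛-minusˡ (λ a → M (suc (suc a))) (λ _ → M ω) y a)
        (cong₂ _-_ (⊛-∘ M (λ a → suc (suc a)) y a) (⊛-∘ M (λ _ → ω) y a))) (h a)
      v-∣ y h zero = ∣-resp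
        (trans (cong (ℤ._- (v y ω + rest)) (sum-suc² (v y))) (x+y-y≡x (v y zero) (v y ω + rest)))
        (∣m∣n⇒∣m-n (sum-v-∣ y ℓ∣s ℓ∣t) (∣m∣n⇒∣m+n (v-∣ y h ω) (∣-sum (λ a → v-∣ y h (suc (suc a))))))
        where
        rest = sum (λ a → v y (suc (suc a)))
      close : ∀ y → (∀ a → + ℓ ∣ (Z ⊛ y) a) → ∀ j → + ℓ ∣ y′ y j - + q * y j
      close y h j = ∣-resp (solve′ (+ q * y j) ((X ᵀ ⊛ v y) j)) (∣m⇒∣-m (⊛-∣ (X ᵀ) (v-∣ y h) j))
        where
        solve′ : ∀ a b → - b ≡ (a - b) - a
        solve′ = solve-∀
      My′ : ∀ y k → (M ⊛ y′ y) k ≡ + q * (M ⊛ y) ω + + q * sum (v y) * identity zero k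
      My′ y k = begin
        (M ⊛ y′ y) k                                            ≡⟨ ⊛-minus M (λ j → + q * y j) (X ᵀ ⊛ v y) k ⟩
        (M ⊛ (λ j → + q * y j)) k - (M ⊛ (X ᵀ ⊛ v y)) k         ≡⟨ cong₂ _-_ (⊛-* M (+ q) y k) (M-combination (v y) k) ⟩
        + q * (M ⊛ y) k - + q * (((M ⊛ y) k - (M ⊛ y) ω) - identity zero k * sum (v y))
          ≡⟨ simplify (+ q) ((M ⊛ y) k) ((M ⊛ y) ω) (identity zero k) (sum (v y)) ⟩
        + q * (M ⊛ y) ω + + q * sum (v y) * identity zero k     ∎
        where
        open ≡-Reasoning
        simplify : ∀ q a b e σ → q * a - q * ((a - b) - e * σ) ≡ q * b + q * σ * e
        simplify = solve-∀
      image : ∀ y j → + (ℓ ^ i) ∣ (A ⊛ y′ y) j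
      image y j = ∣-resp (sym (trans (A-def (y′ y) j) (cong (ℤ._- + s * y′ y j) (begin
          (M ᵀ ⊛ (M ⊛ y′ y)) j                                  ≡⟨ ⊛-cong (M ᵀ) (My′ y) j ⟩
          (M ᵀ ⊛ (λ k → + q * (M ⊛ y) ω + + q * sum (v y) * identity zero k)) j
            ≡⟨ ⊛-+ (M ᵀ) (λ _ → + q * (M ⊛ y) ω) (λ k → + q * sum (v y) * identity zero k) j ⟩
          (M ᵀ ⊛ (λ _ → + q * (M ⊛ y) ω)) j + (M ᵀ ⊛ (λ k → + q * sum (v y) * identity zero k)) j
            ≡⟨ cong₂ _+_ (Mᵀ-const (+ q * (M ⊛ y) ω) j) (⊛-* (M ᵀ) (+ q * sum (v y)) (identity zero) j) ⟩
          + s * (+ q * (M ⊛ y) ω) + + q * sum (v y) * (M ᵀ ⊛ identity zero) j ∎))))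
        (∣m∣n⇒∣m-n (∣m∣n⇒∣m+n (∣m⇒∣m*n (+ q * (M ⊛ y) ω) ∣^s)
            (∣m⇒∣m*n ((M ᵀ ⊛ identity zero) j) (∣n⇒∣m*n (+ q) (sum-v-∣ y ∣^s ∣^t))))
          (∣m⇒∣m*n (y′ y j) ∣^s))
        where open ≡-Reasoning

    -- One exponent beyond the valuation of `s`, the forms `E b` force `M y` to be constant modulo
    -- `ℓ ^ suc a`. Comparing `A y` with `Mᵀ v` and cancelling `s` then makes `y` constant modulo
    -- `ℓ`, and the coordinate at `j₀` detects that constant.
    μ≤1+f : Fin N → ∀ a → HasValuation ℓ s a → μ (suc a) ≤ suc f
    μ≤1+f j₀ a val = kernel⇒μ≤ (suc a) Z trivial
      where
      Z : Fin (suc f) → Fin N → ℤ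
      Z zero    = identity j₀
      Z (suc b) = E b
      s∣ : + (ℓ ^ a) ∣ + s
      s∣ = ∣-valuation ℓ-prime s a val
      ^-suc-∣ : ∀ {x y} → + ℓ ∣ x → + (ℓ ^ a) ∣ y → + (ℓ ^ suc a) ∣ x * y
      ^-suc-∣ p r = ∣-*-^ ℓ 1 a (∣⇒∣^1 ℓ-prime p) r
      s-cancel : ∀ x → + (ℓ ^ suc a) ∣ + s * x → + ℓ ∣ x
      s-cancel x d = ∣^1⇒∣ ℓ-prime (∣^-cancel-valuation ℓ-prime s a val 1 x
        (subst (λ e → + (ℓ ^ e) ∣ + s * x) (ℕ.+-comm 1 a) d))
      trivial : ∀ y → (∀ j → + (ℓ ^ suc a) ∣ (A ⊛ y) j) → (∀ b → + ℓ ∣ (Z ⊛ y) b) → ∀ j → + ℓ ∣ y j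
      trivial y hA hZ j = ∣-resp (x-[x-y]≡y w₀ (y j)) (∣m∣n⇒∣m-n ∣w₀ (w₀-y j))
        where
        open ≡-Reasoning
        w = M ⊛ y
        w₀ = w zero
        v : Vector ℤ (suc (suc f))
        v k = w k - w₀
        -- Pairing `E b` with A y gives q v - s (E · y). The form contributes one factor `ℓ` to E ·
        -- y and `s` contributes `ℓ ^ a`.
        v-E : ∀ b → + (ℓ ^ suc a) ∣ v (suc (suc b))
        v-E b = ∣^-cancel-∤ ℓ-prime (suc a) (+ q) (v (suc (suc b))) ℓ∤q
          (∣-resp (begin
            dot (E b) (A ⊛ y) + (E ⊛ y) b * + s
              ≡⟨ cong₂ _+_ (trans (dot-congʳ (E b) (A-def y)) (dot-minusʳ (E b) (M ᵀ ⊛ w) (λ j → + s * y j)))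
                   (cong (ℤ._* + s) (⊛-def E y b)) ⟩
            (dot (E b) (M ᵀ ⊛ w) - dot (E b) (λ j → + s * y j)) + dot (E b) y * + s
              ≡⟨ cong₂ (λ x z → (x - z) + dot (E b) y * + s) (dot-X-Mᵀ (suc (suc b)) w) (dot-scaleʳ (+ s) (E b) y) ⟩
            (+ q * v (suc (suc b)) - + s * dot (E b) y) + dot (E b) y * + s
              ≡⟨ simplify (+ q * v (suc (suc b))) (+ s) (dot (E b) y) ⟩
            + q * v (suc (suc b)) ∎)
            (∣m∣n⇒∣m+n (∣-dot (E b) hA)
              (^-suc-∣ (∣-resp (trans (⊛-def Z y (suc b)) (sym (⊛-def E y b))) (hZ (suc b))) s∣)))
          where
          simplify : ∀ a s b → (a - s * b) + b * s ≡ a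
          simplify = solve-∀
        -- As s = 1 + q, the sum of `v` is (M A y) at `zero` minus s t w₀, where `ℓ` divides `t` and
        -- `ℓ ^ a` divides `s`. The summand with factor t - (s t - q t) is zero by `s≡`.
        sum-v : + (ℓ ^ suc a) ∣ sum v
        sum-v = ∣-resp (begin
            (M ⊛ (A ⊛ y)) zero - + t * (+ s * w₀) + (+ t - (+ s * + t - + q * + t)) * w₀
              ≡⟨ cong₂ (λ x z → x - + t * (+ s * w₀) + (+ t - (z * + t - + q * + t)) * w₀) MA s≡ ⟩
            (+ s * sum y + + t * w₀ - + s * w₀) - + t * (+ s * w₀) + (+ t - ((1ℤ + + q) * + t - + q * + t)) * w₀
              ≡⟨ cong (λ z → (+ s * sum y + + t * w₀ - + s * w₀) - + t * (z * w₀) + (+ t - ((1ℤ + + q) * + t - + q * + t)) * w₀) s≡ ⟩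
            (+ s * sum y + + t * w₀ - + s * w₀) - + t * ((1ℤ + + q) * w₀) + (+ t - ((1ℤ + + q) * + t - + q * + t)) * w₀
              ≡⟨ simplify (+ s) (sum y) (+ t) w₀ (+ q) ⟩
            + s * sum y - (+ s + + q * + t) * w₀
              ≡⟨ sum-M-minus y w₀ ⟨
            sum v ∎)
          (∣m∣n⇒∣m+n (∣m∣n⇒∣m-n (⊛-∣ M hA zero) (^-suc-∣ ℓ∣t (∣m⇒∣m*n w₀ s∣)))
            (divides 0ℤ (trans (cong (λ z → (+ t - (z * + t - + q * + t)) * w₀) s≡) (zero! (+ t) (+ q) w₀))))
          where
          zero! : ∀ t q w → (t - ((1ℤ + q) * t - q * t)) * w ≡ 0ℤ
          zero! = solve-∀
          simplify : ∀ s y t w q → (s * y + t * w - s * w) - t * ((1ℤ + q) * w) + (t - ((1ℤ + q) * t - q * t)) * w ≡ s * y - (s + q * t) * w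
          simplify = solve-∀
          MA : (M ⊛ (A ⊛ y)) zero ≡ + s * sum y + + t * w₀ - + s * w₀
          MA = begin
            (M ⊛ (A ⊛ y)) zero                                        ≡⟨ ⊛-cong M (A-def y) zero ⟩
            (M ⊛ (λ j → (M ᵀ ⊛ w) j - + s * y j)) zero                ≡⟨ ⊛-minus M (M ᵀ ⊛ w) (λ j → + s * y j) zero ⟩
            (M ⊛ (M ᵀ ⊛ w)) zero - (M ⊛ (λ j → + s * y j)) zero
              ≡⟨ cong₂ _-_ (trans (MMᵀ w zero) (cong (ℤ._+ + t * w₀) (sum-M y))) (⊛-* M (+ s) y zero) ⟩
            + s * sum y + + t * w₀ - + s * w₀                         ∎
        v-∣ : ∀ k → + (ℓ ^ suc a) ∣ v k
        v-∣ zero = divides 0ℤ (ℤ.+-inverseʳ w₀)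
        v-∣ (suc (suc b)) = v-E b
        v-∣ (suc zero) = ∣-resp
          (trans (cong (ℤ._- rest) (sum-suc² v)) (trans (cong (λ z → (z + (v ω + rest)) - rest) (ℤ.+-inverseʳ w₀)) (cancel (v ω) rest)))
          (∣m∣n⇒∣m-n sum-v (∣-sum v-E))
          where
          rest = sum (λ b → v (suc (suc b)))
          cancel : ∀ a b → (0ℤ + (a + b)) - b ≡ a
          cancel = solve-∀
        w₀-y : ∀ j → + ℓ ∣ w₀ - y j
        w₀-y j = s-cancel (w₀ - y j) (∣-resp (begin
            (A ⊛ y) j - (M ᵀ ⊛ v) j
              ≡⟨ cong₂ _-_ (A-def y j) (trans (⊛-minus (M ᵀ) w (λ _ → w₀) j) (cong (ℤ._-_ ((M ᵀ ⊛ w) j)) (Mᵀ-const w₀ j))) ⟩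
            ((M ᵀ ⊛ w) j - + s * y j) - ((M ᵀ ⊛ w) j - + s * w₀)      ≡⟨ simplify ((M ᵀ ⊛ w) j) (+ s) (y j) w₀ ⟩
            + s * (w₀ - y j)                                          ∎)
            (∣m∣n⇒∣m-n (hA j) (⊛-∣ (M ᵀ) v-∣ j)))
          where
          simplify : ∀ m s y w → (m - s * y) - (m - s * w) ≡ s * (w - y)
          simplify = solve-∀
        ∣w₀ : + ℓ ∣ w₀
        ∣w₀ = ∣-resp (x-y+y≡x w₀ (y j₀)) (∣m∣n⇒∣m+n (w₀-y j₀)
          (∣-resp (trans (⊛-def Z y zero) (sum-identityˡ j₀ y)) (hZ zero)))

-- Points, lines and pencils over a finite field

module ProjectiveGeometry where

  import Algebra.Properties.CommutativeMonoid.Sum as CommutativeMonoidSum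
  import Algebra.Properties.Ring as RingProperties
  import Algebra.Solver.Ring.NaturalCoefficients.Default as SemiringSolver
  open import Data.Bool.Base using (if_then_else_)
  open import Data.Fin.Base using (splitAt; _↑ˡ_; _↑ʳ_; join)
  open import Data.Integer.Base as ℤ using (ℤ; +_; 0ℤ; 1ℤ)
  import Data.Integer.Properties as ℤ
  open import Data.Integer.Tactic.RingSolver using (solve-∀)
  open import Data.Nat.Base as ℕ using (ℕ; zero; suc)
  import Data.Nat.Properties as ℕ
  import Relation.Binary.Reasoning.Setoid as SetoidReasoning
  open import Relation.Unary using (_∈_; _⊆_; _≐_)
  open IntegerMatrices

  private
    variable
      r ℓr m ℓm : Level

  -- Coordinates over a finite field

  -- The number [k] without a division. The top power comes first to match the split of normalised
  -- vectors into those with first entry 1, whose tails are arbitrary, and those with first entry 0.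
  geometric : ℕ → ℕ → ℕ
  geometric q zero    = 0
  geometric q (suc k) = q ℕ.^ k ℕ.+ geometric q k

  module FiniteField (F : CommutativeRing r ℓr) {q} (isField : IsFieldOfOrder F q) where

    open CommutativeRing F hiding (_-_; zero)
    open IsFieldOfOrder isField public
    open SetoidReasoning setoid

    element : Fin q → Carrier
    element = Inverse.to cardinality

    index : Carrier → Fin q
    index = Inverse.from cardinality

    element-index : ∀ x → element (index x) ≈ x
    element-index = Inverse.strictlyInverseˡ cardinality

    index-element : ∀ a → index (element a) ≡ a
    index-element = Inverse.strictlyInverseʳ cardinality

    element-injective : ∀ {a b} → element a ≈ element b → a ≡ b
    element-injective {a} {b} eq = ≡.trans (≡.sym (index-element a))
      (≡.trans (Inverse.from-cong cardinality eq) (index-element b))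

    infix 4 _≈?_
    _≈?_ : ∀ x y → Dec (x ≈ y)
    x ≈? y = map′
      (λ eq → trans (sym (element-index x)) (trans (reflexive (≡.cong element eq)) (element-index y)))
      (Inverse.from-cong cardinality)
      (index x Fin.≟ index y)

    1≉0 : ¬ 1# ≈ 0#
    1≉0 = 0≉1 ∘ sym

    -- The nonzero vectors whose first nonzero entry is 1, one on each line
    -- through the origin.
    private
      normalised-⊎ : ∀ {k} (normalised : Fin (geometric q k) → Vector Carrier k) →
                     Fin (q ℕ.^ k) ⊎ Fin (geometric q k) → Vector Carrier (suc k)
      normalised-⊎ _ (inj₁ a) zero    = 1#
      normalised-⊎ _ (inj₁ a) (suc j) = element (finToFun a j)
      normalised-⊎ _ (inj₂ b) zero    = 0#
      normalised-⊎ f (inj₂ b) (suc j) = f b j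

    normalised : ∀ k → Fin (geometric q k) → Vector Carrier k
    normalised (suc k) i = normalised-⊎ (normalised k) (splitAt (q ℕ.^ k) i)

    normalised-nonzero : ∀ k i → ¬ (∀ j → normalised k i j ≈ 0#)
    normalised-nonzero (suc k) i h with splitAt (q ℕ.^ k) i
    ... | inj₁ a = 1≉0 (h zero)
    ... | inj₂ b = normalised-nonzero k b (h ∘ suc)

    normalised-complete : ∀ k (c : Vector Carrier k) → ¬ (∀ j → c j ≈ 0#) →
      ∃₂ λ i x → ¬ x ≈ 0# × (∀ j → c j ≈ x * normalised k i j)
    normalised-complete zero c c≉0 = contradiction (λ ()) c≉0
    normalised-complete (suc k) c c≉0 with c zero ≈? 0#
    ... | no c₀≉0 = a ↑ˡ geometric q k , c zero , c₀≉0 , entries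
      where
      c₀⁻¹ = proj₁ (invertible (c zero) c₀≉0)
      tail : Fin k → Fin q
      tail j = index (c₀⁻¹ * c (suc j))
      a : Fin (q ℕ.^ k)
      a = funToFin tail
      entries : ∀ j → c j ≈ c zero * normalised (suc k) (a ↑ˡ geometric q k) j
      entries j rewrite Fin.splitAt-↑ˡ (q ℕ.^ k) a (geometric q k) with j
      ... | zero   = sym (*-identityʳ (c zero))
      ... | suc j′ = begin
        c (suc j′)                        ≈⟨ *-identityˡ (c (suc j′)) ⟨
        1# * c (suc j′)                   ≈⟨ *-congʳ (proj₂ (invertible (c zero) c₀≉0)) ⟨
        c zero * c₀⁻¹ * c (suc j′)        ≈⟨ *-assoc (c zero) c₀⁻¹ (c (suc j′)) ⟩
        c zero * (c₀⁻¹ * c (suc j′))      ≈⟨ *-congˡ (element-index (c₀⁻¹ * c (suc j′))) ⟨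
        c zero * element (tail j′)        ≈⟨ *-congˡ (reflexive (≡.cong element (Fin.finToFun-funToFin tail j′))) ⟨
        c zero * element (finToFun a j′)  ∎
    ... | yes c₀≈0 with normalised-complete k (c ∘ suc) (λ h → c≉0 λ { zero → c₀≈0 ; (suc j) → h j })
    ...   | b , x , x≉0 , eq = q ℕ.^ k ↑ʳ b , x , x≉0 , entries
      where
      entries : ∀ j → c j ≈ x * normalised (suc k) (q ℕ.^ k ↑ʳ b) j
      entries j rewrite Fin.splitAt-↑ʳ (q ℕ.^ k) (geometric q k) b with j
      ... | zero   = trans c₀≈0 (sym (zeroʳ x))
      ... | suc j′ = eq j′

    normalised-unique : ∀ k i i′ x → (∀ j → normalised k i j ≈ x * normalised k i′ j) → i ≡ i′
    normalised-unique (suc k) i i′ x h = ≡.trans (≡.sym (Fin.join-splitAt (q ℕ.^ k) (geometric q k) i))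
      (≡.trans (≡.cong (join (q ℕ.^ k) (geometric q k)) (unique (splitAt (q ℕ.^ k) i) (splitAt (q ℕ.^ k) i′) h))
        (Fin.join-splitAt (q ℕ.^ k) (geometric q k) i′))
      where
      unique : ∀ s s′ → (∀ j → normalised-⊎ (normalised k) s j ≈ x * normalised-⊎ (normalised k) s′ j) → s ≡ s′
      unique (inj₁ a) (inj₁ a′) h = ≡.cong inj₁ (≡.trans (≡.sym (Fin.funToFin-finToFin {k} {q} a))
        (≡.trans (funToFin-cong λ j → element-injective (trans (h (suc j)) (trans (*-congʳ x≈1) (*-identityˡ _))))
          (Fin.funToFin-finToFin {k} {q} a′)))
        where
        x≈1 : x ≈ 1#
        x≈1 = trans (sym (*-identityʳ x)) (sym (h zero))
      unique (inj₁ a) (inj₂ b′) h = contradiction (trans (h zero) (zeroʳ x)) 1≉0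
      unique (inj₂ b) (inj₁ a′) h = contradiction
        (λ j → trans (h (suc j)) (trans (*-congʳ (trans (sym (*-identityʳ x)) (sym (h zero)))) (zeroˡ _)))
        (normalised-nonzero k b)
      unique (inj₂ b) (inj₂ b′) h = ≡.cong inj₂ (normalised-unique k b b′ x (h ∘ suc))

  module LinearAlgebra {F : CommutativeRing r ℓr} {q} (isField : IsFieldOfOrder F q) (V : Module F m ℓm) where

    open CommutativeRing F hiding (_-_; zero)
    open FiniteField F isField
    open Module V
    open CommutativeMonoidSum +ᴹ-commutativeMonoid using () renaming
      (sum-cong-≋ to sumᴹ-cong; ∑-distrib-+ to sumᴹ-+ᴹ; sum-replicate-zero to sumᴹ-zero)
    open SetoidReasoning ≈ᴹ-setoid

    private
      variable
        k : ℕ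

      lc : Vector Carrier k → Vector Carrierᴹ k → Carrierᴹ
      lc = linearCombination V

    lc-cong : ∀ {c d : Vector Carrier k} v → (∀ i → c i ≈ d i) → lc c v ≈ᴹ lc d v
    lc-cong v eq = sumᴹ-cong λ i → *ₗ-congʳ (eq i)

    lc-+ : ∀ (c d : Vector Carrier k) v → lc (λ i → c i + d i) v ≈ᴹ lc c v +ᴹ lc d v
    lc-+ c d v = ≈ᴹ-trans (sumᴹ-cong λ i → *ₗ-distribʳ (v i) (c i) (d i)) (sumᴹ-+ᴹ (λ i → c i *ₗ v i) (λ i → d i *ₗ v i))

    lc-* : ∀ x (c : Vector Carrier k) v → lc (λ i → x * c i) v ≈ᴹ x *ₗ lc c v
    lc-* {zero}  x c v = ≈ᴹ-sym (*ₗ-zeroʳ x)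
    lc-* {suc k} x c v = ≈ᴹ-trans
      (+ᴹ-cong (*ₗ-assoc x (c zero) (v zero)) (lc-* x (c ∘ suc) (v ∘ suc)))
      (≈ᴹ-sym (*ₗ-distribˡ x _ _))

    lc-0 : ∀ (c : Vector Carrier k) v → (∀ i → c i ≈ 0#) → lc c v ≈ᴹ 0ᴹ
    lc-0 {k} c v eq = ≈ᴹ-trans (sumᴹ-cong λ i → ≈ᴹ-trans (*ₗ-congʳ (eq i)) (*ₗ-zeroˡ (v i))) (sumᴹ-zero k)

    -1*x+x : ∀ x → (- 1#) *ₗ x +ᴹ x ≈ᴹ 0ᴹ
    -1*x+x x = begin
      (- 1#) *ₗ x +ᴹ x             ≈⟨ +ᴹ-congˡ (*ₗ-identityˡ x) ⟨
      (- 1#) *ₗ x +ᴹ 1# *ₗ x       ≈⟨ *ₗ-distribʳ x (- 1#) 1# ⟨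
      (- 1# + 1#) *ₗ x             ≈⟨ *ₗ-congʳ (-‿inverseˡ 1#) ⟩
      0# *ₗ x                      ≈⟨ *ₗ-zeroˡ x ⟩
      0ᴹ                           ∎

    independent⇒injective : ∀ {v : Vector Carrierᴹ k} → LinearlyIndependent V v →
                            ∀ c d → lc c v ≈ᴹ lc d v → ∀ i → c i ≈ d i
    independent⇒injective {v = v} indep c d eq i = trans (sym (+-identityˡ (c i))) (trans
      (+-congʳ (sym (-‿inverseʳ (d i)))) (trans (+-assoc (d i) (- d i) (c i))
      (trans (+-congˡ (trans (+-congʳ (-1*x≈ (d i))) zero-i)) (+-identityʳ (d i)))))
      where
      open RingProperties ring using (-1*x≈-x)
      -1*x≈ : ∀ x → - x ≈ - 1# * x
      -1*x≈ x = sym (-1*x≈-x x)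
      zero-i : - 1# * d i + c i ≈ 0#
      zero-i = indep (λ i → - 1# * d i + c i) (begin
        lc (λ i → - 1# * d i + c i) v           ≈⟨ lc-+ (λ i → - 1# * d i) c v ⟩
        lc (λ i → - 1# * d i) v +ᴹ lc c v       ≈⟨ +ᴹ-cong (lc-* (- 1#) d v) eq ⟩
        (- 1#) *ₗ lc d v +ᴹ lc d v              ≈⟨ -1*x+x (lc d v) ⟩
        0ᴹ                                      ∎) i

    *ₗ-cancel : ∀ {x y v} → ¬ x ≈ 0# → x *ₗ v ≈ᴹ y → ∃ λ x⁻¹ → ¬ x⁻¹ ≈ 0# × v ≈ᴹ x⁻¹ *ₗ y
    *ₗ-cancel {x} {y} {v} x≉0 eq = z , z≉0 , (begin
      v                ≈⟨ *ₗ-identityˡ v ⟨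
      1# *ₗ v          ≈⟨ *ₗ-congʳ xz≈1 ⟨
      (x * z) *ₗ v     ≈⟨ *ₗ-congʳ (*-comm x z) ⟩
      (z * x) *ₗ v     ≈⟨ *ₗ-assoc z x v ⟩
      z *ₗ (x *ₗ v)    ≈⟨ *ₗ-congˡ eq ⟩
      z *ₗ y           ∎)
      where
      z = proj₁ (invertible x x≉0)
      xz≈1 = proj₂ (invertible x x≉0)
      z≉0 : ¬ z ≈ 0#
      z≉0 z≈0 = 1≉0 (trans (sym xz≈1) (trans (*-congˡ z≈0) (zeroʳ x)))

    -- The projective points of `W` as a finite transversal: one vector is chosen on each line
    -- through the origin, so that points are compared by index and no quotient is formed.
    record Representatives (W : Subspace V) (k : ℕ) : Set (r ⊔ ℓr ⊔ m ⊔ ℓm) where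
      field
        point    : Fin k → Carrierᴹ
        ∈W       : ∀ a → Subspace.members W (point a)
        nonzero  : ∀ a → ¬ point a ≈ᴹ 0ᴹ
        unique   : ∀ a b x → point a ≈ᴹ x *ₗ point b → a ≡ b
        complete : ∀ {z} → Subspace.members W z → ¬ z ≈ᴹ 0ᴹ → ∃₂ λ a x → ¬ x ≈ 0# × z ≈ᴹ x *ₗ point a

    lc-closed : ∀ (W : Subspace V) (c : Vector Carrier k) v →
                (∀ i → Subspace.members W (v i)) → Subspace.members W (lc c v)
    lc-closed {zero}  W c v h = Subspace.0-closed W
    lc-closed {suc k} W c v h = Subspace.+-closed W (Subspace.*ₗ-closed W (c zero) (h zero))
      (lc-closed W (c ∘ suc) (v ∘ suc) (h ∘ suc))

    representatives : ∀ {W : Subspace V} → HasDimension V W k → Representatives W (geometric q k)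
    representatives {k} {W} (v , basis) = record
      { point    = λ a → lc (normalised k a) v
      ; ∈W       = λ a → lc-closed W (normalised k a) v in-subspace
      ; nonzero  = λ a eq → normalised-nonzero k a (independent (normalised k a) eq)
      ; unique   = λ a b x eq → normalised-unique k a b x (independent⇒injective independent
          (normalised k a) (λ j → x * normalised k b j) (≈ᴹ-trans eq (≈ᴹ-sym (lc-* x (normalised k b) v))))
      ; complete = λ z∈W z≉0 → complete (proj₁ (spanning z∈W)) (proj₂ (spanning z∈W)) z≉0
      }
      where
      open IsBasis basis
      complete : ∀ {z} c → z ≈ᴹ lc c v → ¬ z ≈ᴹ 0ᴹ →
                 ∃₂ λ a x → ¬ x ≈ 0# × z ≈ᴹ x *ₗ lc (normalised k a) v
      complete c z≈ z≉0 with normalised-complete k c (λ c≈0 → z≉0 (≈ᴹ-trans z≈ (lc-0 c v c≈0)))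
      ... | a , x , x≉0 , eq = a , x , x≉0 ,
        ≈ᴹ-trans z≈ (≈ᴹ-trans (lc-cong v eq) (lc-* x (normalised k a) v))

  -- Planes spanned by two vectors

  module Planes {F : CommutativeRing r ℓr} {q} (isField : IsFieldOfOrder F q) (V : Module F m ℓm) where

    open CommutativeRing F hiding (_-_; zero)
    open RingProperties ring using (-‿distribˡ-*; -‿distribʳ-*; -‿involutive; -0#≈0#)
    open FiniteField F isField
    open LinearAlgebra isField V
    open Module V
    open Subspace

    module _ (W : Subspace V) where

      +-cancelˡ-∈ : ∀ {x y} → x +ᴹ y ∈ members W → x ∈ members W → y ∈ members W
      +-cancelˡ-∈ {x} {y} x+y∈ x∈ = resp-≈ W (begin
        (- 1#) *ₗ x +ᴹ (x +ᴹ y)     ≈⟨ +ᴹ-assoc ((- 1#) *ₗ x) x y ⟨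
        ((- 1#) *ₗ x +ᴹ x) +ᴹ y     ≈⟨ +ᴹ-congʳ (-1*x+x x) ⟩
        0ᴹ +ᴹ y                     ≈⟨ +ᴹ-identityˡ y ⟩
        y                           ∎)
        (+-closed W (*ₗ-closed W (- 1#) x∈) x+y∈)
        where open SetoidReasoning ≈ᴹ-setoid

      +-cancelʳ-∈ : ∀ {x y} → x +ᴹ y ∈ members W → y ∈ members W → x ∈ members W
      +-cancelʳ-∈ {x} {y} x+y∈ = +-cancelˡ-∈ (resp-≈ W (+ᴹ-comm x y) x+y∈)

      *ₗ-cancel-∈ : ∀ {c x} → ¬ c ≈ 0# → c *ₗ x ∈ members W → x ∈ members W
      *ₗ-cancel-∈ {c} {x} c≉0 cx∈ with *ₗ-cancel c≉0 ≈ᴹ-refl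
      ... | c⁻¹ , _ , eq = resp-≈ W (≈ᴹ-sym eq) (*ₗ-closed W c⁻¹ cx∈)

    comb : Carrier → Carrierᴹ → Carrier → Carrierᴹ → Carrierᴹ
    comb α u β v = α *ₗ u +ᴹ β *ₗ v

    Independent₂ : Carrierᴹ → Carrierᴹ → Set _
    Independent₂ u v = ∀ α β → comb α u β v ≈ᴹ 0ᴹ → α ≈ 0# × β ≈ 0#

    comb-closed : ∀ (W : Subspace V) {u v} → u ∈ members W → v ∈ members W → ∀ α β → comb α u β v ∈ members W
    comb-closed W u∈ v∈ α β = +-closed W (*ₗ-closed W α u∈) (*ₗ-closed W β v∈)

    comb-+ : ∀ α β α′ β′ u v → comb α u β v +ᴹ comb α′ u β′ v ≈ᴹ comb (α + α′) u (β + β′) v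
    comb-+ α β α′ β′ u v = begin
      (α *ₗ u +ᴹ β *ₗ v) +ᴹ (α′ *ₗ u +ᴹ β′ *ₗ v)   ≈⟨ +ᴹ-assoc _ _ _ ⟩
      α *ₗ u +ᴹ (β *ₗ v +ᴹ (α′ *ₗ u +ᴹ β′ *ₗ v))   ≈⟨ +ᴹ-congˡ (+ᴹ-assoc _ _ _) ⟨
      α *ₗ u +ᴹ ((β *ₗ v +ᴹ α′ *ₗ u) +ᴹ β′ *ₗ v)   ≈⟨ +ᴹ-congˡ (+ᴹ-congʳ (+ᴹ-comm _ _)) ⟩
      α *ₗ u +ᴹ ((α′ *ₗ u +ᴹ β *ₗ v) +ᴹ β′ *ₗ v)   ≈⟨ +ᴹ-congˡ (+ᴹ-assoc _ _ _) ⟩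
      α *ₗ u +ᴹ (α′ *ₗ u +ᴹ (β *ₗ v +ᴹ β′ *ₗ v))   ≈⟨ +ᴹ-assoc _ _ _ ⟨
      (α *ₗ u +ᴹ α′ *ₗ u) +ᴹ (β *ₗ v +ᴹ β′ *ₗ v)   ≈⟨ +ᴹ-cong (*ₗ-distribʳ u α α′) (*ₗ-distribʳ v β β′) ⟨
      comb (α + α′) u (β + β′) v                   ∎
      where open SetoidReasoning ≈ᴹ-setoid

    span₂ : Carrierᴹ → Carrierᴹ → Subspace V
    span₂ u v = record
      { members   = λ z → ∃₂ λ α β → z ≈ᴹ comb α u β v
      ; resp-≈    = λ { x≈y (α , β , eq) → α , β , ≈ᴹ-trans (≈ᴹ-sym x≈y) eq }
      ; 0-closed  = 0# , 0# , ≈ᴹ-sym (≈ᴹ-trans (+ᴹ-cong (*ₗ-zeroˡ u) (*ₗ-zeroˡ v)) (+ᴹ-identityˡ 0ᴹ))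
      ; +-closed  = λ { (α , β , eq) (α′ , β′ , eq′) → α + α′ , β + β′ ,
          ≈ᴹ-trans (+ᴹ-cong eq eq′) (comb-+ α β α′ β′ u v) }
      ; *ₗ-closed = λ { c (α , β , eq) → c * α , c * β , ≈ᴹ-trans (*ₗ-congˡ eq)
          (≈ᴹ-trans (*ₗ-distribˡ c _ _) (≈ᴹ-sym (+ᴹ-cong (*ₗ-assoc c α u) (*ₗ-assoc c β v)))) }
      }

    left∈span₂ : ∀ u v → u ∈ members (span₂ u v)
    left∈span₂ u v = 1# , 0# , ≈ᴹ-sym (≈ᴹ-trans (+ᴹ-cong (*ₗ-identityˡ u) (*ₗ-zeroˡ v)) (+ᴹ-identityʳ u))

    right∈span₂ : ∀ u v → v ∈ members (span₂ u v)
    right∈span₂ u v = 0# , 1# , ≈ᴹ-sym (≈ᴹ-trans (+ᴹ-cong (*ₗ-zeroˡ u) (*ₗ-identityˡ v)) (+ᴹ-identityˡ v))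

    span₂-dimension : ∀ {u v} → Independent₂ u v → HasDimension V (span₂ u v) 2
    span₂-dimension {u} {v} indep = uv , record
      { in-subspace = λ { zero → left∈span₂ u v ; (suc zero) → right∈span₂ u v }
      ; independent = λ c eq → λ { zero → proj₁ (both c eq) ; (suc zero) → proj₂ (both c eq) }
      ; spanning    = λ { (α , β , eq) → (λ { zero → α ; (suc _) → β }) ,
          ≈ᴹ-trans eq (+ᴹ-congˡ (≈ᴹ-sym (+ᴹ-identityʳ _))) }
      }
      where
      uv : Vector Carrierᴹ 2
      uv zero    = u
      uv (suc _) = v
      both : ∀ c → linearCombination V c uv ≈ᴹ 0ᴹ → c zero ≈ 0# × c (suc zero) ≈ 0#
      both c eq = indep (c zero) (c (suc zero)) (≈ᴹ-trans (+ᴹ-congˡ (≈ᴹ-sym (+ᴹ-identityʳ _))) eq)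

    -- Cramer's rule in coordinates with respect to a basis of W.
    module _ {W : Subspace V} (dim : HasDimension V W 2) {u v : Carrierᴹ}
             (indep : Independent₂ u v) (u∈ : u ∈ members W) (v∈ : v ∈ members W) where

      private
        w = proj₁ dim
        open IsBasis (proj₂ dim)
        a = proj₁ (spanning u∈)
        c = proj₁ (spanning v∈)
        i₀ i₁ : Fin 2
        i₀ = zero
        i₁ = suc zero

        lc : Vector Carrier 2 → Carrierᴹ
        lc x = linearCombination V x w

        comb≈lc : ∀ α β → comb α u β v ≈ᴹ lc (λ i → α * a i + β * c i)
        comb≈lc α β = ≈ᴹ-sym (≈ᴹ-trans (lc-+ (λ i → α * a i) (λ i → β * c i) w)
          (+ᴹ-cong (≈ᴹ-trans (lc-* α a w) (*ₗ-congˡ (≈ᴹ-sym (proj₂ (spanning u∈)))))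
                   (≈ᴹ-trans (lc-* β c w) (*ₗ-congˡ (≈ᴹ-sym (proj₂ (spanning v∈)))))))

        Δ : Carrier
        Δ = a i₀ * c i₁ + - (a i₁ * c i₀)

        open SetoidReasoning setoid

        open SemiringSolver commutativeSemiring using (solve; _:=_; _:+_; _:*_)

        +-- : ∀ x y → x * y + (- y) * x ≈ 0#
        +-- x y = begin
          x * y + (- y) * x      ≈⟨ +-cong (*-comm x y) (sym (-‿distribˡ-* y x)) ⟩
          y * x + - (y * x)      ≈⟨ -‿inverseʳ (y * x) ⟩
          0#                     ∎

        -≈0 : ∀ {x} → - x ≈ 0# → x ≈ 0#
        -≈0 {x} eq = trans (sym (-‿involutive x)) (trans (-‿cong eq) -0#≈0#)

        -- With Δ zero, c₁ u - a₁ v has both coordinates zero, so c₁ and a₁ vanish by independence.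
        -- Then c₀ u - a₀ v is zero as well, and u has no nonzero coordinate.
        Δ≉0 : ¬ Δ ≈ 0#
        Δ≉0 Δ≈0 = 1≉0 (proj₁ (indep 1# 0# (≈ᴹ-trans (+ᴹ-cong (*ₗ-identityˡ u) (*ₗ-zeroˡ v))
            (≈ᴹ-trans (+ᴹ-identityʳ u) u≈0))))
          where
          row₁ : c i₁ ≈ 0# × - a i₁ ≈ 0#
          row₁ = indep (c i₁) (- a i₁) (≈ᴹ-trans (comb≈lc (c i₁) (- a i₁)) (lc-0 (λ i → c i₁ * a i + (- a i₁) * c i) w λ
            { zero → trans (+-cong (*-comm (c i₁) (a i₀)) (sym (-‿distribˡ-* (a i₁) (c i₀)))) Δ≈0
            ; (suc zero) → +-- (c i₁) (a i₁) }))
          a₁≈0 : a i₁ ≈ 0#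
          a₁≈0 = -≈0 (proj₂ row₁)
          row₀ : c i₀ ≈ 0# × - a i₀ ≈ 0#
          row₀ = indep (c i₀) (- a i₀) (≈ᴹ-trans (comb≈lc (c i₀) (- a i₀)) (lc-0 (λ i → c i₀ * a i + (- a i₀) * c i) w λ
            { zero → +-- (c i₀) (a i₀)
            ; (suc zero) → trans (+-cong (trans (*-congˡ a₁≈0) (zeroʳ (c i₀)))
                (trans (*-congˡ (proj₁ row₁)) (zeroʳ (- a i₀)))) (+-identityˡ 0#) }))
          u≈0 : u ≈ᴹ 0ᴹ
          u≈0 = ≈ᴹ-trans (proj₂ (spanning u∈)) (lc-0 a w λ { zero → -≈0 (proj₂ row₀) ; (suc zero) → a₁≈0 })

        Δ⁻¹ : Carrier
        Δ⁻¹ = proj₁ (invertible Δ Δ≉0)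

        Δ⁻¹-cancel : ∀ x → Δ⁻¹ * (x * Δ) ≈ x
        Δ⁻¹-cancel x = begin
          Δ⁻¹ * (x * Δ)     ≈⟨ *-comm Δ⁻¹ (x * Δ) ⟩
          x * Δ * Δ⁻¹       ≈⟨ *-assoc x Δ Δ⁻¹ ⟩
          x * (Δ * Δ⁻¹)     ≈⟨ *-congˡ (proj₂ (invertible Δ Δ≉0)) ⟩
          x * 1#            ≈⟨ *-identityʳ x ⟩
          x                 ∎

        -- An identity of commutative semirings: `m` and `n` will be the negatives of `e₁` and `e₀`,
        -- so that the last summand vanishes and the rest becomes d e₀ Δ, as `collapse` shows.
        factor₀ : ∀ d e₀ e₁ m n a₀ a₁ c₀ c₁ →
          d * (e₀ * c₁ + m * c₀) * a₀ + d * (e₁ * a₀ + n * a₁) * c₀ ≈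
          d * (e₀ * (a₀ * c₁) + n * (a₁ * c₀)) + d * ((m + e₁) * (a₀ * c₀))
        factor₀ = solve 9 (λ d e₀ e₁ m n a₀ a₁ c₀ c₁ →
          (d :* (e₀ :* c₁ :+ m :* c₀) :* a₀ :+ d :* (e₁ :* a₀ :+ n :* a₁) :* c₀) :=
          (d :* (e₀ :* (a₀ :* c₁) :+ n :* (a₁ :* c₀)) :+ d :* ((m :+ e₁) :* (a₀ :* c₀)))) refl

        factor₁ : ∀ d e₀ e₁ m n a₀ a₁ c₀ c₁ →
          d * (e₀ * c₁ + m * c₀) * a₁ + d * (e₁ * a₀ + n * a₁) * c₁ ≈
          d * (e₁ * (a₀ * c₁) + m * (a₁ * c₀)) + d * ((n + e₀) * (a₁ * c₁))
        factor₁ = solve 9 (λ d e₀ e₁ m n a₀ a₁ c₀ c₁ →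
          (d :* (e₀ :* c₁ :+ m :* c₀) :* a₁ :+ d :* (e₁ :* a₀ :+ n :* a₁) :* c₁) :=
          (d :* (e₁ :* (a₀ :* c₁) :+ m :* (a₁ :* c₀)) :+ d :* ((n :+ e₀) :* (a₁ :* c₁)))) refl

        collapse : ∀ x y z → Δ⁻¹ * (x * (a i₀ * c i₁) + (- x) * (a i₁ * c i₀)) + Δ⁻¹ * ((- y + y) * z) ≈ x
        collapse x y z = begin
          Δ⁻¹ * (x * (a i₀ * c i₁) + (- x) * (a i₁ * c i₀)) + Δ⁻¹ * ((- y + y) * z)
            ≈⟨ +-cong (*-congˡ (+-congˡ (trans (sym (-‿distribˡ-* x _)) (-‿distribʳ-* x _))))
                 (*-congˡ (trans (*-congʳ (-‿inverseˡ y)) (zeroˡ z))) ⟩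
          Δ⁻¹ * (x * (a i₀ * c i₁) + x * - (a i₁ * c i₀)) + Δ⁻¹ * 0#
            ≈⟨ +-cong (*-congˡ (sym (distribˡ x _ _))) (zeroʳ Δ⁻¹) ⟩
          Δ⁻¹ * (x * Δ) + 0#
            ≈⟨ +-identityʳ _ ⟩
          Δ⁻¹ * (x * Δ)
            ≈⟨ Δ⁻¹-cancel x ⟩
          x ∎

      ⊆-span₂ : members W ⊆ members (span₂ u v)
      ⊆-span₂ {z} z∈ = α , β , ≈ᴹ-trans (proj₂ (spanning z∈)) (≈ᴹ-trans (lc-cong w coordinates) (≈ᴹ-sym (comb≈lc α β)))
        where
        e = proj₁ (spanning z∈)
        α = Δ⁻¹ * (e i₀ * c i₁ + (- e i₁) * c i₀)
        β = Δ⁻¹ * (e i₁ * a i₀ + (- e i₀) * a i₁)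
        coordinates : ∀ i → e i ≈ α * a i + β * c i
        coordinates zero = sym (trans
          (factor₀ Δ⁻¹ (e i₀) (e i₁) (- e i₁) (- e i₀) (a i₀) (a i₁) (c i₀) (c i₁)) (collapse (e i₀) (e i₁) (a i₀ * c i₀)))
        coordinates (suc zero) = sym (trans
          (factor₁ Δ⁻¹ (e i₀) (e i₁) (- e i₁) (- e i₀) (a i₀) (a i₁) (c i₀) (c i₁)) (collapse (e i₁) (e i₀) (a i₁ * c i₁)))

  -- The incidence matrix

  indicator : ∀ {p} {P : Set p} → Dec P → ℤ
  indicator P? = if does P? then 1ℤ else 0ℤ

  indicator-yes : ∀ {p} {P : Set p} (P? : Dec P) → P → indicator P? ≡ 1ℤ
  indicator-yes (yes _) _ = ≡.refl
  indicator-yes (no ¬p) p = contradiction p ¬p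

  indicator-no : ∀ {p} {P : Set p} (P? : Dec P) → ¬ P → indicator P? ≡ 0ℤ
  indicator-no (no _) _ = ≡.refl
  indicator-no (yes p) ¬p = contradiction p ¬p

  sum-indicator : ∀ {k n p} {P : Pred (Fin n) p} (P? : Decidable P) (σ : Fin k → Fin n) →
    Injective _≡_ _≡_ σ → (∀ a → P (σ a)) → (∀ {i} → P i → ∃ λ a → σ a ≡ i) →
    sum (λ i → indicator (P? i)) ≡ + k
  sum-indicator {k} P? σ injective ∈P surjective = begin
    sum (λ i → indicator (P? i))             ≡⟨ sum-cong fibre ⟩
    sum (λ i → sum (λ a → identity (σ a) i)) ≡⟨ sum-comm (λ i a → identity (σ a) i) ⟩
    sum (λ a → sum (identity (σ a)))         ≡⟨ sum-cong (λ a → sum-identity (σ a)) ⟩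
    sum {k} (λ _ → 1ℤ)                       ≡⟨ sum-const k 1ℤ ⟩
    + k ℤ.* 1ℤ                               ≡⟨ ℤ.*-identityʳ (+ k) ⟩
    + k                                      ∎
    where
    open ≡-Reasoning
    fibre : ∀ i → indicator (P? i) ≡ sum (λ a → identity (σ a) i)
    fibre i with P? i
    ... | no ¬p = ≡.sym (sum-zero λ a → identity-≢ {i = σ a} {i} λ { ≡.refl → ¬p (∈P a) })
    ... | yes p with surjective p
    ...   | a , ≡.refl = ≡.sym (≡.trans
      (sum-single (λ b → identity (σ b) (σ a)) a (λ b b≢a → identity-≢ {i = σ b} {σ a} (b≢a ∘ injective)))
      (identity-refl (σ a)))

  module Geometry {F : CommutativeRing r ℓr} {q} (isField : IsFieldOfOrder F q) (V : Module F m ℓm)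
    {f} (reps : LinearAlgebra.Representatives isField V (whole V) (suc f))
    {N} (vertices : HasCardinality (Grassmannian V 2) N) where

    open CommutativeRing F using (_≈_; 0#; 1#; _*_; _+_; -_; Carrier)
    open FiniteField F isField
    open LinearAlgebra isField V
    open Planes isField V
    open Module V
    open Subspace
    open Representatives reps renaming (point to p) hiding (∈W)

    Line : Fin N → Subspace V
    Line j = proj₁ (Inverse.to vertices j)

    Line-dim : ∀ j → HasDimension V (Line j) 2
    Line-dim j = proj₂ (Inverse.to vertices j)

    Line-injective : ∀ {j k} → members (Line j) ≐ members (Line k) → j ≡ k
    Line-injective {j} {k} eq = ≡.trans (≡.sym (Inverse.strictlyInverseʳ vertices j))
      (≡.trans (Inverse.from-cong vertices eq) (Inverse.strictlyInverseʳ vertices k))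

    _on_ : Fin (suc f) → Fin N → Set _
    i on j = p i ∈ members (Line j)

    private
      -- Each of the q + 1 = `geometric q 2` normalised vectors of the line is proportional to
      -- exactly one chosen point of V. The resulting `σ` enumerates the points on the line.
      module LineRepresentatives (j : Fin N) where

        open Representatives (representatives (Line-dim j)) public
          renaming (point to p′; nonzero to nonzero′; unique to unique′; complete to complete′)

        σ : Fin (geometric q 2) → Fin (suc f)
        σ a = proj₁ (complete _ (nonzero′ a))

        scale : ∀ a → ∃ λ x → ¬ x ≈ 0# × p′ a ≈ᴹ x *ₗ p (σ a)
        scale a = proj₂ (complete _ (nonzero′ a))

        σ-on : ∀ a → σ a on j
        σ-on a = let x , x≉0 , eq = scale a in *ₗ-cancel-∈ (Line j) x≉0 (resp-≈ (Line j) eq (∈W a))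

        σ-injective : Injective _≡_ _≡_ σ
        σ-injective {a} {b} σa≡σb with scale a | scale b
        ... | x , _ , eq | y , y≉0 , eq′ with *ₗ-cancel y≉0 (≈ᴹ-sym eq′)
        ...   | z , _ , eq″ = unique′ a b (x * z) (begin
          p′ a               ≈⟨ eq ⟩
          x *ₗ p (σ a)       ≡⟨ ≡.cong (λ i → x *ₗ p i) σa≡σb ⟩
          x *ₗ p (σ b)       ≈⟨ *ₗ-congˡ eq″ ⟩
          x *ₗ (z *ₗ p′ b)   ≈⟨ *ₗ-assoc x z (p′ b) ⟨
          (x * z) *ₗ p′ b    ∎)
          where open SetoidReasoning ≈ᴹ-setoid

        σ-surjective : ∀ {i} → i on j → ∃ λ a → σ a ≡ i
        σ-surjective {i} i∈j with complete′ i∈j (nonzero i)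
        ... | a , x , _ , eq with scale a
        ...   | y , _ , eq′ = a , ≡.sym (unique i (σ a) (x * y)
          (≈ᴹ-trans eq (≈ᴹ-trans (*ₗ-congˡ eq′) (≈ᴹ-sym (*ₗ-assoc x y (p (σ a)))))))

    open LineRepresentatives using (σ; σ-on; σ-injective; σ-surjective)

    opaque
      -- Membership in a subspace is an arbitrary predicate; incidence is decided by searching the
      -- finite list `σ j`.
      _on?_ : ∀ i j → Dec (i on j)
      i on? j = map′ (λ { (a , ≡.refl) → σ-on j a }) (σ-surjective j) (Fin.any? λ a → σ j a Fin.≟ i)

    opaque
      M : Fin (suc f) → Fin N → ℤ
      M i j = indicator (i on? j)

      M-def : ∀ i j → M i j ≡ indicator (i on? j)
      M-def i j = ≡.refl

      M-on : ∀ {i j} → i on j → M i j ≡ 1ℤ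
      M-on {i} {j} = indicator-yes (i on? j)

      M-off : ∀ {i j} → ¬ i on j → M i j ≡ 0ℤ
      M-off {i} {j} = indicator-no (i on? j)

      M-idempotent : ∀ i j → M i j ℤ.* M i j ≡ M i j
      M-idempotent i j with i on? j
      ... | yes _ = ≡.refl
      ... | no _ = ≡.refl

      M-*-off : ∀ i j k l → ¬ (i on j × k on l) → M i j ℤ.* M k l ≡ 0ℤ
      M-*-off i j k l ¬both with i on? j | k on? l
      ... | no _ | _ = ≡.refl
      ... | yes _ | no _ = ≡.refl
      ... | yes i∈j | yes k∈l = contradiction (i∈j , k∈l) ¬both

    column-sum : ∀ j → sum ((M ᵀ) j) ≡ + suc q
    column-sum j = ≡.trans (≡.trans (sum-cong λ i → M-def i j)
      (sum-indicator (λ i → i on? j) (σ j) (σ-injective j) (σ-on j) (σ-surjective j)))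
      (≡.cong +_ (≡.trans (ℕ.+-comm (q ℕ.* 1) 1) (≡.cong suc (ℕ.*-identityʳ q))))

    ≈-1*ₗ : ∀ {x y} → x +ᴹ y ≈ᴹ 0ᴹ → y ≈ᴹ (- 1#) *ₗ x
    ≈-1*ₗ {x} {y} eq = begin
      y                             ≈⟨ +ᴹ-identityˡ y ⟨
      0ᴹ +ᴹ y                       ≈⟨ +ᴹ-congʳ (-1*x+x x) ⟨
      ((- 1#) *ₗ x +ᴹ x) +ᴹ y       ≈⟨ +ᴹ-assoc _ _ _ ⟩
      (- 1#) *ₗ x +ᴹ (x +ᴹ y)       ≈⟨ +ᴹ-congˡ eq ⟩
      (- 1#) *ₗ x +ᴹ 0ᴹ             ≈⟨ +ᴹ-identityʳ _ ⟩
      (- 1#) *ₗ x                   ∎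
      where open SetoidReasoning ≈ᴹ-setoid

    opaque
      -- Equality in F is decidable, so a doubly negated conclusion is enough; callers may assume β
      -- nonzero and derive a contradiction.
      independent₂ : ∀ {u v} → ¬ u ≈ᴹ 0ᴹ → (∀ α β → comb α u β v ≈ᴹ 0ᴹ → ¬ ¬ β ≈ 0#) → Independent₂ u v
      independent₂ {u} {v} u≉0 h α β eq = α≈0 , β≈0
        where
        open SetoidReasoning ≈ᴹ-setoid
        β≈0 : β ≈ 0#
        β≈0 = decidable-stable (β ≈? 0#) (h α β eq)
        αu≈0 : α *ₗ u ≈ᴹ 0ᴹ
        αu≈0 = begin
          α *ₗ u               ≈⟨ +ᴹ-identityʳ _ ⟨
          α *ₗ u +ᴹ 0ᴹ         ≈⟨ +ᴹ-congˡ (≈ᴹ-trans (*ₗ-congʳ β≈0) (*ₗ-zeroˡ v)) ⟨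
          comb α u β v         ≈⟨ eq ⟩
          0ᴹ                   ∎
        α≈0 : α ≈ 0#
        α≈0 with α ≈? 0#
        ... | yes α≈0 = α≈0
        ... | no α≉0 with *ₗ-cancel α≉0 αu≈0
        ...   | z , _ , u≈ = contradiction (≈ᴹ-trans u≈ (*ₗ-zeroʳ z)) u≉0

      points-independent : ∀ {i k} → i ≢ k → Independent₂ (p i) (p k)
      points-independent {i} {k} i≢k = independent₂ (nonzero i) λ α β eq β≉0 →
        let z , _ , pk≈ = *ₗ-cancel β≉0 (≈-1*ₗ eq) in
        i≢k (≡.sym (unique k i (z * (- 1# * α)) (≈ᴹ-trans pk≈
          (≈ᴹ-sym (≈ᴹ-trans (*ₗ-assoc z (- 1# * α) (p i)) (*ₗ-congˡ (*ₗ-assoc (- 1#) α (p i))))))))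

    span₂⊆ : ∀ {u v} (W : Subspace V) → u ∈ members W → v ∈ members W → members (span₂ u v) ⊆ members W
    span₂⊆ W u∈ v∈ (α , β , eq) = resp-≈ W (≈ᴹ-sym eq) (comb-closed W u∈ v∈ α β)

    line-unique : ∀ {u v j k} → Independent₂ u v →
      u ∈ members (Line j) → v ∈ members (Line j) → u ∈ members (Line k) → v ∈ members (Line k) → j ≡ k
    line-unique {j = j} {k} indep u∈j v∈j u∈k v∈k = Line-injective
      ( (λ z∈ → span₂⊆ (Line k) u∈k v∈k (⊆-span₂ (Line-dim j) indep u∈j v∈j z∈))
      , (λ z∈ → span₂⊆ (Line j) u∈j v∈j (⊆-span₂ (Line-dim k) indep u∈k v∈k z∈)))

    opaque
      line : ∀ {u v} → Independent₂ u v → Fin N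
      line {u} {v} indep = Inverse.from vertices (span₂ u v , span₂-dimension indep)

      line-span : ∀ {u v} (indep : Independent₂ u v) → members (Line (line indep)) ≐ members (span₂ u v)
      line-span {u} {v} indep = Inverse.strictlyInverseˡ vertices (span₂ u v , span₂-dimension indep)

      left∈line : ∀ {u v} (indep : Independent₂ u v) → u ∈ members (Line (line indep))
      left∈line {u} {v} indep = proj₂ (line-span indep) (left∈span₂ u v)

      right∈line : ∀ {u v} (indep : Independent₂ u v) → v ∈ members (Line (line indep))
      right∈line {u} {v} indep = proj₂ (line-span indep) (right∈span₂ u v)

    -- The off-diagonal entries of `M Mᵀ`: distinct points span a line, and by `line-unique` it is
    -- the only one through both.
    row-product : ∀ {i k} → i ≢ k → sum (λ j → M i j ℤ.* M k j) ≡ 1ℤ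
    row-product {i} {k} i≢k = ≡.trans (sum-single (λ j → M i j ℤ.* M k j) ik off)
      (≡.cong₂ ℤ._*_ (M-on (left∈line indep)) (M-on (right∈line indep)))
      where
      indep = points-independent i≢k
      ik = line indep
      off : ∀ j → j ≢ ik → M i j ℤ.* M k j ≡ 0ℤ
      off j j≢ik = M-*-off i j k j λ { (i∈j , k∈j) →
        j≢ik (line-unique indep i∈j k∈j (left∈line indep) (right∈line indep)) }

    -- Two distinct lines share at most one point, and a nonzero common vector is proportional to a
    -- chosen point. Hence the off-diagonal entries of `Mᵀ M` are those of the adjacency matrix.
    column-product : ∀ {A : Matrix N} →
      IsAdjacencyMatrix (λ i j → GrassmannAdjacent V (Inverse.to vertices i) (Inverse.to vertices j)) A →
      ∀ j k → sum (λ i → M i j ℤ.* M i k) ≡ A j k ℤ.+ + suc q ℤ.* identity j k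
    column-product {A} isAdj j k with j Fin.≟ k
    ... | yes ≡.refl = begin
      sum (λ i → M i j ℤ.* M i j)          ≡⟨ sum-cong (λ i → M-idempotent i j) ⟩
      sum ((M ᵀ) j)                        ≡⟨ column-sum j ⟩
      + suc q                              ≡⟨ simplify (+ suc q) ⟩
      0ℤ ℤ.+ + suc q ℤ.* 1ℤ                ≡⟨ ≡.cong (ℤ._+ + suc q ℤ.* 1ℤ) (IsAdjacencyMatrix.nonadjacent isAdj (λ adj → proj₁ adj ((λ x → x) , (λ x → x)))) ⟨
      A j j ℤ.+ + suc q ℤ.* 1ℤ             ∎
      where
      open ≡-Reasoning
      simplify : ∀ x → x ≡ 0ℤ ℤ.+ x ℤ.* 1ℤ
      simplify = solve-∀
    ... | no j≢k = ≡.trans sum≡A (simplify (A j k) (+ suc q))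
      where
      simplify : ∀ a x → a ≡ a ℤ.+ x ℤ.* 0ℤ
      simplify = solve-∀
      sum≡A : sum (λ i → M i j ℤ.* M i k) ≡ A j k
      sum≡A with Fin.any? (λ i → (i on? j) ×-dec (i on? k))
      ... | yes (i , i∈j , i∈k) = ≡.trans
        (≡.trans (sum-single (λ i → M i j ℤ.* M i k) i off) (≡.cong₂ ℤ._*_ (M-on i∈j) (M-on i∈k)))
        (≡.sym (IsAdjacencyMatrix.adjacent isAdj (j≢k ∘ Line-injective , p i , nonzero i , i∈j , i∈k)))
        where
        off : ∀ i′ → i′ ≢ i → M i′ j ℤ.* M i′ k ≡ 0ℤ
        off i′ i′≢i = M-*-off i′ j i′ k λ { (i′∈j , i′∈k) →
          j≢k (line-unique (points-independent i′≢i) i′∈j i∈j i′∈k i∈k) }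
      ... | no ∄i = ≡.trans (sum-zero off) (≡.sym (IsAdjacencyMatrix.nonadjacent isAdj nonadjacent))
        where
        off : ∀ i → M i j ℤ.* M i k ≡ 0ℤ
        off i = M-*-off i j i k λ both → ∄i (i , both)
        nonadjacent : ¬ GrassmannAdjacent V (Inverse.to vertices j) (Inverse.to vertices k)
        nonadjacent (_ , v , v≉0 , v∈j , v∈k) with complete _ v≉0
        ... | i , x , x≉0 , eq = ∄i (i , *ₗ-cancel-∈ (Line j) x≉0 (resp-≈ (Line j) eq v∈j)
                                       , *ₗ-cancel-∈ (Line k) x≉0 (resp-≈ (Line k) eq v∈k))

  -- Pencils of lines

  module Covering {F : CommutativeRing r ℓr} {q} (isField : IsFieldOfOrder F q) (V : Module F m ℓm)
    {f} (reps : LinearAlgebra.Representatives isField V (whole V) (suc f))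
    {N} (vertices : HasCardinality (Grassmannian V 2) N) where

    open CommutativeRing F using (_≈_; 0#; 1#; _*_; _+_; -_; Carrier)
    private module F = CommutativeRing F
    open FiniteField F isField
    open LinearAlgebra isField V
    open Planes isField V
    open Module V
    open Subspace
    open Representatives reps renaming (point to p) hiding (∈W)
    open Geometry isField V reps vertices

    -- The lines through p i other than p i p j in a plane containing both.
    module Pencil {i j} (i≢j : i ≢ j) {w} (w∉ : ¬ w ∈ members (Line (line (points-independent i≢j)))) where

      private
        u v : Carrierᴹ
        u = p i
        v = p j
        L : Fin N
        L = line (points-independent i≢j)
        u∈L : u ∈ members (Line L)
        u∈L = left∈line (points-independent i≢j)
        v∈L : v ∈ members (Line L)
        v∈L = right∈line (points-independent i≢j)

      -- The points other than `p j` on the line through `w` and `p j`. Each line of the pencil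
      -- meets that line in exactly one of them.
      direction : Fin q → Carrierᴹ
      direction a = w +ᴹ element a *ₗ v

      opaque
        direction-independent : ∀ a → Independent₂ u (direction a)
        direction-independent a = independent₂ (nonzero i) λ α β eq β≉0 → w∉
          (+-cancelʳ-∈ (Line L)
            (*ₗ-cancel-∈ (Line L) β≉0
              (+-cancelˡ-∈ (Line L) (resp-≈ (Line L) (≈ᴹ-sym eq) (0-closed (Line L))) (*ₗ-closed (Line L) α u∈L)))
            (*ₗ-closed (Line L) (element a) v∈L))

        pencil : Fin q → Fin N
        pencil a = line (direction-independent a)

        i-on : ∀ a → i on pencil a
        i-on a = left∈line (direction-independent a)

        direction-on : ∀ a → direction a ∈ members (Line (pencil a))
        direction-on a = right∈line (direction-independent a)

        pencil⊆span : ∀ a → members (Line (pencil a)) ⊆ members (span₂ u (direction a))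
        pencil⊆span a = proj₁ (line-span (direction-independent a))

      j-off : ∀ a → ¬ j on pencil a
      j-off a v∈ = w∉ (≡.subst (λ l → w ∈ members (Line l))
        (line-unique (points-independent i≢j) (i-on a) v∈ u∈L v∈L)
        (+-cancelʳ-∈ (Line (pencil a)) (direction-on a) (*ₗ-closed (Line (pencil a)) (element a) v∈)))

      pencil-injective : ∀ {a b} → pencil a ≡ pencil b → a ≡ b
      pencil-injective {a} {b} eq = decidable-stable (a Fin.≟ b) λ a≢b → j-off a
        (*ₗ-cancel-∈ W (x≉0 a≢b)
          (+-cancelˡ-∈ W (resp-≈ W difference (direction-on a))
            (≡.subst (λ l → direction b ∈ members (Line l)) (≡.sym eq) (direction-on b))))
        where
        W = Line (pencil a)
        x = element a + - element b
        x≉0 : a ≢ b → ¬ x ≈ 0#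
        x≉0 a≢b x≈0 = a≢b (element-injective (begin
          element a                                ≈⟨ F.+-identityʳ _ ⟨
          element a + 0#                           ≈⟨ F.+-congˡ (F.-‿inverseˡ (element b)) ⟨
          element a + (- element b + element b)    ≈⟨ F.+-assoc _ _ _ ⟨
          x + element b                            ≈⟨ F.+-congʳ x≈0 ⟩
          0# + element b                           ≈⟨ F.+-identityˡ _ ⟩
          element b                                ∎))
          where open SetoidReasoning F.setoid
        difference : direction a ≈ᴹ direction b +ᴹ x *ₗ v
        difference = begin
          w +ᴹ element a *ₗ v                              ≈⟨ +ᴹ-congˡ (*ₗ-congʳ element-b+x) ⟨
          w +ᴹ (element b + x) *ₗ v                        ≈⟨ +ᴹ-congˡ (*ₗ-distribʳ v (element b) x) ⟩
          w +ᴹ (element b *ₗ v +ᴹ x *ₗ v)                  ≈⟨ +ᴹ-assoc _ _ _ ⟨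
          direction b +ᴹ x *ₗ v                            ∎
          where
          open SetoidReasoning ≈ᴹ-setoid
          element-b+x : element b + x ≈ element a
          element-b+x = F.trans (F.+-comm _ _) (F.trans (F.+-assoc _ _ _)
            (F.trans (F.+-congˡ (F.-‿inverseˡ (element b))) (F.+-identityʳ _)))

      coverage : Fin (suc f) → ℤ
      coverage k = sum (λ a → M k (pencil a))

      coverage-i : coverage i ≡ + q
      coverage-i = ≡.trans (sum-cong (λ a → M-on (i-on a))) (≡.trans (sum-const q 1ℤ) (ℤ.*-identityʳ (+ q)))

      coverage-j : coverage j ≡ 0ℤ
      coverage-j = sum-zero (λ a → M-off (j-off a))

      coverage-on : ∀ {k} → k ≢ i → ∀ {a} → k on pencil a → coverage k ≡ 1ℤ
      coverage-on {k} k≢i {a} k∈ = ≡.trans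
        (sum-single (λ b → M k (pencil b)) a λ b b≢a → M-off λ k∈b → b≢a
          (pencil-injective (line-unique (points-independent k≢i) k∈b (i-on b) k∈ (i-on a))))
        (M-on k∈)

      coverage-off : ∀ {k} → (∀ a → ¬ k on pencil a) → coverage k ≡ 0ℤ
      coverage-off off = sum-zero (λ a → M-off (off a))

    -- Both pencils cover the points of the plane outside the line p i p j.
    module _ {i j} (i≢j : i ≢ j) (j≢i : j ≢ i) {w}
             (w∉ : ¬ w ∈ members (Line (line (points-independent i≢j))))
             (w∉′ : ¬ w ∈ members (Line (line (points-independent j≢i)))) where

      private
        module I = Pencil i≢j w∉
        module J = Pencil j≢i w∉′

      transfer : ∀ {k} → k ≢ i → ∀ {a} → k on I.pencil a → ∃ λ b → k on J.pencil b
      transfer {k} k≢i {a} k∈ with I.pencil⊆span a k∈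
      ... | α , β , eq = b , resp-≈ W (≈ᴹ-sym recombine)
        (+-closed W (*ₗ-closed W (β * x) (J.i-on b)) (*ₗ-closed W β (J.direction-on b)))
        where
        u v z : Carrierᴹ
        u = p i
        v = p j
        z = p k
        x y : Carrier
        x = element a
        open SetoidReasoning ≈ᴹ-setoid
        β≉0 : ¬ β ≈ 0#
        β≉0 β≈0 = k≢i (unique k i α (begin
          z                                      ≈⟨ eq ⟩
          α *ₗ u +ᴹ β *ₗ (w +ᴹ x *ₗ v)           ≈⟨ +ᴹ-congˡ (≈ᴹ-trans (*ₗ-congʳ β≈0) (*ₗ-zeroˡ _)) ⟩
          α *ₗ u +ᴹ 0ᴹ                           ≈⟨ +ᴹ-identityʳ _ ⟩
          α *ₗ u                                 ∎))
        β⁻¹ = proj₁ (invertible β β≉0)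
        -- α u + β (w + x v) equals (β x) v + β (w + (α / β) u), so the line of the other pencil has
        -- parameter α / β.
        y = β⁻¹ * α
        b = index y
        W = Line (J.pencil b)
        βy≈α : β * element b ≈ α
        βy≈α = F.trans (F.*-congˡ (element-index y)) (F.trans (F.sym (F.*-assoc β β⁻¹ α))
          (F.trans (F.*-congʳ (proj₂ (invertible β β≉0))) (F.*-identityˡ α)))
        recombine : z ≈ᴹ (β * x) *ₗ v +ᴹ β *ₗ (w +ᴹ element b *ₗ u)
        recombine = begin
          z                                                  ≈⟨ eq ⟩
          α *ₗ u +ᴹ β *ₗ (w +ᴹ x *ₗ v)                       ≈⟨ +ᴹ-cong (*ₗ-congʳ βy≈α) (≈ᴹ-sym (*ₗ-distribˡ β w (x *ₗ v))) ⟨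
          (β * element b) *ₗ u +ᴹ (β *ₗ w +ᴹ β *ₗ (x *ₗ v))  ≈⟨ +ᴹ-comm _ _ ⟩
          (β *ₗ w +ᴹ β *ₗ (x *ₗ v)) +ᴹ (β * element b) *ₗ u  ≈⟨ +ᴹ-congʳ (+ᴹ-comm _ _) ⟩
          (β *ₗ (x *ₗ v) +ᴹ β *ₗ w) +ᴹ (β * element b) *ₗ u  ≈⟨ +ᴹ-assoc _ _ _ ⟩
          β *ₗ (x *ₗ v) +ᴹ (β *ₗ w +ᴹ (β * element b) *ₗ u)
            ≈⟨ +ᴹ-cong (≈ᴹ-sym (*ₗ-assoc β x v)) (+ᴹ-congˡ (*ₗ-assoc β (element b) u)) ⟩
          (β * x) *ₗ v +ᴹ (β *ₗ w +ᴹ β *ₗ (element b *ₗ u))  ≈⟨ +ᴹ-congˡ (*ₗ-distribˡ β w (element b *ₗ u)) ⟨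
          (β * x) *ₗ v +ᴹ β *ₗ (w +ᴹ element b *ₗ u)         ∎

    module _ {t} (q>0 : 0 ℕ.< q) (t>0 : 0 ℕ.< t) (points : suc f ≡ suc (q ℕ.* suc t)) where

      private
        instance
          q≢0 : ℕ.NonZero q
          q≢0 = ℕ.>-nonZero q>0

      -- Pairs of a line through `i` and a point on it are counted twice. With d lines, this gives
      -- (q + 1) d by lines, and d + q (1 + t) by points: `i` occurs d times and each other point
      -- once.
      row-sum : ∀ i → sum (M i) ≡ 1ℤ ℤ.+ + t
      row-sum i = ℤ.*-cancelˡ-≡ (+ q) (sum (M i)) (1ℤ ℤ.+ + t) (cancel (+ q) (sum (M i)) (1ℤ ℤ.+ + t) (begin
        (1ℤ ℤ.+ + q) ℤ.* sum (M i)                               ≡⟨ ≡.cong (ℤ._* sum (M i)) (≡.sym (ℤ.pos-+ 1 q)) ⟩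
        + suc q ℤ.* sum (M i)                                    ≡⟨ ≡.trans (≡.sym (sum-scale (+ suc q) (M i))) (sum-cong λ j → ℤ.*-comm (+ suc q) (M i j)) ⟩
        sum (λ j → M i j ℤ.* + suc q)                            ≡⟨ sum-cong (λ j → ≡.cong (ℤ._*_ (M i j)) (≡.sym (column-sum j))) ⟩
        sum (λ j → M i j ℤ.* sum ((M ᵀ) j))                      ≡⟨ sum-cong (λ j → ≡.sym (sum-scale (M i j) ((M ᵀ) j))) ⟩
        sum (λ j → sum (λ k → M i j ℤ.* M k j))                  ≡⟨ sum-comm (λ j k → M i j ℤ.* M k j) ⟩
        sum (λ k → sum (λ j → M i j ℤ.* M k j))                  ≡⟨ sum-cong row ⟩
        sum (λ k → 1ℤ ℤ.+ (sum (M i) ℤ.- 1ℤ) ℤ.* identity i k)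
          ≡⟨ sum-+ (λ (_ : Fin (suc f)) → 1ℤ) (λ k → (sum (M i) ℤ.- 1ℤ) ℤ.* identity i k) ⟩
        sum (λ (_ : Fin (suc f)) → 1ℤ) ℤ.+ sum (λ k → (sum (M i) ℤ.- 1ℤ) ℤ.* identity i k)
          ≡⟨ ≡.cong₂ ℤ._+_ (sum-const (suc f) 1ℤ) (≡.trans (sum-scale (sum (M i) ℤ.- 1ℤ) (identity i)) (≡.cong (ℤ._*_ (sum (M i) ℤ.- 1ℤ)) (sum-identity i))) ⟩
        + suc f ℤ.* 1ℤ ℤ.+ (sum (M i) ℤ.- 1ℤ) ℤ.* 1ℤ
          ≡⟨ ≡.cong (λ x → x ℤ.* 1ℤ ℤ.+ (sum (M i) ℤ.- 1ℤ) ℤ.* 1ℤ) points′ ⟩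
        (1ℤ ℤ.+ + q ℤ.* (1ℤ ℤ.+ + t)) ℤ.* 1ℤ ℤ.+ (sum (M i) ℤ.- 1ℤ) ℤ.* 1ℤ  ≡⟨ simplify (+ q) (+ t) (sum (M i)) ⟩
        sum (M i) ℤ.+ + q ℤ.* (1ℤ ℤ.+ + t)                       ∎))
        where
        open ≡-Reasoning
        points′ : + suc f ≡ 1ℤ ℤ.+ + q ℤ.* (1ℤ ℤ.+ + t)
        points′ = ≡.trans (≡.cong +_ points) (≡.trans (ℤ.pos-+ 1 (q ℕ.* suc t)) (≡.cong (ℤ._+_ 1ℤ) (ℤ.pos-* q (suc t))))
        simplify : ∀ q t d → (1ℤ ℤ.+ q ℤ.* (1ℤ ℤ.+ t)) ℤ.* 1ℤ ℤ.+ (d ℤ.- 1ℤ) ℤ.* 1ℤ ≡ d ℤ.+ q ℤ.* (1ℤ ℤ.+ t)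
        simplify = solve-∀
        cancel : ∀ q d x → (1ℤ ℤ.+ q) ℤ.* d ≡ d ℤ.+ q ℤ.* x → q ℤ.* d ≡ q ℤ.* x
        cancel q d x eq = ≡.trans (eq₁ q d) (≡.trans (≡.cong (ℤ._- d) eq) (eq₂ (q ℤ.* x) d))
          where
          eq₁ : ∀ q d → q ℤ.* d ≡ (1ℤ ℤ.+ q) ℤ.* d ℤ.- d
          eq₁ = solve-∀
          eq₂ : ∀ x d → (d ℤ.+ x) ℤ.- d ≡ x
          eq₂ = solve-∀
        row : ∀ k → sum (λ j → M i j ℤ.* M k j) ≡ 1ℤ ℤ.+ (sum (M i) ℤ.- 1ℤ) ℤ.* identity i k
        row k with i Fin.≟ k
        ... | yes ≡.refl = ≡.trans (sum-cong (M-idempotent i)) (solve′ (sum (M i)))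
          where
          solve′ : ∀ d → d ≡ 1ℤ ℤ.+ (d ℤ.- 1ℤ) ℤ.* 1ℤ
          solve′ = solve-∀
        ... | no i≢k = ≡.trans (row-product i≢k) (solve′ (sum (M i)))
          where
          solve′ : ∀ d → 1ℤ ≡ 1ℤ ℤ.+ (d ℤ.- 1ℤ) ℤ.* 0ℤ
          solve′ = solve-∀

      -- Otherwise the line would contain all 1 + q (1 + t) points, more than q + 1 because t is
      -- positive.
      point-off : ∀ j → ∃ λ k → ¬ k on j
      point-off j with Fin.any? (λ k → ¬? (k on? j))
      ... | yes found = found
      ... | no ∄k = contradiction (ℤ.+-injective (begin
        + suc f                          ≡⟨ ℤ.*-identityʳ (+ suc f) ⟨
        + suc f ℤ.* 1ℤ                   ≡⟨ sum-const (suc f) 1ℤ ⟨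
        sum (λ (_ : Fin (suc f)) → 1ℤ)   ≡⟨ sum-cong (λ k → M-on (decidable-stable (k on? j) λ k∉ → ∄k (k , k∉))) ⟨
        sum ((M ᵀ) j)                    ≡⟨ column-sum j ⟩
        + suc q                          ∎))
        λ eq → ℕ.<⇒≢ (ℕ.m<m*n q (suc t) (ℕ.s≤s t>0)) (≡.sym (ℕ.suc-injective (≡.trans (≡.sym points) eq)))
        where open ≡-Reasoning

      opaque
        -- The pencil at `i` minus the pencil at `zero`, in a plane spanned with a third point `w`
        -- off their line. All `q` lines of a pencil pass through its own centre and none through
        -- the other; elsewhere the two coverages agree by `transfer`.
        cover : ∀ i → ∃ λ (x : Vector ℤ N) → M ⊛ x ≗ λ k → + q ℤ.* (identity i k ℤ.- identity zero k)
        cover i with i Fin.≟ zero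
        ... | yes ≡.refl = (λ _ → 0ℤ) , λ k → ≡.trans (⊛-def M (λ _ → 0ℤ) k)
          (≡.trans (sum-zero λ j → ℤ.*-zeroʳ (M k j)) (solve′ (+ q) (identity zero k)))
          where
          solve′ : ∀ q a → 0ℤ ≡ q ℤ.* (a ℤ.- a)
          solve′ = solve-∀
        ... | no i≢0 = x , λ k → ≡.trans (Mx k) (byCases k (k Fin.≟ i) (k Fin.≟ zero))
          where
          0≢i : zero ≢ i
          0≢i = i≢0 ∘ ≡.sym
          L : Fin N
          L = line {p i} {p zero} (points-independent i≢0)
          w : Carrierᴹ
          w = p (proj₁ (point-off L))
          w∉ : ¬ w ∈ members (Line L)
          w∉ = proj₂ (point-off L)
          w∉′ : ¬ w ∈ members (Line (line {p zero} {p i} (points-independent 0≢i)))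
          w∉′ = ≡.subst (λ l → ¬ w ∈ members (Line l)) (line-unique (points-independent i≢0)
            (left∈line (points-independent i≢0)) (right∈line (points-independent i≢0)) (right∈line (points-independent 0≢i)) (left∈line (points-independent 0≢i))) w∉
          module I = Pencil {i} {zero} i≢0 {w} w∉
          module J = Pencil {zero} {i} 0≢i {w} w∉′
          x : Vector ℤ N
          x l = sum (λ a → identity (I.pencil a) l) ℤ.- sum (λ a → identity (J.pencil a) l)
          cover-sum : ∀ (P : Fin q → Fin N) k → (M ⊛ (λ l → sum (λ a → identity (P a) l))) k ≡ sum (λ a → M k (P a))
          cover-sum P k = begin
            (M ⊛ (λ l → sum (λ a → identity (P a) l))) k
              ≡⟨ ⊛-cong M (λ l → sum-cong λ a → ≡.sym (ℤ.*-identityˡ (identity (P a) l))) k ⟩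
            (M ⊛ (λ l → sum (λ a → 1ℤ ℤ.* identity (P a) l))) k   ≡⟨ ⊛-sum M (λ _ → 1ℤ) (λ a → identity (P a)) k ⟩
            sum (λ a → 1ℤ ℤ.* (M ⊛ identity (P a)) k)
              ≡⟨ sum-cong (λ a → ≡.trans (ℤ.*-identityˡ _) (⊛-identity M (P a) k)) ⟩
            sum (λ a → M k (P a))                                 ∎
            where open ≡-Reasoning
          Mx : ∀ k → (M ⊛ x) k ≡ I.coverage k ℤ.- J.coverage k
          Mx k = ≡.trans (⊛-minus M _ _ k) (≡.cong₂ ℤ._-_ (cover-sum I.pencil k) (cover-sum J.pencil k))
          same : ∀ {k} → k ≢ i → k ≢ zero → Dec (∃ λ a → k on I.pencil a) → I.coverage k ≡ J.coverage k
          same k≢i k≢0 (yes (a , k∈)) = ≡.trans (I.coverage-on k≢i k∈)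
            (≡.sym (J.coverage-on k≢0 (proj₂ (transfer {i} {zero} i≢0 0≢i {w} w∉ w∉′ k≢i k∈))))
          same k≢i k≢0 (no ∄a) = ≡.trans (I.coverage-off λ a k∈ → ∄a (a , k∈))
            (≡.sym (J.coverage-off λ b k∈ → ∄a (transfer {zero} {i} 0≢i i≢0 {w} w∉′ w∉ k≢0 k∈)))
          byCases : ∀ k → Dec (k ≡ i) → Dec (k ≡ zero) →
                    I.coverage k ℤ.- J.coverage k ≡ + q ℤ.* (identity i k ℤ.- identity zero k)
          byCases k (yes ≡.refl) _ = ≡.trans (≡.cong₂ ℤ._-_ I.coverage-i J.coverage-j) (≡.trans (solve′ (+ q))
            (≡.sym (≡.cong₂ (λ a b → + q ℤ.* (a ℤ.- b)) (identity-refl i) (identity-≢ {i = zero} {i} 0≢i))))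
            where
            solve′ : ∀ q → q ℤ.- 0ℤ ≡ q ℤ.* (1ℤ ℤ.- 0ℤ)
            solve′ = solve-∀
          byCases k (no k≢i) (yes ≡.refl) = ≡.trans (≡.cong₂ ℤ._-_ I.coverage-j J.coverage-i) (≡.trans (solve′ (+ q))
            (≡.sym (≡.cong₂ (λ a b → + q ℤ.* (a ℤ.- b)) (identity-≢ {i = i} {zero} i≢0) (identity-refl (zero {f})))))
            where
            solve′ : ∀ q → 0ℤ ℤ.- q ≡ q ℤ.* (0ℤ ℤ.- 1ℤ)
            solve′ = solve-∀
          byCases k (no k≢i) (no k≢0) = ≡.trans
            (≡.trans (≡.cong (ℤ._- J.coverage k) (same k≢i k≢0 (Fin.any? λ a → k on? I.pencil a))) (ℤ.+-inverseʳ (J.coverage k)))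
            (≡.trans (solve′ (+ q))
              (≡.sym (≡.cong₂ (λ a b → + q ℤ.* (a ℤ.- b)) (identity-≢ {i = i} {k} (k≢i ∘ ≡.sym)) (identity-≢ {i = zero} {k} (k≢0 ∘ ≡.sym)))))
            where
            solve′ : ∀ q → 0ℤ ≡ q ℤ.* (0ℤ ℤ.- 0ℤ)
            solve′ = solve-∀

      geometry : ∀ {A : Matrix N} {r} → t ≡ r ℕ.+ suc q →
        IsAdjacencyMatrix (λ i j → GrassmannAdjacent V (Inverse.to vertices i) (Inverse.to vertices j)) A →
        PointLineGeometry f N q (suc q) t r A
      geometry {A} {r} t≡ isAdj = record
        { s≡     = ≡.refl
        ; t≡     = ≡.trans (≡.cong +_ t≡) (ℤ.pos-+ r (suc q))
        ; points = ≡.cong +_ (≡.trans points (≡.cong suc (ℕ.*-suc q t))) ⟨trans⟩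
                   ≡.trans (ℤ.pos-+ (suc q) (q ℕ.* t)) (≡.cong (ℤ._+_ (+ suc q)) (ℤ.pos-* q t))
        ; M      = M
        ; A-def  = A-def
        ; MMᵀ    = MMᵀ
        ; M1     = row-sum
        ; Mᵀ1    = column-sum
        ; X      = λ i → proj₁ (cover i)
        ; MX     = λ i → proj₂ (cover i)
        ; sum-X  = sum-X
        }
        where
        open ≡-Reasoning
        infixr 2 _⟨trans⟩_
        _⟨trans⟩_ : ∀ {x y z : ℤ} → x ≡ y → y ≡ z → x ≡ z
        _⟨trans⟩_ = ≡.trans
        A-def : ∀ y → A ⊛ y ≗ λ j → (M ᵀ ⊛ (M ⊛ y)) j ℤ.- + suc q ℤ.* y j
        A-def y j = ≡.sym (begin
          (M ᵀ ⊛ (M ⊛ y)) j ℤ.- + suc q ℤ.* y j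
            ≡⟨ ≡.cong (ℤ._- + suc q ℤ.* y j) (⊛-assoc (M ᵀ) M y j) ⟨
          ((λ j k → sum (λ i → M i j ℤ.* M i k)) ⊛ y) j ℤ.- + suc q ℤ.* y j
            ≡⟨ ≡.cong (ℤ._- + suc q ℤ.* y j) (≡.trans (⊛-congˡ (column-product isAdj) y j) (⊛-def (λ j k → A j k ℤ.+ + suc q ℤ.* identity j k) y j)) ⟩
          sum (λ k → (A j k ℤ.+ + suc q ℤ.* identity j k) ℤ.* y k) ℤ.- + suc q ℤ.* y j
            ≡⟨ ≡.cong (ℤ._- + suc q ℤ.* y j) (≡.trans (sum-cong (λ k → distrib (A j k) (+ suc q) (identity j k) (y k)))
                 (sum-+ (λ k → A j k ℤ.* y k) (λ k → + suc q ℤ.* (identity j k ℤ.* y k)))) ⟩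
          (sum (λ k → A j k ℤ.* y k) ℤ.+ sum (λ k → + suc q ℤ.* (identity j k ℤ.* y k))) ℤ.- + suc q ℤ.* y j
            ≡⟨ ≡.cong₂ (λ a b → (a ℤ.+ b) ℤ.- + suc q ℤ.* y j) (≡.sym (⊛-def A y j))
                 (≡.trans (sum-scale (+ suc q) (λ k → identity j k ℤ.* y k)) (≡.cong (ℤ._*_ (+ suc q)) (sum-identityˡ j y))) ⟩
          ((A ⊛ y) j ℤ.+ + suc q ℤ.* y j) ℤ.- + suc q ℤ.* y j
            ≡⟨ x+y-y≡x ((A ⊛ y) j) (+ suc q ℤ.* y j) ⟩
          (A ⊛ y) j ∎)
          where
          distrib : ∀ a s e y → (a ℤ.+ s ℤ.* e) ℤ.* y ≡ a ℤ.* y ℤ.+ s ℤ.* (e ℤ.* y)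
          distrib = solve-∀
        row-products : ∀ i k → sum (λ j → M i j ℤ.* M k j) ≡ 1ℤ ℤ.+ + t ℤ.* identity i k
        row-products i k with i Fin.≟ k
        ... | yes ≡.refl = ≡.trans (sum-cong (M-idempotent i)) (≡.trans (row-sum i) (≡.cong (ℤ._+_ 1ℤ) (≡.sym (ℤ.*-identityʳ (+ t)))))
        ... | no i≢k = ≡.trans (row-product i≢k) (≡.cong (ℤ._+_ 1ℤ) (≡.sym (ℤ.*-zeroʳ (+ t))))
        MMᵀ : ∀ w → M ⊛ (M ᵀ ⊛ w) ≗ λ i → sum w ℤ.+ + t ℤ.* w i
        MMᵀ w i = begin
          (M ⊛ (M ᵀ ⊛ w)) i                                     ≡⟨ ⊛-assoc M (M ᵀ) w i ⟨
          ((λ i k → sum (λ j → M i j ℤ.* M k j)) ⊛ w) i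
            ≡⟨ ≡.trans (⊛-congˡ row-products w i) (⊛-def (λ i k → 1ℤ ℤ.+ + t ℤ.* identity i k) w i) ⟩
          sum (λ k → (1ℤ ℤ.+ + t ℤ.* identity i k) ℤ.* w k)
            ≡⟨ ≡.trans (sum-cong (λ k → distrib (+ t) (identity i k) (w k))) (sum-+ w (λ k → + t ℤ.* (identity i k ℤ.* w k))) ⟩
          sum w ℤ.+ sum (λ k → + t ℤ.* (identity i k ℤ.* w k))
            ≡⟨ ≡.cong (ℤ._+_ (sum w)) (≡.trans (sum-scale (+ t) (λ k → identity i k ℤ.* w k)) (≡.cong (ℤ._*_ (+ t)) (sum-identityˡ i w))) ⟩
          sum w ℤ.+ + t ℤ.* w i                                 ∎
          where
          distrib : ∀ t e w → (1ℤ ℤ.+ t ℤ.* e) ℤ.* w ≡ w ℤ.+ t ℤ.* (e ℤ.* w)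
          distrib = solve-∀
        -- All column sums of `M` are q + 1, so (q + 1) sum X is the sum of M X, which is zero; the
        -- positive factor cancels.
        sum-X : ∀ i → sum (proj₁ (cover i)) ≡ 0ℤ
        sum-X i = ℤ.*-cancelˡ-≡ (+ suc q) (sum x) 0ℤ (begin
          + suc q ℤ.* sum x                                     ≡⟨ sum-scale (+ suc q) x ⟨
          sum (λ j → + suc q ℤ.* x j)                           ≡⟨ sum-cong (λ j → ≡.trans (≡.cong (ℤ._* x j) (≡.sym (column-sum j))) (≡.sym (sum-scaleʳ (x j) ((M ᵀ) j)))) ⟩
          sum (λ j → sum (λ k → M k j ℤ.* x j))                 ≡⟨ sum-comm (λ j k → M k j ℤ.* x j) ⟩
          sum (λ k → sum (λ j → M k j ℤ.* x j))                 ≡⟨ sum-cong (λ k → ≡.trans (≡.sym (⊛-def M x k)) (proj₂ (cover i) k)) ⟩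
          sum (λ k → + q ℤ.* (identity i k ℤ.- identity zero k)) ≡⟨ sum-scale (+ q) (λ k → identity i k ℤ.- identity zero k) ⟩
          + q ℤ.* sum (λ k → identity i k ℤ.- identity zero k)
            ≡⟨ ≡.cong (ℤ._*_ (+ q)) (≡.trans (sum-minus (identity i) (identity (zero {f}))) (≡.cong₂ ℤ._-_ (sum-identity i) (sum-identity (zero {f})))) ⟩
          + q ℤ.* 0ℤ                                            ≡⟨ ≡.trans (ℤ.*-zeroʳ (+ q)) (≡.sym (ℤ.*-zeroʳ (+ suc q))) ⟩
          + suc q ℤ.* 0ℤ                                        ∎)
          where x = proj₁ (cover i)

open import Data.List.Membership.Propositional using (_∉_)
open import Data.List.Relation.Unary.All using (All; []; _∷_)
open import Data.List.Relation.Unary.Any using (here; there)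
open import Data.Nat.Base using (ℕ; zero; suc; pred; _+_; _*_; _∸_; _^_; _/_; _≤_; _<_; z≤n; s≤s; NonZero; ≢-nonZero; >-nonZero; >-nonZero⁻¹; nonTrivial⇒n>1)
open import Data.Nat.Properties
open import Data.Nat.Tactic.RingSolver using (solve-∀)
open import Relation.Binary.Definitions using (tri<; tri≈; tri>)
open ≡ using (refl; sym; trans; cong; cong₂; subst; subst₂; ≢-sym)

-- From bounds to multiplicities

module _ {e μ : ℕ → ℕ} (e+μ : ∀ i → e i + μ (suc i) ≡ μ i) where

  μ-antitone : ∀ {i j} → i ≤ j → μ j ≤ μ i
  μ-antitone {zero} {zero} _ = ≤-refl
  μ-antitone {i} {suc j} i≤1+j with m≤n⇒m<n∨m≡n i≤1+j
  ... | inj₂ refl = ≤-refl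
  ... | inj₁ (s≤s i≤j) = ≤-trans (subst (μ (suc j) ≤_) (e+μ j) (m≤n+m (μ (suc j)) (e j))) (μ-antitone i≤j)

  e≡∸ : ∀ i → e i ≡ μ i ∸ μ (suc i)
  e≡∸ i = trans (sym (m+n∸n≡m (e i) (μ (suc i)))) (cong (_∸ μ (suc i)) (e+μ i))

  -- Stairs h x ts: the value of μ at h is x, and ts lists the nonzero
  -- differences of μ below h.
  data Stairs : ℕ → ℕ → List (ℕ × ℕ) → Set where
    ground : Stairs 0 (μ 0) []
    step   : ∀ {h x v y ts} → v < h → x ≤ μ h → μ (suc v) ≤ x → Stairs v y ts →
             Stairs h x ((v , y ∸ x) ∷ ts)

  private
    -- By antitonicity, an upper bound just after one drop and an equal lower bound at the next fix
    -- μ in between. No other values of μ have to be computed.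
    flat : ∀ {h x v} → x ≤ μ h → μ (suc v) ≤ x → ∀ {i} → v < i → i ≤ h → μ i ≡ x
    flat x≤ ≤x v<i i≤h = ≤-antisym (≤-trans (μ-antitone v<i) ≤x) (≤-trans x≤ (μ-antitone i≤h))

    value : ∀ {h x ts} → Stairs h x ts → μ h ≡ x
    value ground = refl
    value (step v<h x≤ ≤x _) = flat x≤ ≤x v<h ≤-refl

    listed : ∀ {h x ts} → Stairs h x ts → All (λ p → e (proj₁ p) ≡ proj₂ p) ts
    listed ground = []
    listed (step {v = v} v<h x≤ ≤x st) =
      trans (e≡∸ v) (cong₂ _∸_ (value st) (flat x≤ ≤x ≤-refl v<h)) ∷ listed st

    unlisted : ∀ {h x ts} → Stairs h x ts → ∀ i → i < h → i ∉ map proj₁ ts → e i ≡ 0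
    unlisted (step {x = x} {v = v} v<h x≤ ≤x st) i i<h i∉ with <-cmp i v
    ... | tri< i<v _ _ = unlisted st i i<v (i∉ ∘ there)
    ... | tri≈ _ i≡v _ = contradiction (here i≡v) i∉
    ... | tri> _ _ v<i = trans (e≡∸ i)
      (trans (cong₂ _∸_ (flat x≤ ≤x v<i (<⇒≤ i<h)) (flat x≤ ≤x (m<n⇒m<1+n v<i) i<h)) (n∸n≡0 x))

  -- The staircase is closed by a last step to height 0, whose listed difference `y ∸ 0` reduces to
  -- `y`.
  tabulated : ∀ {v y ts} → μ (suc v) ≤ 0 → Stairs v y ts → IsTabulatedBy e ((v , y) ∷ ts)
  tabulated {v} {y} {ts} top st =
    listed (step {h = suc v} {x = 0} ≤-refl z≤n top st) , above
    where
    above : ∀ i → i ∉ map proj₁ ((v , y) ∷ ts) → e i ≡ 0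
    above i i∉ with <-cmp i v
    ... | tri< i<v _ _ = unlisted st i i<v (i∉ ∘ there)
    ... | tri≈ _ i≡v _ = contradiction (here i≡v) i∉
    ... | tri> _ _ v<i = trans (e≡∸ i)
      (trans (cong (_∸ μ (suc i)) (n≤0⇒n≡0 (≤-trans (μ-antitone v<i) top))) (0∸n≡0 (μ (suc i))))

-- Multiplicity tables from the bounds

module Tables where

  open import Data.Integer.Base using (+_)
  import Data.Integer.Properties as ℤ
  open import Data.Integer.Divisibility.Signed as ℤ∣ using (_∣_)
  import Data.Nat.Base as ℕ
  open import Data.Nat.Divisibility as ℕ∣ using () renaming (_∣_ to _∣ⁿ_)
  import Data.Nat.Properties as ℕ
  open IntegerMatrices

  module _ {f N q s t r A} (G : PointLineGeometry f N q s t r A) (S : SmithNormalForm A)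
    {ℓ} (ℓ-prime : Prime ℓ) (j₀ : Fin N) (f≤N : f ≤ N) where

    open MultiplicityBounds G S ℓ-prime
    open ElementaryDivisors S ℓ-prime
    open PointLineGeometry G using (t≡)

    private
      e : ℕ → ℕ
      e = multiplicity S ℓ

      Table : List (ℕ × ℕ) → Set
      Table = IsTabulatedBy e

      e+μ : ∀ i → e i + μ (suc i) ≡ μ i
      e+μ = multiplicity-μ

      t≡ⁿ : t ≡ r + s
      t≡ⁿ = ℤ.+-injective (trans t≡ (sym (ℤ.pos-+ r s)))

      valuation-0 : ∀ {x} → ¬ ℓ ∣ⁿ x → HasValuation ℓ x 0
      valuation-0 {x} ∤x = valuation-zero⁺ ℓ-prime x (∤x ∘ ∣⇒∣ⁿ)

      1≤N : 1 ≤ N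
      1≤N = ℕ.≤-trans (s≤s z≤n) (Fin.toℕ<n j₀)

      twoSteps : ∀ {a x} → 0 < a → x ≤ N → x ≤ μ a → μ 1 ≤ x → μ (suc a) ≤ 0 →
                 Table ((a , x) ∷ (0 , N ∸ x) ∷ [])
      twoSteps {a} {x} 0<a x≤N x≤ ≤x top =
        subst (λ n → Table ((a , x) ∷ (0 , n ∸ x) ∷ [])) μ-zero
          (tabulated e+μ top (step 0<a x≤ ≤x ground))

    -- All of r s, s and k′ are prime to `ℓ`, so `μ 1` is 0 and `ℓ` divides no diagonal entry. In
    -- particular no entry is zero, and the cokernel is finite of order the product of the entries.
    ∤order : ¬ ℓ ∣ⁿ s → ¬ ℓ ∣ⁿ s * t → ¬ ℓ ∣ⁿ r →
             ∃ λ order → HasCardinality (AbelianGroup.setoid (cokernel A)) order × ¬ (ℓ ∣ⁿ order)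
    ∤order ∤s ∤st ∤r = ∏ entry , cokernel-cardinality S nonZero , ∤-∏ ℓ-prime entry ∤entry
      where
      open SmithNormalForm S using (entry)
      μ1≤0 : μ 1 ≤ 0
      μ1≤0 = μ≤0 0 0 0
        (valuation-* ℓ-prime r s 0 0 (valuation-0 ∤r) (valuation-0 ∤s))
        (valuation-0 ∤s) (valuation-0 ∤st)
        1 1 ℕ.≤-refl ℕ.≤-refl ℕ.≤-refl
      ∤entry : ∀ j → ¬ ℓ ∣ⁿ entry j
      ∤entry j d with enumerate-surjective (λ j → ℓ ^ 1 ℕ∣.∣? entry j)
                        (∣⇒∣ⁿ (∣⇒∣^1 ℓ-prime (∣ⁿ⇒∣ d)))
      ... | b , _ = contradiction (subst Fin (ℕ.n≤0⇒n≡0 μ1≤0) b) λ ()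
      nonZero : ∀ j → ℕ.NonZero (entry j)
      nonZero j = ℕ.≢-nonZero λ eq → ∤entry j (subst (ℓ ∣ⁿ_) (sym eq) (ℓ ℕ∣.∣0))

    -- With r s prime to `ℓ`, a vector with image divisible by `ℓ` is controlled by its sum alone.
    -- The all-ones eigenvector attains this bound up to the valuation of k′.
    ∣k′-case : ¬ ℓ ∣ⁿ s → ¬ ℓ ∣ⁿ r → ∀ a → 0 < a → HasValuation ℓ (s * t) a →
               Table ((a , 1) ∷ (0 , N ∸ 1) ∷ [])
    ∣k′-case ∤s ∤r a 0<a val = twoSteps 0<a 1≤N
      (1≤μ j₀ a (∣-resp (ℤ.pos-* s t) (∣-valuation ℓ-prime (s * t) a val)))
      (μ≤1 0 0 valrs (valuation-0 ∤s) 1 ℕ.≤-refl ℕ.≤-refl)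
      (μ≤0 0 0 a valrs (valuation-0 ∤s) val 1 (suc a) (ℕ.≤-reflexive (ℕ.+-comm a 1)) (s≤s z≤n) ℕ.≤-refl)
      where
      valrs : HasValuation ℓ (r * s) 0
      valrs = valuation-* ℓ-prime r s 0 0 (valuation-0 ∤r) (valuation-0 ∤s)

    -- Neither `s` nor `t` is divisible by `ℓ`, so the `f` eigenvectors `D` remain independent and
    -- account for every exponent up to the valuation of `r`.
    ∣r-case : ¬ ℓ ∣ⁿ s → ¬ ℓ ∣ⁿ s * t → ∀ a → 0 < a → HasValuation ℓ r a →
              Table ((a , f) ∷ (0 , N ∸ f) ∷ [])
    ∣r-case ∤s ∤st a 0<a val = twoSteps 0<a f≤N
      (f≤μ (∤st ∘ ℕ∣.∣n⇒∣m*n s ∘ ∣⇒∣ⁿ) a (∣-valuation ℓ-prime r a val))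
      (μ1≤f j₀ (∤s ∘ ∣⇒∣ⁿ) (λ d → ∤st (∣⇒∣ⁿ (∣-resp (sym (ℤ.pos-* s t)) d))))
      (μ≤0 a 0 0 (subst (HasValuation ℓ (r * s)) (ℕ.+-identityʳ a) (valuation-* ℓ-prime r s a 0 val (valuation-0 ∤s)))
        (valuation-0 ∤s) (valuation-0 ∤st) (suc a) (suc a) ℕ.≤-refl ℕ.≤-refl ℕ.≤-refl)

    -- `ℓ` does not divide r = t - s, so `A` has rank `f` modulo `ℓ`. The remaining `N ∸ f` divisors
    -- all have the valuation of `s`: r s and k′ have that same valuation.
    ∣s∤t-case : ¬ ℓ ∣ⁿ t → ∀ a → 0 < a → HasValuation ℓ s a →
                Table ((a , N ∸ f) ∷ (0 , N ∸ (N ∸ f)) ∷ [])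
    ∣s∤t-case ∤t a 0<a val = twoSteps 0<a (ℕ.m∸n≤m N f)
      (ℕ.m≤n+o⇒m∸n≤o N f (N≤f+μ (∤t ∘ ∣⇒∣ⁿ) ∣s a (∣-valuation ℓ-prime s a val)))
      (ℕ.m+n≤o⇒m≤o∸n (μ 1) (subst (_≤ N) (ℕ.+-comm f (μ 1)) (f+μ≤N (∤t ∘ ∣⇒∣ⁿ) (∤r ∘ ∣⇒∣ⁿ))))
      (μ≤0 a a a (valuation-* ℓ-prime r s 0 a (valuation-0 ∤r) val) val
        (subst (HasValuation ℓ (s * t)) (ℕ.+-identityʳ a) (valuation-* ℓ-prime s t a 0 val (valuation-0 ∤t)))
        1 (suc a) (ℕ.≤-reflexive (ℕ.+-comm a 1)) ℕ.≤-refl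
        (subst (suc a ≤_) (ℕ.+-comm 1 (a + a)) (s≤s (ℕ.m≤m+n a a))))
      where
      ∣s : + ℓ ∣ + s
      ∣s = valuation-positive⁻ ℓ-prime s a val 0<a
      ∤r : ¬ ℓ ∣ⁿ r
      ∤r d = ∤t (subst (ℓ ∣ⁿ_) (sym t≡ⁿ) (ℕ∣.∣m∣n⇒∣m+n d (∣⇒∣ⁿ ∣s)))

  module _ {f N q s t r A} (G : PointLineGeometry (suc f) N q s t r A) (S : SmithNormalForm A)
    {ℓ} (ℓ-prime : Prime ℓ) (ℓ∤q : ¬ ℓ ∣ⁿ q) (j₀ : Fin N)
    (a b c h k : ℕ) (0<a : 0 < a) (t≡ : t ≡ q * (s * h)) (r≡ : r ≡ s * k)
    (val-s : HasValuation ℓ s a) (val-k : HasValuation ℓ k b) (val-h : HasValuation ℓ h c) where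

    private
      ∣s : + ℓ ∣ + s
      ∣s = valuation-positive⁻ ℓ-prime s a val-s 0<a

      val-t : HasValuation ℓ t (a + c)
      val-t = subst (λ x → HasValuation ℓ x (a + c)) (sym t≡)
        (valuation-* ℓ-prime q (s * h) 0 (a + c) (valuation-zero⁺ ℓ-prime q (ℓ∤q ∘ ∣⇒∣ⁿ))
          (valuation-* ℓ-prime s h a c val-s val-h))

      val-r : HasValuation ℓ r (a + b)
      val-r = subst (λ x → HasValuation ℓ x (a + b)) (sym r≡) (valuation-* ℓ-prime s k a b val-s val-k)

      val-rs : HasValuation ℓ (r * s) (a + b + a)
      val-rs = valuation-* ℓ-prime r s (a + b) a val-r val-s

      val-st : HasValuation ℓ (s * t) (a + (a + c))
      val-st = valuation-* ℓ-prime s t a (a + c) val-s val-t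

      ∣t : + ℓ ∣ + t
      ∣t = valuation-positive⁻ ℓ-prime t (a + c) val-t (ℕ.<-≤-trans 0<a (ℕ.m≤m+n a c))

    open MultiplicityBounds G S ℓ-prime using (μ≤0; μ≤1; 1≤μ)
    open DegenerateBounds G S ℓ-prime (ℓ∤q ∘ ∣⇒∣ⁿ) ∣s ∣t
    open ElementaryDivisors S ℓ-prime

    private
      e : ℕ → ℕ
      e = multiplicity S ℓ

      Table : List (ℕ × ℕ) → Set
      Table = IsTabulatedBy e

      e+μ : ∀ i → e i + μ (suc i) ≡ μ i
      e+μ = multiplicity-μ

      x : ℕ
      x = N ∸ f

      -- From exponent 1 up to the valuation `a` of `s`, exactly `f` divisors are missing: the rank
      -- modulo `ℓ`.
      lower : Stairs e+μ a x ((0 , N ∸ x) ∷ [])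
      lower = subst (λ n → Stairs e+μ a x ((0 , n ∸ x) ∷ [])) μ-zero
        (step 0<a
          (ℕ.m≤n+o⇒m∸n≤o N f (N≤f+μ a (∣-valuation ℓ-prime s a val-s)
            (ℤ∣.∣-trans (^-∣ ℓ (ℕ.m≤m+n a c)) (∣-valuation ℓ-prime t (a + c) val-t))))
          (ℕ.m+n≤o⇒m≤o∸n (μ 1) (subst (_≤ N) (ℕ.+-comm f (μ 1)) f+μ≤N))
          ground)

      a<a+b+a : a < a + b + a
      a<a+b+a = ℕ.<-≤-trans (ℕ.m<m+n a 0<a) (ℕ.≤-trans (ℕ.≤-reflexive (ℕ.+-comm a a)) (ℕ.+-monoˡ-≤ a (ℕ.m≤m+n a b)))

      -- The height `suc f` persists as long as the exponent is bounded by the valuations of r s and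
      -- t r, which govern the images of the vectors used in `f<μ`.
      upper : ∀ {v} → a < v → v ≤ a + b + a → v ≤ a + c + (a + b) →
              Stairs e+μ v (suc f) ((a , x ∸ suc f) ∷ (0 , N ∸ x) ∷ [])
      upper {v} a<v v≤rs v≤tr = step a<v
        (f<μ j₀ v
          (ℤ∣.∣-trans (^-∣ ℓ v≤tr) (∣-*-^ ℓ (a + c) (a + b) (∣-valuation ℓ-prime t (a + c) val-t) (∣-valuation ℓ-prime r (a + b) val-r)))
          (ℤ∣.∣-trans (^-∣ ℓ v≤rs) (∣-*-^ ℓ (a + b) a (∣-valuation ℓ-prime r (a + b) val-r) (∣-valuation ℓ-prime s a val-s))))
        (μ≤1+f j₀ a val-s)
        lower

    ∤h-case : c ≡ 0 → Table ((a + b + a , suc f) ∷ (a , x ∸ suc f) ∷ (0 , N ∸ x) ∷ [])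
    ∤h-case refl = tabulated e+μ
      -- With c = 0 the valuation of k′ is 2a. Exponent 2a + b + 1 for the image thus leaves b + 1
      -- for the sum, and s² brings this back to 2a + b + 1, just above the valuation 2a + b of r s.
      (μ≤0 (a + b + a) a (a + (a + 0)) val-rs val-s val-st (suc b) (suc (a + b + a))
        (ℕ.≤-reflexive (eq₁ a b)) ℕ.≤-refl (ℕ.≤-reflexive (eq₂ a b)))
      (upper a<a+b+a ℕ.≤-refl (ℕ.≤-reflexive (eq₃ a b)))
      where
      eq₁ : ∀ a b → a + (a + 0) + (1 + b) ≡ 1 + (a + b + a)
      eq₁ = solve-∀
      eq₂ : ∀ a b → 1 + (a + b + a) ≡ a + a + (1 + b)
      eq₂ = solve-∀
      eq₃ : ∀ a b → a + b + a ≡ a + 0 + (a + b)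
      eq₃ = solve-∀

    -- The valuation 2a + c of k′ now exceeds the valuation 2a of r s. Between them only the form
    -- sum y survives, and the all-ones vector supplies the single remaining divisor.
    ∣h-case : b ≡ 0 → 0 < c →
              Table ((a + (a + c) , 1) ∷ (a + 0 + a , f) ∷ (a , x ∸ suc f) ∷ (0 , N ∸ x) ∷ [])
    ∣h-case refl 0<c = tabulated e+μ
      (μ≤0 (a + 0 + a) a (a + (a + c)) val-rs val-s val-st 1 (suc (a + (a + c)))
        (ℕ.≤-reflexive (ℕ.+-comm _ 1)) (s≤s (ℕ.≤-trans (ℕ.m≤m+n (a + 0 + a) c) (ℕ.≤-reflexive (eq₁ a c))))
        (ℕ.≤-reflexive (eq₂ a)))
      (step (ℕ.<-≤-trans (ℕ.m<m+n (a + 0 + a) 0<c) (ℕ.≤-reflexive (eq₁ a c)))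
        (1≤μ j₀ (a + (a + c)) (∣-resp (ℤ.pos-* s t) (∣-valuation ℓ-prime (s * t) (a + (a + c)) val-st)))
        (μ≤1 (a + 0 + a) a val-rs val-s (suc (a + 0 + a)) ℕ.≤-refl (ℕ.≤-reflexive (eq₂ a)))
        (upper a<a+b+a ℕ.≤-refl (ℕ.≤-trans (ℕ.m≤m+n (a + 0 + a) c) (ℕ.≤-reflexive (eq₃ a c)))))
      where
      eq₁ : ∀ a c → a + 0 + a + c ≡ a + (a + c)
      eq₁ = solve-∀
      eq₂ : ∀ a → 1 + (a + 0 + a) ≡ a + a + 1
      eq₂ = solve-∀
      eq₃ : ∀ a c → a + 0 + a + c ≡ a + c + (a + 0)
      eq₃ = solve-∀

open import Data.Nat.Divisibility using (_∣_; _∣?_; _∣0; divides; ∣1⇒≡1; ∣m+n∣m⇒∣n; ∣n⇒∣m*n; ∣m⇒∣m*n)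
open import Data.Nat.DivMod using (m*n/n≡m)
open IntegerMatrices using (∣⇒∣ⁿ; valuation-positive; valuation-positive⁻; 1<prime; PointLineGeometry; module PointLineGeometryProperties)
open ProjectiveGeometry
open Tables

-- Geometric sums

geometric-suc : ∀ q k → geometric q (suc k) ≡ suc (q * geometric q k)
geometric-suc q zero    = cong suc (sym (*-zeroʳ q))
geometric-suc q (suc k) = trans (cong (_+_ (q ^ suc k)) (geometric-suc q k)) (rearrange q (q ^ k) (geometric q k))
  where
  rearrange : ∀ q x g → q * x + (1 + q * g) ≡ 1 + q * (x + g)
  rearrange = solve-∀

geometric-even : ∀ q k → geometric q (k + k) ≡ (q + 1) * geometric (q ^ 2) k
geometric-even q zero    = sym (*-zeroʳ (q + 1))
geometric-even q (suc k) = begin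
  geometric q (suc (k + suc k))              ≡⟨ cong (geometric q ∘ suc) (+-suc k k) ⟩
  geometric q (suc (suc (k + k)))            ≡⟨ geometric-suc q (suc (k + k)) ⟩
  suc (q * geometric q (suc (k + k)))        ≡⟨ cong (λ x → suc (q * x)) (geometric-suc q (k + k)) ⟩
  suc (q * suc (q * geometric q (k + k)))    ≡⟨ cong (λ x → suc (q * suc (q * x))) (geometric-even q k) ⟩
  suc (q * suc (q * ((q + 1) * geometric (q ^ 2) k)))
    ≡⟨ rearrange q (geometric (q ^ 2) k) ⟩
  (q + 1) * suc (q ^ 2 * geometric (q ^ 2) k) ≡⟨ cong ((q + 1) *_) (geometric-suc (q ^ 2) k) ⟨
  (q + 1) * geometric (q ^ 2) (suc k)        ∎
  where
  open ≡-Reasoning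
  rearrange : ∀ q g → 1 + q * (1 + q * ((q + 1) * g)) ≡ (q + 1) * (1 + q * (q * 1) * g)
  rearrange = solve-∀

qInt≡geometric : ∀ {q} k → 1 < q → qInt q k ≡ geometric q k
qInt≡geometric {suc zero} k (s≤s ())
qInt≡geometric {suc (suc q)} k _ = trans (cong (_div suc q) (trans (cong (_∸ 1) (telescope k)) refl))
  (m*n/n≡m (geometric (2 + q) k) (suc q))
  where
  telescope : ∀ k → (2 + q) ^ k ≡ suc (geometric (2 + q) k * suc q)
  telescope zero    = refl
  telescope (suc k) = trans (rearrange q ((2 + q) ^ k))
    (trans (cong (λ x → (2 + q) ^ k * suc q + x) (telescope k)) (collect ((2 + q) ^ k) (geometric (2 + q) k) q))
    where
    rearrange : ∀ q x → (2 + q) * x ≡ x * (1 + q) + x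
    rearrange = solve-∀
    collect : ∀ x g q → x * (1 + q) + (1 + g * (1 + q)) ≡ 1 + (x + g) * (1 + q)
    collect = solve-∀

half : ∀ n → ∃ λ k → n ≡ k + k ⊎ n ≡ suc (k + k)
half zero = 0 , inj₁ refl
half (suc n) with half n
... | k , inj₁ eq = k , inj₂ (cong suc eq)
... | k , inj₂ eq = suc k , inj₁ (cong suc (trans eq (sym (+-suc k k))))

[k+k]/2≡k : ∀ k → (k + k) / 2 ≡ k
[k+k]/2≡k k = trans (cong (_/ 2) (double k)) (m*n/n≡m k 2)
  where
  double : ∀ k → k + k ≡ k * 2
  double = solve-∀

2∣k+k : ∀ k → 2 ∣ k + k
2∣k+k k = divides k (double k)
  where
  double : ∀ k → k + k ≡ k * 2
  double = solve-∀

2∤1+k+k : ∀ k → ¬ 2 ∣ suc (k + k)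
2∤1+k+k k d with ∣1⇒≡1 (∣m+n∣m⇒∣n (subst (2 ∣_) (+-comm 1 (k + k)) d) (2∣k+k k))
... | ()

prime∣prime^ : ∀ {ℓ p} k → Prime ℓ → Prime p → ℓ ∣ p ^ k → ℓ ≡ p
prime∣prime^ {ℓ} {p} zero ℓ-prime p-prime d =
  contradiction (∣1⇒≡1 d) (≢-sym (<⇒≢ (nonTrivial⇒n>1 ℓ {{prime⇒nonTrivial ℓ-prime}})))
prime∣prime^ {ℓ} {p} (suc k) ℓ-prime p-prime d with euclidsLemma p (p ^ k) ℓ-prime d
... | inj₂ d′ = prime∣prime^ k ℓ-prime p-prime d′
... | inj₁ ℓ∣p with prime⇒irreducible p-prime ℓ∣p
...   | inj₂ ℓ≡p = ℓ≡p
...   | inj₁ refl = contradiction (nonTrivial⇒n>1 1 {{prime⇒nonTrivial ℓ-prime}}) (<-irrefl refl)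

-- The conclusion of the theorem, with [n], q + 1, k′, r and h abstracted.
Multiplicities : ∀ {N} {A : Matrix N} → SmithNormalForm A → (ℓ q s m k′ r h : ℕ) → Set → Set → Set
Multiplicities {N} {A} S ℓ q s m k′ r h Even Odd =
  let
    e = multiplicity S ℓ
    f = m ∸ 1
    g = N ∸ m
  in
    ( ¬ (ℓ ∣ s) →
        ( ¬ (ℓ ∣ k′ * r) →
            ∃ λ order → HasCardinality (AbelianGroup.setoid (cokernel A)) order × ¬ (ℓ ∣ order) )
      × ( ℓ ∣ k′ * r →
            ( (ℓ ∣ k′ × ¬ (ℓ ∣ r)) ⊎ (¬ (ℓ ∣ k′) × ℓ ∣ r) )
          × ( ℓ ∣ k′ → ∀ a → HasValuation ℓ k′ a →
                IsTabulatedBy e ((a , 1) ∷ (0 , f + g) ∷ []) )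
          × ( ℓ ∣ r → ∀ a → HasValuation ℓ r a →
                IsTabulatedBy e ((a , f) ∷ (0 , g + 1) ∷ []) ) ) )
  × ( ℓ ∣ s → Even →
        ∀ a b c → HasValuation ℓ s a → HasValuation ℓ (q * h ∸ 1) b → HasValuation ℓ h c →
          ( b ≡ 0 ⊎ c ≡ 0 )
        × ( b ≡ 0 → c ≡ 0 →
              IsTabulatedBy e ((2 * a , f) ∷ (a , g ∸ f + 2) ∷ (0 , f ∸ 1) ∷ []) )
        × ( 0 < b →
              IsTabulatedBy e ((2 * a + b , f) ∷ (a , g ∸ f + 2) ∷ (0 , f ∸ 1) ∷ []) )
        × ( 0 < c →
              IsTabulatedBy e ((2 * a + c , 1) ∷ (2 * a , f ∸ 1) ∷ (a , g ∸ f + 2) ∷ (0 , f ∸ 1) ∷ []) ) )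
  × ( ℓ ∣ s → Odd →
        ∀ a → HasValuation ℓ s a →
          IsTabulatedBy e ((a , g + 1) ∷ (0 , f) ∷ []) )

-- The tables in terms of f, g, k′, r and h

module _ {f N q s t r A} (G : PointLineGeometry (suc f) N q s t r A) (S : SmithNormalForm A)
  {ℓ} (ℓ-prime : Prime ℓ) (ℓ∤q : ¬ ℓ ∣ q) (t≡ : t ≡ r + s) (2m≤N : suc (suc f) * 2 ≤ N) where

  private
    e : ℕ → ℕ
    e = multiplicity S ℓ

    m≤N : suc (suc f) ≤ N
    m≤N = ≤-trans (m≤m*n (suc (suc f)) 2) 2m≤N

    j₀ : Fin N
    j₀ = fromℕ< (≤-trans (s≤s z≤n) m≤N)

    f≤N : suc f ≤ N
    f≤N = ≤-trans (n≤1+n (suc f)) m≤N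

    g : ℕ
    g = N ∸ suc (suc f)

    m+g : suc (suc f) + g ≡ N
    m+g = m+[n∸m]≡n m≤N

    N∸1 : N ∸ 1 ≡ suc f + g
    N∸1 = cong (_∸ 1) (sym m+g)

    N∸f : N ∸ suc f ≡ g + 1
    N∸f = begin
      N ∸ suc f                    ≡⟨ cong (_∸ suc f) m+g ⟨
      suc (suc f) + g ∸ suc f      ≡⟨ cong (_∸ suc f) (+-suc (suc f) g) ⟨
      suc f + suc g ∸ suc f        ≡⟨ m+n∸m≡n (suc f) (suc g) ⟩
      suc g                        ≡⟨ +-comm 1 g ⟩
      g + 1                        ∎
      where open ≡-Reasoning

    -- Subtraction is truncated, so regrouping needs 2 ≤ N - (2f + 1). This is where the bound
    -- `2m≤N` enters: it reads 2f + 4 ≤ N.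
    middle : N ∸ f ∸ suc f ≡ g ∸ suc f + 2
    middle = begin
      N ∸ f ∸ suc f                    ≡⟨ ∸-+-assoc N f (suc f) ⟩
      x                                ≡⟨ m∸n+n≡m 2≤x ⟨
      x ∸ 2 + 2                        ≡⟨ cong (_+ 2) (∸-+-assoc N (f + suc f) 2) ⟩
      N ∸ (f + suc f + 2) + 2          ≡⟨ cong (λ y → N ∸ y + 2) (rearrange f) ⟩
      N ∸ (suc (suc f) + suc f) + 2    ≡⟨ cong (_+ 2) (∸-+-assoc N (suc (suc f)) (suc f)) ⟨
      g ∸ suc f + 2                    ∎
      where
      open ≡-Reasoning
      x = N ∸ (f + suc f)
      rearrange : ∀ f → f + (1 + f) + 2 ≡ 2 + f + (1 + f)
      rearrange = solve-∀
      split : ∀ f → (2 + f) * 2 ≡ 2 + (f + (1 + f)) + 1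
      split = solve-∀
      2≤x : 2 ≤ x
      2≤x = m+n≤o⇒m≤o∸n 2 (≤-trans (≤-trans (m≤m+n (2 + (f + suc f)) 1) (≤-reflexive (sym (split f)))) 2m≤N)

    bottom : N ∸ (N ∸ f) ≡ f
    bottom = m∸[m∸n]≡n (≤-trans (n≤1+n f) f≤N)

    ∣st⇒∤r : ¬ ℓ ∣ s → ℓ ∣ s * t → ¬ ℓ ∣ r
    ∣st⇒∤r ∤s ∣st ∣r with euclidsLemma s t ℓ-prime ∣st
    ... | inj₁ ∣s = ∤s ∣s
    ... | inj₂ ∣t = ∤s (∣m+n∣m⇒∣n (subst (ℓ ∣_) t≡ ∣t) ∣r)

    exclusive : ¬ ℓ ∣ s → ℓ ∣ s * t * r → (ℓ ∣ s * t × ¬ ℓ ∣ r) ⊎ (¬ ℓ ∣ s * t × ℓ ∣ r)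
    exclusive ∤s d with ℓ ∣? r
    ... | yes ∣r = inj₂ ((λ ∣st → ∣st⇒∤r ∤s ∣st ∣r) , ∣r)
    ... | no ∤r with euclidsLemma (s * t) r ℓ-prime d
    ...   | inj₁ ∣st = inj₁ (∣st , ∤r)
    ...   | inj₂ ∣r = contradiction ∣r ∤r

    -- A common divisor of q h - 1 and h divides 1. The case h = 0, where the truncated q h ∸ 1 is
    -- no predecessor, is excluded because 0 has no valuation.
    b≡0⊎c≡0 : ∀ h b c → HasValuation ℓ (q * h ∸ 1) b → HasValuation ℓ h c → b ≡ 0 ⊎ c ≡ 0
    b≡0⊎c≡0 h zero c _ _ = inj₁ refl
    b≡0⊎c≡0 h (suc b) zero _ _ = inj₂ refl
    b≡0⊎c≡0 zero (suc b) (suc c) _ val-h = contradiction (_ ∣0) (proj₂ val-h)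
    b≡0⊎c≡0 h@(suc _) (suc b) (suc c) val-k val-h = contradiction
      (∣1⇒≡1 (∣m+n∣m⇒∣n (subst (ℓ ∣_) (sym qh∸1+1) (∣n⇒∣m*n q (∣⇒∣ⁿ (valuation-positive⁻ ℓ-prime h (suc c) val-h (s≤s z≤n)))))
        (∣⇒∣ⁿ (valuation-positive⁻ ℓ-prime (q * h ∸ 1) (suc b) val-k (s≤s z≤n)))))
      (≢-sym (<⇒≢ (1<prime ℓ-prime)))
      where
      instance
        qh≢0 : NonZero (q * h)
        qh≢0 = m*n≢0 q h {{≢-nonZero λ { refl → ℓ∤q (ℓ ∣0) }}}
      qh∸1+1 : q * h ∸ 1 + 1 ≡ q * h
      qh∸1+1 = m∸n+n≡m (>-nonZero⁻¹ (q * h))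

    evenCase : ∀ {h} → t ≡ q * (s * h) → ℓ ∣ s → ∀ a b c →
      HasValuation ℓ s a → HasValuation ℓ (q * h ∸ 1) b → HasValuation ℓ h c →
        ( b ≡ 0 ⊎ c ≡ 0 )
      × ( b ≡ 0 → c ≡ 0 →
            IsTabulatedBy e ((2 * a , suc f) ∷ (a , g ∸ suc f + 2) ∷ (0 , f) ∷ []) )
      × ( 0 < b →
            IsTabulatedBy e ((2 * a + b , suc f) ∷ (a , g ∸ suc f + 2) ∷ (0 , f) ∷ []) )
      × ( 0 < c →
            IsTabulatedBy e ((2 * a + c , 1) ∷ (2 * a , f) ∷ (a , g ∸ suc f + 2) ∷ (0 , f) ∷ []) )
    evenCase {h} t≡qsh ℓ∣s a b c val-s val-k val-h =
        b≡0⊎c≡0 h b c val-k val-h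
      , (λ b≡0 c≡0 → subst (λ v → Top v) (trans (top a b) (trans (cong (_+_ (2 * a)) b≡0) (+-identityʳ (2 * a)))) (∤h c≡0))
      , (λ 0<b → subst (λ v → Top v) (top a b) (∤h (c≡0 0<b)))
      , λ 0<c → subst₂ (λ v w → IsTabulatedBy e ((v , 1) ∷ (w , f) ∷ (a , g ∸ suc f + 2) ∷ (0 , f) ∷ []))
          (top₁ a c) (top₂ a)
          (subst₂ (λ x y → IsTabulatedBy e ((a + (a + c) , 1) ∷ (a + 0 + a , f) ∷ (a , x) ∷ (0 , y) ∷ []))
            middle bottom (∣h-case G S ℓ-prime ℓ∤q j₀ a b c h (q * h ∸ 1) 0<a t≡qsh r≡ val-s val-k val-h (b≡0 0<c) 0<c))
      where
      Top : ℕ → Set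
      Top v = IsTabulatedBy e ((v , suc f) ∷ (a , g ∸ suc f + 2) ∷ (0 , f) ∷ [])
      0<a : 0 < a
      0<a = valuation-positive ℓ-prime s a val-s ℓ∣s
      r≡ : r ≡ s * (q * h ∸ 1)
      r≡ = begin
        r                         ≡⟨ m+n∸n≡m r s ⟨
        r + s ∸ s                 ≡⟨ cong (_∸ s) t≡ ⟨
        t ∸ s                     ≡⟨ cong₂ _∸_ (trans t≡qsh (swap q s h)) (sym (*-identityʳ s)) ⟩
        s * (q * h) ∸ s * 1       ≡⟨ *-distribˡ-∸ s (q * h) 1 ⟨
        s * (q * h ∸ 1)           ∎
        where
        open ≡-Reasoning
        swap : ∀ q s h → q * (s * h) ≡ s * (q * h)
        swap = solve-∀
      top : ∀ a b → a + b + a ≡ 2 * a + b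
      top = solve-∀
      top₁ : ∀ a c → a + (a + c) ≡ 2 * a + c
      top₁ = solve-∀
      top₂ : ∀ a → a + 0 + a ≡ 2 * a
      top₂ = solve-∀
      ∤h : c ≡ 0 → Top (a + b + a)
      ∤h c≡0 = subst₂ (λ x y → IsTabulatedBy e ((a + b + a , suc f) ∷ (a , x) ∷ (0 , y) ∷ []))
        middle bottom (∤h-case G S ℓ-prime ℓ∤q j₀ a b c h (q * h ∸ 1) 0<a t≡qsh r≡ val-s val-k val-h c≡0)
      c≡0 : 0 < b → c ≡ 0
      c≡0 0<b with b≡0⊎c≡0 h b c val-k val-h
      ... | inj₁ b≡0 = contradiction (sym b≡0) (<⇒≢ 0<b)
      ... | inj₂ c≡0 = c≡0
      b≡0 : 0 < c → b ≡ 0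
      b≡0 0<c with b≡0⊎c≡0 h b c val-k val-h
      ... | inj₁ b≡0 = b≡0
      ... | inj₂ c≡0 = contradiction (sym c≡0) (<⇒≢ 0<c)

  multiplicities : ∀ {h Even Odd} → (Even → t ≡ q * (s * h)) → (ℓ ∣ s → Odd → ¬ ℓ ∣ t) →
                   Multiplicities S ℓ q s (suc (suc f)) (s * t) r h Even Odd
  multiplicities even odd =
      (λ ∤s →
          (λ ∤str → ∤order G S ℓ-prime j₀ f≤N ∤s (∤str ∘ ∣m⇒∣m*n r) (∤str ∘ ∣n⇒∣m*n (s * t)))
        , λ ∣str →
            exclusive ∤s ∣str
          , (λ ∣st a val → subst (λ x → IsTabulatedBy e ((a , 1) ∷ (0 , x) ∷ [])) N∸1
              (∣k′-case G S ℓ-prime j₀ f≤N ∤s (∣st⇒∤r ∤s ∣st) a (valuation-positive ℓ-prime (s * t) a val ∣st) val))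
          , (λ ∣r a val → subst (λ x → IsTabulatedBy e ((a , suc f) ∷ (0 , x) ∷ [])) N∸f
              (∣r-case G S ℓ-prime j₀ f≤N ∤s (λ ∣st → ∣st⇒∤r ∤s ∣st ∣r) a (valuation-positive ℓ-prime r a val ∣r) val)))
    , (λ ∣s ev → evenCase (even ev) ∣s)
    , (λ ∣s od a val → subst₂ (λ x y → IsTabulatedBy e ((a , x) ∷ (0 , y) ∷ [])) N∸f (m∸[m∸n]≡n f≤N)
        (∣s∤t-case G S ℓ-prime j₀ f≤N (odd ∣s od) a (valuation-positive ℓ-prime s a val ∣s) val))

mainTheorem6 :
  {a₁ a₂ b₁ b₂ : Level}
  (p t q n : ℕ) → Prime p → 1 ≤ t → q ≡ p ^ t → 4 ≤ n →
  (F : CommutativeRing a₁ a₂) → IsFieldOfOrder F q →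
  (V : Module F b₁ b₂) → HasDimension V (whole V) n →
  -- An ordering of the vertices; in particular N is the number of
  -- 2-dimensional subspaces, that is, the Gaussian binomial [n 2]_q.
  (N : ℕ) (vertices : HasCardinality (Grassmannian V 2) N) →
  (A : Matrix N) →
  IsAdjacencyMatrix (λ i j → GrassmannAdjacent V (Inverse.to vertices i) (Inverse.to vertices j)) A →
  (S : SmithNormalForm A) →
  (ℓ : ℕ) → Prime ℓ → ℓ ≢ p →
  let
    e  = multiplicity S ℓ
    f  = qInt q n ∸ 1
    g  = N ∸ qInt q n
    k′ = q * (q + 1) * qInt q (n ∸ 2)
    r  = q ^ 2 * qInt q (n ∸ 3) ∸ 1
  in
    ( ¬ (ℓ ∣ q + 1) →
        ( ¬ (ℓ ∣ k′ * r) →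
            ∃ λ order → HasCardinality (AbelianGroup.setoid (cokernel A)) order × ¬ (ℓ ∣ order) )
      × ( ℓ ∣ k′ * r →
            ( (ℓ ∣ k′ × ¬ (ℓ ∣ r)) ⊎ (¬ (ℓ ∣ k′) × ℓ ∣ r) )
          × ( ℓ ∣ k′ → ∀ a → HasValuation ℓ k′ a →
                IsTabulatedBy e ((a , 1) ∷ (0 , f + g) ∷ []) )
          × ( ℓ ∣ r → ∀ a → HasValuation ℓ r a →
                IsTabulatedBy e ((a , f) ∷ (0 , g + 1) ∷ []) ) ) )
  × ( ℓ ∣ q + 1 → 2 ∣ n →
        let h = qInt (q ^ 2) ((n ∸ 2) / 2) in
        ∀ a b c → HasValuation ℓ (q + 1) a → HasValuation ℓ (q * h ∸ 1) b → HasValuation ℓ h c →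
          ( b ≡ 0 ⊎ c ≡ 0 )
        × ( b ≡ 0 → c ≡ 0 →
              IsTabulatedBy e ((2 * a , f) ∷ (a , g ∸ f + 2) ∷ (0 , f ∸ 1) ∷ []) )
        × ( 0 < b →
              IsTabulatedBy e ((2 * a + b , f) ∷ (a , g ∸ f + 2) ∷ (0 , f ∸ 1) ∷ []) )
        × ( 0 < c →
              IsTabulatedBy e ((2 * a + c , 1) ∷ (2 * a , f ∸ 1) ∷ (a , g ∸ f + 2) ∷ (0 , f ∸ 1) ∷ []) ) )
  × ( ℓ ∣ q + 1 → ¬ (2 ∣ n) →
        ∀ a → HasValuation ℓ (q + 1) a →
          IsTabulatedBy e ((a , g + 1) ∷ (0 , f) ∷ []) )
mainTheorem6 p (suc t) q (suc (suc (suc (suc n)))) p-prime _ q≡ (s≤s (s≤s (s≤s (s≤s _)))) F isField V dim N vertices A isAdj S ℓ ℓ-prime ℓ≢p =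
  -- The tables are proved for geometric sums; the substitutions replace these by `qInt` and s t by
  -- k′.
  subst (λ m → Multiplicities S ℓ q (q + 1) m (q * (q + 1) * qInt q (2 + n)) (q ^ 2 * qInt q (1 + n) ∸ 1) h Even Odd) (trans (sym points) (sym (qInt≡ (4 + n))))
    (subst₂ (λ k′ r → Multiplicities S ℓ q (q + 1) (suc (suc f)) k′ r h Even Odd)
      (trans (valency q G₂) (cong (_*_ (q * (q + 1))) (sym (qInt≡ (2 + n)))))
      (cong (λ x → q ^ 2 * x ∸ 1) (sym (qInt≡ (1 + n))))
      (multiplicities G S ℓ-prime ℓ∤q (trans T≡ (cong (r +_) (+-comm 1 q))) 2m≤N even odd))
  where
  1<q : 1 < q
  1<q = subst (1 <_) (sym q≡) (≤-trans 1<p (m≤m*n p (p ^ t) {{m^n≢0 p t {{>-nonZero (<⇒≤ 1<p)}}}}))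
    where
    1<p : 1 < p
    1<p = nonTrivial⇒n>1 p {{prime⇒nonTrivial p-prime}}

  instance
    q≢0 : NonZero q
    q≢0 = >-nonZero (<⇒≤ 1<q)

  ℓ∤q : ¬ ℓ ∣ q
  ℓ∤q ℓ∣q = ℓ≢p (prime∣prime^ (suc t) ℓ-prime p-prime (subst (ℓ ∣_) q≡ ℓ∣q))

  qInt≡ : ∀ k → qInt q k ≡ geometric q k
  qInt≡ k = qInt≡geometric k 1<q

  Even Odd : Set
  Even = 2 ∣ 4 + n
  Odd = ¬ 2 ∣ 4 + n

  -- `n` is now the dimension minus 4. `T` is q [dim - 2], and `f` is [dim] - 2, so that `suc f` is
  -- the f of the theorem and `suc (suc f)` the number of points.
  G₁ G₂ T r f h : ℕ
  G₁ = geometric q (1 + n)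
  G₂ = geometric q (2 + n)
  T = q * G₂
  r = q ^ 2 * G₁ ∸ 1
  f = pred (q * suc T)
  h = qInt (q ^ 2) ((2 + n) / 2)

  instance
    G₁≢0 : NonZero G₁
    G₁≢0 = subst NonZero (sym (geometric-suc q n)) _

    q²G₁≢0 : NonZero (q ^ 2 * G₁)
    q²G₁≢0 = m*n≢0 (q ^ 2) G₁ {{m^n≢0 q 2}}

    q*1+T≢0 : NonZero (q * suc T)
    q*1+T≢0 = m*n≢0 q (suc T)

  f≡ : suc f ≡ q * suc T
  f≡ = suc-pred (q * suc T)

  points : geometric q (4 + n) ≡ suc (suc f)
  points = trans (geometric-suc q (3 + n)) (cong suc
    (trans (cong (q *_) (geometric-suc q (2 + n))) (sym f≡)))

  G₂≡ : G₂ ≡ suc (q * G₁)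
  G₂≡ = geometric-suc q (1 + n)

  T≡ : T ≡ r + suc q
  T≡ = begin
    q * G₂                    ≡⟨ cong (q *_) G₂≡ ⟩
    q * suc (q * G₁)          ≡⟨ expand q G₁ ⟩
    q ^ 2 * G₁ + q            ≡⟨ cong (_+ q) (m∸n+n≡m (>-nonZero⁻¹ (q ^ 2 * G₁))) ⟨
    r + 1 + q                 ≡⟨ +-assoc r 1 q ⟩
    r + suc q                 ∎
    where
    open ≡-Reasoning
    expand : ∀ q g → q * (1 + q * g) ≡ q * (q * 1) * g + q
    expand = solve-∀

  valency : ∀ q g → (q + 1) * (q * g) ≡ q * (q + 1) * g
  valency = solve-∀

  1+q≤G₂ : 1 + q ≤ G₂
  1+q≤G₂ = subst (1 + q ≤_) (sym G₂≡) (s≤s (m≤m*n q G₁))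

  G : PointLineGeometry (suc f) N q (q + 1) T r A
  G = subst (λ s → PointLineGeometry (suc f) N q s T r A) (+-comm 1 q)
    (Covering.geometry isField V (subst (LinearAlgebra.Representatives isField V (whole V)) points
        (LinearAlgebra.representatives isField V dim))
      vertices (<⇒≤ 1<q) (≤-trans (s≤s z≤n) (≤-trans 1+q≤G₂ (m≤n*m G₂ q))) (cong suc f≡) T≡ isAdj)

  -- Counting incident pairs gives N (q + 1) = m (T + 1). Dimension at least 4 makes `G₂` at least q
  -- + 1, and q ≥ 2, so T is at least 2 (q + 1).
  2m≤N : suc (suc f) * 2 ≤ N
  2m≤N = *-cancelʳ-≤ (suc (suc f) * 2) N (q + 1) {{subst NonZero (+-comm 1 q) _}} (begin
    suc (suc f) * 2 * (q + 1)      ≡⟨ *-assoc (suc (suc f)) 2 (q + 1) ⟩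
    suc (suc f) * (2 * (q + 1))    ≤⟨ *-monoʳ-≤ (suc (suc f)) (≤-trans (*-mono-≤ 1<q (≤-trans (≤-reflexive (+-comm q 1)) 1+q≤G₂)) (n≤1+n T)) ⟩
    suc (suc f) * suc T            ≡⟨ PointLineGeometryProperties.doubleCount G ⟨
    N * (q + 1)                    ∎)
    where open ≤-Reasoning

  even : Even → T ≡ q * ((q + 1) * h)
  even 2∣n with half (2 + n)
  ... | k , inj₂ eq = contradiction (subst (2 ∣_) (cong (2 +_) eq) 2∣n)
    (subst (λ x → ¬ 2 ∣ suc (suc x)) (+-suc k k) (2∤1+k+k (suc k)))
  ... | k , inj₁ eq = cong (q *_) (begin
    geometric q (2 + n)                            ≡⟨ cong (geometric q) eq ⟩
    geometric q (k + k)                            ≡⟨ geometric-even q k ⟩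
    (q + 1) * geometric (q ^ 2) k                  ≡⟨ cong ((q + 1) *_) (qInt≡geometric k 1<q²) ⟨
    (q + 1) * qInt (q ^ 2) k                       ≡⟨ cong (λ x → (q + 1) * qInt (q ^ 2) x) (trans (cong (_/ 2) eq) ([k+k]/2≡k k)) ⟨
    (q + 1) * h                                    ∎)
    where
    open ≡-Reasoning
    1<q² : 1 < q ^ 2
    1<q² = ≤-trans 1<q (m≤m*n q (q * 1) {{m*n≢0 q 1}})

  odd : ℓ ∣ q + 1 → Odd → ¬ ℓ ∣ T
  odd ℓ∣q+1 2∤n ℓ∣T with half (2 + n)
  ... | k , inj₁ eq = 2∤n (subst (2 ∣_) (sym (trans (cong (2 +_) eq) (cong suc (sym (+-suc k k))))) (2∣k+k (suc k)))
  ... | k , inj₂ eq with euclidsLemma q G₂ ℓ-prime ℓ∣T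
  ...   | inj₁ ℓ∣q = ℓ∤q ℓ∣q
  ...   | inj₂ ℓ∣G₂ = <⇒≢ (1<prime ℓ-prime) (sym (∣1⇒≡1 (∣m+n∣m⇒∣n (subst (ℓ ∣_) G₂≡′ ℓ∣G₂)
    (∣n⇒∣m*n q (subst (ℓ ∣_) (*-comm (geometric (q ^ 2) k) (q + 1)) (∣n⇒∣m*n (geometric (q ^ 2) k) ℓ∣q+1))))))
    where
    -- An odd number of terms leaves 1 after the factor q + 1 is taken out of the others, so `G₂` is
    -- 1 modulo `ℓ`.
    G₂≡′ : G₂ ≡ q * ((q + 1) * geometric (q ^ 2) k) + 1
    G₂≡′ = trans (cong (geometric q) eq) (trans (geometric-suc q (k + k))
      (trans (cong (λ x → suc (q * x)) (geometric-even q k)) (+-comm 1 _)))
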